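{- $\mathsf{ZF}+\mathsf{DC}$ proves that for every notion of forcing $\mathbb P$, $\mathbb P$ satisfies $\mathrm{CCC}_3$ if and only if $\mathbb P$ satisfies Mekler's definition of the countable chain condition, i.e. for all sufficiently large $\kappa$, whenever $M\prec H_\kappa$ is a countable elementary submodel with $\mathbb P\in M$, every condition of $\mathbb P$ is $M$-generic (equivalently, $\mathbf 1_{\mathbb P}$ is $M$-generic).
   Context: $\mathsf{DC}$ is the Principle of Dependent Choice. A notion of forcing is a preordered set $\mathbb P$ with a maximum $\mathbf 1_{\mathbb P}$. Conditions are compatible if they have a common extension. $D\subseteq\mathbb P$ is predense if every $p\in\mathbb P$ is compatible with some member of $D$; $D$ is predense below $q$ if every $p\le q$ is compatible with some member of $D$. $\mathbb P$ is $\mathrm{CCC}_3$ if every predense subset of $\mathbb P$ contains a countable predense subset. In $\mathsf{ZF}$, $H_\kappa$ is the set of those $x$ whose transitive closure does not map onto $\kappa$. For a countable $M\prec H_\kappa$ with $\mathbb P\in M$, a condition $q\in\mathbb P$ is $M$-generic if for every predense $D\subseteq\mathbb P$ with $D\in M$, the set $D\cap M$ is predense below $q$. -}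

module Defs where

open import Level using (Level)
open import Data.Nat.Base using (ℕ; zero; suc)
open import Data.Fin.Base using (Fin)
open import Data.Vec.Base using (Vec; _∷_; lookup)
open import Data.Product using (_×_; ∃-syntax)
open import Data.Sum using (_⊎_)
open import Function.Bundles using (_⇔_)
open import Relation.Nullary using (¬_)
open import Relation.Binary.PropositionalEquality using (_≡_; _≢_)

-- First-order formulas of the language {∈} with n free variables (de Bruijn
-- indices).  They occur only in the Separation and Replacement schemes;
-- elementarity of submodels uses formulas coded as sets (IsFormula below).
data Formula (n : ℕ) : Set where
  mem eq          : Fin n → Fin n → Formula n
  neg             : Formula n → Formula n
  and or imp iff  : Formula n → Formula n → Formula n
  all ex          : Formula (suc n) → Formula n

-- All set-theoretic notions below quantify over V only, so each is (for IsZF: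
-- is a scheme of) first-order assertions about (V , ∈).  Set-theoretic
-- operations are rendered by their graphs.
module SetTheory {ℓ : Level} {V : Set ℓ} (_∈_ : V → V → Set ℓ) where

  infix 4 _⊆_ ⟨_,_⟩∈_ _≺_ _⊨_[_]

  ⟦_⟧ : ∀ {n} → Formula n → Vec V n → Set ℓ
  ⟦ mem i j ⟧ ρ = lookup ρ i ∈ lookup ρ j
  ⟦ eq  i j ⟧ ρ = lookup ρ i ≡ lookup ρ j
  ⟦ neg φ   ⟧ ρ = ¬ ⟦ φ ⟧ ρ
  ⟦ and φ ψ ⟧ ρ = ⟦ φ ⟧ ρ × ⟦ ψ ⟧ ρ
  ⟦ or  φ ψ ⟧ ρ = ⟦ φ ⟧ ρ ⊎ ⟦ ψ ⟧ ρ
  ⟦ imp φ ψ ⟧ ρ = ⟦ φ ⟧ ρ → ⟦ ψ ⟧ ρ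
  ⟦ iff φ ψ ⟧ ρ = ⟦ φ ⟧ ρ ⇔ ⟦ ψ ⟧ ρ
  ⟦ all φ   ⟧ ρ = ∀ x → ⟦ φ ⟧ (x ∷ ρ)
  ⟦ ex  φ   ⟧ ρ = ∃[ x ] ⟦ φ ⟧ (x ∷ ρ)

  _⊆_ : V → V → Set ℓ
  x ⊆ y = ∀ z → z ∈ x → z ∈ y

  IsEmpty : V → Set ℓ
  IsEmpty e = ∀ x → ¬ (x ∈ e)

  -- e = x ∩ y
  IsIntersection : V → V → V → Set ℓ
  IsIntersection e x y = ∀ z → z ∈ e ⇔ (z ∈ x × z ∈ y)

  -- z = {x , y}
  IsPair : V → V → V → Set ℓ
  IsPair z x y = ∀ w → w ∈ z ⇔ (w ≡ x ⊎ w ≡ y)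

  -- p = ⟨x , y⟩ (Kuratowski)
  IsOPair : V → V → V → Set ℓ
  IsOPair p x y = ∃[ a ] ∃[ b ] IsPair a x x × IsPair b x y × IsPair p a b

  -- t = ⟨x , ⟨y , z⟩⟩
  IsTriple : V → V → V → V → Set ℓ
  IsTriple t x y z = ∃[ p ] IsOPair p y z × IsOPair t x p

  ⟨_,_⟩∈_ : V → V → V → Set ℓ
  ⟨ x , y ⟩∈ r = ∃[ p ] IsOPair p x y × p ∈ r

  -- s = n ∪ {n}
  IsSuc : V → V → Set ℓ
  IsSuc s n = ∀ w → w ∈ s ⇔ (w ∈ n ⊎ w ≡ n)

  Inductive : V → Set ℓ
  Inductive w = (∃[ e ] IsEmpty e × e ∈ w)
              × (∀ n → n ∈ w → ∃[ s ] IsSuc s n × s ∈ w)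

  IsOmega : V → Set ℓ
  IsOmega w = Inductive w × (∀ w′ → Inductive w′ → w ⊆ w′)

  -- n ∈ ω
  IsNat : V → Set ℓ
  IsNat n = ∃[ w ] IsOmega w × n ∈ w

  IsRelation : V → V → V → Set ℓ
  IsRelation r A B = ∀ p → p ∈ r → ∃[ x ] ∃[ y ] x ∈ A × y ∈ B × IsOPair p x y

  -- f : A → B
  IsFunction : V → V → V → Set ℓ
  IsFunction f A B = IsRelation f A B
                   × (∀ x → x ∈ A → ∃[ y ] ⟨ x , y ⟩∈ f)
                   × (∀ x y y′ → ⟨ x , y ⟩∈ f → ⟨ x , y′ ⟩∈ f → y ≡ y′)

  IsInjection : V → V → V → Set ℓ
  IsInjection f A B = IsFunction f A B
                    × (∀ x x′ y → ⟨ x , y ⟩∈ f → ⟨ x′ , y ⟩∈ f → x ≡ x′)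

  IsSurjection : V → V → V → Set ℓ
  IsSurjection f A B = IsFunction f A B
                     × (∀ y → y ∈ B → ∃[ x ] ⟨ x , y ⟩∈ f)

  MapsOnto : V → V → Set ℓ
  MapsOnto A B = ∃[ f ] IsSurjection f A B

  Equinumerous : V → V → Set ℓ
  Equinumerous A B = ∃[ f ] IsInjection f A B × IsSurjection f A B

  -- Finite sets count as countable.
  Countable : V → Set ℓ
  Countable A = ∃[ w ] ∃[ f ] IsOmega w × IsInjection f A w

  record IsZF : Set ℓ where
    field
      extensionality : ∀ x y → (∀ z → z ∈ x ⇔ z ∈ y) → x ≡ y
      foundation     : ∀ a → (∃[ x ] x ∈ a) →
                       ∃[ x ] x ∈ a × (∀ y → y ∈ x → ¬ (y ∈ a))
      pairing        : ∀ x y → ∃[ z ] IsPair z x y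
      union          : ∀ a → ∃[ u ] (∀ x → x ∈ u ⇔ (∃[ y ] x ∈ y × y ∈ a))
      powerset       : ∀ a → ∃[ p ] (∀ x → x ∈ p ⇔ x ⊆ a)
      infinity       : ∃[ w ] Inductive w
      separation     : ∀ {n} (φ : Formula (suc n)) (ρ : Vec V n) a →
                       ∃[ b ] (∀ x → x ∈ b ⇔ (x ∈ a × ⟦ φ ⟧ (x ∷ ρ)))
      replacement    : ∀ {n} (φ : Formula (suc (suc n))) (ρ : Vec V n) a →
                       (∀ x y y′ → x ∈ a → ⟦ φ ⟧ (x ∷ y ∷ ρ) →
                          ⟦ φ ⟧ (x ∷ y′ ∷ ρ) → y ≡ y′) →
                       ∃[ b ] (∀ y → y ∈ b ⇔ (∃[ x ] x ∈ a × ⟦ φ ⟧ (x ∷ y ∷ ρ)))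

  DC : Set ℓ
  DC = ∀ X R → (∃[ x ] x ∈ X) →
       (∀ x → x ∈ X → ∃[ y ] y ∈ X × ⟨ x , y ⟩∈ R) →
       ∃[ w ] ∃[ f ] IsOmega w × IsFunction f w X ×
         (∀ n s x y → n ∈ w → IsSuc s n → ⟨ n , x ⟩∈ f → ⟨ s , y ⟩∈ f → ⟨ x , y ⟩∈ R)

  Transitive : V → Set ℓ
  Transitive t = ∀ x → x ∈ t → x ⊆ t

  -- Well-foundedness of ∈ on α is supplied by the axiom of foundation.
  IsOrdinal : V → Set ℓ
  IsOrdinal α = Transitive α
              × (∀ x y → x ∈ α → y ∈ α → x ∈ y ⊎ x ≡ y ⊎ y ∈ x)

  -- Well-ordered cardinals, i.e. initial ordinals.
  IsCardinal : V → Set ℓ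
  IsCardinal κ = IsOrdinal κ × (∀ α → α ∈ κ → ¬ Equinumerous α κ)

  IsTransitiveClosure : V → V → Set ℓ
  IsTransitiveClosure t x = Transitive t × x ⊆ t
                          × (∀ t′ → Transitive t′ → x ⊆ t′ → t ⊆ t′)

  -- H = H_κ
  IsH : V → V → Set ℓ
  IsH κ H = ∀ x → x ∈ H ⇔ (∃[ t ] IsTransitiveClosure t x × ¬ MapsOnto t κ)

  IsNumeral : ℕ → V → Set ℓ
  IsNumeral zero    v = IsEmpty v
  IsNumeral (suc k) v = ∃[ u ] IsNumeral k u × IsSuc v u

  -- Codes of formulas as sets of V:
  --   ⌜vᵢ ∈ vⱼ⌝ = ⟨0,⟨i,j⟩⟩,  ⌜vᵢ = vⱼ⌝ = ⟨1,⟨i,j⟩⟩,  ⌜¬φ⌝ = ⟨2,φ⟩,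
  --   ⌜φ ∧ ψ⌝ = ⟨3,⟨φ,ψ⟩⟩,  ⌜∃vᵢ φ⌝ = ⟨4,⟨i,φ⟩⟩,   with i , j ∈ ω.
  -- As ω is that of V, these include formulas of nonstandard length when ω is
  -- nonstandard, as they must for "M ≺ H" to be a notion of set theory.
  IsMemCode IsEqCode IsAndCode IsExCode : V → V → V → Set ℓ
  IsMemCode c i j = ∃[ k ] IsNumeral 0 k × IsTriple c k i j
  IsEqCode  c i j = ∃[ k ] IsNumeral 1 k × IsTriple c k i j
  IsAndCode c φ ψ = ∃[ k ] IsNumeral 3 k × IsTriple c k φ ψ
  IsExCode  c i φ = ∃[ k ] IsNumeral 4 k × IsTriple c k i φ

  IsNegCode : V → V → Set ℓ
  IsNegCode c φ = ∃[ k ] IsNumeral 2 k × IsOPair c k φ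

  record FormulaClosed (F : V) : Set ℓ where
    field
      mem-closed : ∀ c i j → IsNat i → IsNat j → IsMemCode c i j → c ∈ F
      eq-closed  : ∀ c i j → IsNat i → IsNat j → IsEqCode c i j → c ∈ F
      neg-closed : ∀ c φ → φ ∈ F → IsNegCode c φ → c ∈ F
      and-closed : ∀ c φ ψ → φ ∈ F → ψ ∈ F → IsAndCode c φ ψ → c ∈ F
      ex-closed  : ∀ c i φ → IsNat i → φ ∈ F → IsExCode c i φ → c ∈ F

  IsFormula : V → Set ℓ
  IsFormula φ = ∀ F → FormulaClosed F → φ ∈ F

  -- s : ω → A, assigning s(i) to the variable vᵢ
  IsAssignment : V → V → Set ℓ
  IsAssignment s A = ∃[ w ] IsOmega w × IsFunction s w A

  -- s′ = s[i ↦ a]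
  IsUpdate : V → V → V → V → V → Set ℓ
  IsUpdate A s′ s i a = IsAssignment s′ A × ⟨ i , a ⟩∈ s′
                      × (∀ j x → j ≢ i → ⟨ j , x ⟩∈ s → ⟨ j , x ⟩∈ s′)

  -- S is a set obeying Tarski's clauses for the structure (A , ∈), where
  -- ⟨φ,s⟩ ∈ S means that s satisfies φ.
  record IsSatisfaction (A S : V) : Set ℓ where
    field
      sat-mem : ∀ c i j s → IsNat i → IsNat j → IsMemCode c i j → IsAssignment s A →
                ⟨ c , s ⟩∈ S ⇔ (∃[ x ] ∃[ y ] ⟨ i , x ⟩∈ s × ⟨ j , y ⟩∈ s × x ∈ y)
      sat-eq  : ∀ c i j s → IsNat i → IsNat j → IsEqCode c i j → IsAssignment s A →
                ⟨ c , s ⟩∈ S ⇔ (∃[ x ] ∃[ y ] ⟨ i , x ⟩∈ s × ⟨ j , y ⟩∈ s × x ≡ y)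
      sat-neg : ∀ c φ s → IsFormula φ → IsNegCode c φ → IsAssignment s A →
                ⟨ c , s ⟩∈ S ⇔ (¬ ⟨ φ , s ⟩∈ S)
      sat-and : ∀ c φ ψ s → IsFormula φ → IsFormula ψ → IsAndCode c φ ψ →
                IsAssignment s A →
                ⟨ c , s ⟩∈ S ⇔ (⟨ φ , s ⟩∈ S × ⟨ ψ , s ⟩∈ S)
      sat-ex  : ∀ c i φ s → IsNat i → IsFormula φ → IsExCode c i φ →
                IsAssignment s A →
                ⟨ c , s ⟩∈ S ⇔
                  (∃[ a ] ∃[ s′ ] a ∈ A × IsUpdate A s′ s i a × ⟨ φ , s′ ⟩∈ S)

  _⊨_[_] : V → V → V → Set ℓ
  A ⊨ φ [ s ] = ∃[ S ] IsSatisfaction A S × ⟨ φ , s ⟩∈ S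

  _≺_ : V → V → Set ℓ
  M ≺ N = M ⊆ N
        × (∀ φ s → IsFormula φ → IsAssignment s M → M ⊨ φ [ s ] ⇔ N ⊨ φ [ s ])

  -- ℙ = ⟨P , ⟨L , 𝟏⟩⟩, where L is the preorder and 𝟏 the chosen maximum.
  record IsForcing (ℙ P L 𝟏 : V) : Set ℓ where
    field
      triple      : IsTriple ℙ P L 𝟏
      relation    : IsRelation L P P
      reflexive   : ∀ p → p ∈ P → ⟨ p , p ⟩∈ L
      transitive  : ∀ p q r → ⟨ p , q ⟩∈ L → ⟨ q , r ⟩∈ L → ⟨ p , r ⟩∈ L
      𝟏∈P         : 𝟏 ∈ P
      𝟏-maximum   : ∀ p → p ∈ P → ⟨ p , 𝟏 ⟩∈ L

  module _ (P L : V) where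

    Compatible : V → V → Set ℓ
    Compatible p q = ∃[ r ] r ∈ P × ⟨ r , p ⟩∈ L × ⟨ r , q ⟩∈ L

    Predense : V → Set ℓ
    Predense D = D ⊆ P × (∀ p → p ∈ P → ∃[ d ] d ∈ D × Compatible p d)

    CCC₃ : Set ℓ
    CCC₃ = ∀ D → Predense D → ∃[ C ] C ⊆ D × Countable C × Predense C

    PredenseBelow : V → V → Set ℓ
    PredenseBelow q D = ∀ p → p ∈ P → ⟨ p , q ⟩∈ L → ∃[ d ] d ∈ D × Compatible p d

    IsGeneric : V → V → Set ℓ
    IsGeneric M q = ∀ D → Predense D → D ∈ M →
                    ∃[ E ] IsIntersection E D M × PredenseBelow q E

  -- M ≺ H_κ is countable and ℙ ∈ M.
  IsCountableSubmodel : V → V → V → Set ℓ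
  IsCountableSubmodel ℙ κ M = Countable M × (∃[ H ] IsH κ H × M ≺ H) × ℙ ∈ M

  MeklerCCC : V → V → V → Set ℓ
  MeklerCCC ℙ P L =
    ∃[ κ₀ ] IsCardinal κ₀ ×
      (∀ κ → IsCardinal κ → κ₀ ⊆ κ →
       ∀ M → IsCountableSubmodel ℙ κ M → ∀ q → q ∈ P → IsGeneric P L M q)

{-# OPTIONS --safe #-}
-- If ℙ is CCC₃ and D ∈ M is predense, some countable C ⊆ D is predense; an
-- injection of C into ω lies in H_κ once κ is not an image of a suitable set, so by
-- elementarity such an injection f lies in M.  As ω ⊆ M, each element of the domain
-- of f is in M, hence D ∩ M is predense.  Conversely, given a predense D, take κ so
-- large that ℙ , D ∈ H_κ.  Dependent choice yields a countable M ≺ H_κ containing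
-- both, and D ∩ M is a countable predense subset of D.
--
-- Without choice, "κ is large" means that κ is not an image of a given set X; the
-- least such κ is the Lindenbaum number of X.  Rank bounds H_κ: a transitive set
-- that omits some rank β ∈ κ is included in the β-th level of the cumulative hierarchy.
module Submission where

open import Defs
open import Level using (Level)
open import Data.Nat.Base using (ℕ; zero; suc; _∸_; _<_)
open import Data.Nat.Properties using (<-irrefl; m<n⇒m<1+n; n<1+n)
open import Data.Fin.Base using (Fin; zero; suc)
open import Data.Vec.Base using (Vec; []; _∷_; lookup; map)
open import Data.Product using (_×_; _,_; proj₁; proj₂; ∃-syntax)
open import Data.Sum using (_⊎_; inj₁; inj₂; [_,_]′)
open import Data.Empty using (⊥-elim)
open import Function.Base using (id; _∘_)
open import Function.Bundles using (_⇔_; mk⇔; Equivalence)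
open import Relation.Nullary using (¬_; Dec; yes; no; recompute)
open import Relation.Binary.PropositionalEquality using (_≡_; _≢_; refl; sym; trans; cong; subst)
open import Axiom.ExcludedMiddle using (ExcludedMiddle)

open Equivalence using (to; from)

-- Three obstacles shape the proof. Separation and replacement are available for `Formula` only, so
-- every comprehension and every induction in `V` comes with an explicit formula, written so that
-- its denotation computes to the intended notion. Next, `M ≺ H` concerns formulas coded in `V`,
-- possibly of nonstandard length. To produce a submodel, satisfaction has to be constructed in `V`
-- for all codes, by induction inside `V`; to exploit a given submodel, the few standard formulas
-- that are applied to it are translated into codes. Finally, neither a well-ordering of `H` nor
-- Skolem functions are at hand, and the assignments into an infinite set are too many for a
-- countable closure to run through. So a witness is attached to a finite part of an assignment, and
-- the set that is closed up lives in a superset of `H` that also holds codes and such finite parts.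
-- In the other direction, ω and the injection are only known to be in `H`; elementarity yields
-- substitutes in `M`, which need not be the same sets.

-- Formulas are written with bound variables named by Agda variables of type ℕ,
-- which stand for de Bruijn levels.  `var` clamps a level that is out of range;
-- on concrete formulas it computes, so that ⟦ φ ⟧ ρ unfolds to the notion of
-- set theory with the same name.
clamp : (m i : ℕ) → Fin (suc m)
clamp zero    i       = zero
clamp (suc m) zero    = zero
clamp (suc m) (suc i) = suc (clamp m i)

var : ∀ {m} → ℕ → Fin (suc m)
var {m} x = clamp m (m ∸ x)

infix  6 _∈ᶠ_ _≡ᶠ_ _⊆ᶠ_ ⟨_,_⟩∈ᶠ_
infix  5 ¬ᶠ_
infixr 4 _∧ᶠ_
infixr 3 _∨ᶠ_
infixr 2 _⇒ᶠ_
infix  1 _⇔ᶠ_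
infixr 0 ∀ᶠ_ ∃ᶠ_

_∈ᶠ_ _≡ᶠ_ : ∀ {m} → ℕ → ℕ → Formula (suc m)
x ∈ᶠ y = mem (var x) (var y)
x ≡ᶠ y = eq (var x) (var y)

¬ᶠ_ : ∀ {n} → Formula n → Formula n
¬ᶠ_ = neg

_∧ᶠ_ _∨ᶠ_ _⇒ᶠ_ _⇔ᶠ_ : ∀ {n} → Formula n → Formula n → Formula n
_∧ᶠ_ = and
_∨ᶠ_ = or
_⇒ᶠ_ = imp
_⇔ᶠ_ = iff

∀ᶠ_ ∃ᶠ_ : ∀ {n} → (ℕ → Formula (suc n)) → Formula n
∀ᶠ_ {n} φ = all (φ n)
∃ᶠ_ {n} φ = ex (φ n)

-- Position i holds level k-1-i, which reverses the conversion made by `var`; hence a `Class` can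
-- name its parameters by matching on this vector.
levels : ∀ k → Vec ℕ k
levels zero    = []
levels (suc k) = k ∷ levels k

Class Class₂ : ℕ → Set
Class k  = Vec ℕ k → ℕ → Formula (suc k)
Class₂ k = Vec ℕ k → ℕ → ℕ → Formula (suc (suc k))

_⊆ᶠ_ : ∀ {m} → ℕ → ℕ → Formula (suc m)
x ⊆ᶠ y = ∀ᶠ λ z → z ∈ᶠ x ⇒ᶠ z ∈ᶠ y

IsEmptyᶠ : ∀ {m} → ℕ → Formula (suc m)
IsEmptyᶠ e = ∀ᶠ λ x → ¬ᶠ (x ∈ᶠ e)

IsPairᶠ IsOPairᶠ ⟨_,_⟩∈ᶠ_ : ∀ {m} → ℕ → ℕ → ℕ → Formula (suc m)
IsPairᶠ z x y = ∀ᶠ λ w → w ∈ᶠ z ⇔ᶠ (w ≡ᶠ x ∨ᶠ w ≡ᶠ y)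
IsOPairᶠ p x y = ∃ᶠ λ a → ∃ᶠ λ b → IsPairᶠ a x x ∧ᶠ IsPairᶠ b x y ∧ᶠ IsPairᶠ p a b
⟨ x , y ⟩∈ᶠ r = ∃ᶠ λ p → IsOPairᶠ p x y ∧ᶠ p ∈ᶠ r

IsSucᶠ : ∀ {m} → ℕ → ℕ → Formula (suc m)
IsSucᶠ s n = ∀ᶠ λ w → w ∈ᶠ s ⇔ᶠ (w ∈ᶠ n ∨ᶠ w ≡ᶠ n)

Inductiveᶠ Transitiveᶠ : ∀ {m} → ℕ → Formula (suc m)
Inductiveᶠ w = (∃ᶠ λ e → IsEmptyᶠ e ∧ᶠ e ∈ᶠ w)
            ∧ᶠ (∀ᶠ λ n → n ∈ᶠ w ⇒ᶠ (∃ᶠ λ s → IsSucᶠ s n ∧ᶠ s ∈ᶠ w))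
Transitiveᶠ t = ∀ᶠ λ x → x ∈ᶠ t ⇒ᶠ x ⊆ᶠ t

-- Basic set operations and foundation

module ZF {ℓ : Level} (em : ExcludedMiddle ℓ) {V : Set ℓ} (_∈_ : V → V → Set ℓ)
          (zf : SetTheory.IsZF _∈_) where

  open SetTheory _∈_
  open IsZF zf

  infix 4 _∉_
  infixl 6 _∪_

  _∉_ : V → V → Set ℓ
  x ∉ y = ¬ (x ∈ y)

  by-contradiction : {A : Set ℓ} → ¬ ¬ A → A
  by-contradiction {A} ¬¬a with em {A}
  ... | yes a = a
  ... | no ¬a = ⊥-elim (¬¬a ¬a)

  ¬∀⇒∃¬ : {P : V → Set ℓ} → ¬ (∀ x → P x) → ∃[ x ] ¬ P x
  ¬∀⇒∃¬ ¬∀ = by-contradiction λ ¬∃ → ¬∀ λ x → by-contradiction λ ¬p → ¬∃ (x , ¬p)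

  ⟦_⟧₁ : ∀ {k} → Class k → Vec V k → V → Set ℓ
  ⟦_⟧₁ {k} φ ρ x = ⟦ φ (levels k) k ⟧ (x ∷ ρ)

  ⟦_⟧₂ : ∀ {k} → Class₂ k → Vec V k → V → V → Set ℓ
  ⟦_⟧₂ {k} φ ρ x y = ⟦ φ (levels k) (suc k) k ⟧ (x ∷ y ∷ ρ)

  ext : ∀ {x y} → (∀ z → z ∈ x → z ∈ y) → (∀ z → z ∈ y → z ∈ x) → x ≡ y
  ext x⊆y y⊆x = extensionality _ _ λ z → mk⇔ (x⊆y z) (y⊆x z)

  opaque
    sep : ∀ {k} → V → Vec V k → Class k → V
    sep {k} a ρ φ = proj₁ (separation (φ (levels k) k) ρ a)

    ∈-sep : ∀ {k} a (ρ : Vec V k) (φ : Class k) {x} → x ∈ sep a ρ φ ⇔ (x ∈ a × ⟦ φ ⟧₁ ρ x)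
    ∈-sep {k} a ρ φ {x} = proj₂ (separation (φ (levels k) k) ρ a) x

  opaque
    rep : ∀ {k} (a : V) (ρ : Vec V k) (φ : Class₂ k) →
          (∀ x y y′ → x ∈ a → ⟦ φ ⟧₂ ρ x y → ⟦ φ ⟧₂ ρ x y′ → y ≡ y′) →
          ∃[ b ] (∀ y → y ∈ b ⇔ (∃[ x ] x ∈ a × ⟦ φ ⟧₂ ρ x y))
    rep {k} a ρ φ = replacement (φ (levels k) (suc k) k) ρ a

  opaque
    ∅ : V
    ∅ = proj₁ (proj₁ (proj₂ infinity))

    ∅-empty : ∀ x → x ∉ ∅
    ∅-empty = proj₁ (proj₂ (proj₁ (proj₂ infinity)))

  empty⇒≡∅ : ∀ {e} → IsEmpty e → e ≡ ∅
  empty⇒≡∅ h = ext (λ z z∈ → ⊥-elim (h z z∈)) (λ z z∈ → ⊥-elim (∅-empty z z∈))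

  nonempty : ∀ {a} → a ≢ ∅ → ∃[ x ] x ∈ a
  nonempty a≢∅ = by-contradiction λ ¬∃ → a≢∅ (empty⇒≡∅ λ x x∈ → ¬∃ (x , x∈))

  opaque
    ｛_,_｝ : V → V → V
    ｛ x , y ｝ = proj₁ (pairing x y)

    ∈-pair : ∀ {x y w} → w ∈ ｛ x , y ｝ ⇔ (w ≡ x ⊎ w ≡ y)
    ∈-pair {x} {y} {w} = proj₂ (pairing x y) w

  singleton : V → V
  singleton x = ｛ x , x ｝

  ∈-single : ∀ {x w} → w ∈ singleton x → w ≡ x
  ∈-single h = [ id , id ]′ (to ∈-pair h)

  x∈singleton : ∀ {x} → x ∈ singleton x
  x∈singleton = from ∈-pair (inj₁ refl)

  opaque
    ⋃ : V → V
    ⋃ a = proj₁ (union a)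

    ∈-⋃ : ∀ {a x} → x ∈ ⋃ a ⇔ (∃[ y ] x ∈ y × y ∈ a)
    ∈-⋃ {a} {x} = proj₂ (union a) x

  opaque
    _∪_ : V → V → V
    x ∪ y = ⋃ ｛ x , y ｝

    ∈-∪ : ∀ {x y w} → w ∈ (x ∪ y) ⇔ (w ∈ x ⊎ w ∈ y)
    ∈-∪ {x} {y} {w} = mk⇔ f g
      where
      f : w ∈ (x ∪ y) → w ∈ x ⊎ w ∈ y
      f h with to ∈-⋃ h
      ... | v , w∈v , v∈ with to ∈-pair v∈
      ... | inj₁ refl = inj₁ w∈v
      ... | inj₂ refl = inj₂ w∈v
      g : w ∈ x ⊎ w ∈ y → w ∈ (x ∪ y)
      g (inj₁ h) = from ∈-⋃ (x , h , from ∈-pair (inj₁ refl))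
      g (inj₂ h) = from ∈-⋃ (y , h , from ∈-pair (inj₂ refl))

  opaque
    𝒫 : V → V
    𝒫 a = proj₁ (powerset a)

    ∈-𝒫 : ∀ {a x} → x ∈ 𝒫 a ⇔ x ⊆ a
    ∈-𝒫 {a} {x} = proj₂ (powerset a) x

  adjoin : V → V → V
  adjoin x y = x ∪ singleton y

  ∈-adjoin : ∀ {x y w} → w ∈ adjoin x y ⇔ (w ∈ x ⊎ w ≡ y)
  ∈-adjoin = mk⇔ (λ h → [ inj₁ , inj₂ ∘ ∈-single ]′ (to ∈-∪ h))
                 λ { (inj₁ h) → from ∈-∪ (inj₁ h) ; (inj₂ refl) → from ∈-∪ (inj₂ x∈singleton) }

  opaque
    ⟪_,_⟫ : V → V → V
    ⟪ x , y ⟫ = ｛ singleton x , ｛ x , y ｝ ｝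

    opair-def : ∀ {x y} → ⟪ x , y ⟫ ≡ ｛ singleton x , ｛ x , y ｝ ｝
    opair-def = refl

  isPair : ∀ x y → IsPair ｛ x , y ｝ x y
  isPair x y w = ∈-pair

  pair-unique : ∀ {z x y} → IsPair z x y → z ≡ ｛ x , y ｝
  pair-unique h = ext (λ w w∈ → from ∈-pair (to (h w) w∈)) (λ w w∈ → from (h w) (to ∈-pair w∈))

  isOPair : ∀ x y → IsOPair ⟪ x , y ⟫ x y
  isOPair x y = subst (λ p → IsOPair p x y) (sym opair-def) 
    (singleton x , ｛ x , y ｝ , isPair x x , isPair x y , isPair _ _)

  opair-unique : ∀ {p x y} → IsOPair p x y → p ≡ ⟪ x , y ⟫
  opair-unique (a , b , ha , hb , hp) with pair-unique ha | pair-unique hb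
  ... | refl | refl = trans (pair-unique hp) (sym opair-def)

  pair-cancel : ∀ {x y z} → ｛ x , y ｝ ≡ ｛ x , z ｝ → y ≡ z
  pair-cancel {x} {y} {z} e with to ∈-pair (subst (y ∈_) e (from ∈-pair (inj₂ refl)))
  ... | inj₂ y≡z = y≡z
  ... | inj₁ refl with to ∈-pair (subst (z ∈_) (sym e) (from ∈-pair (inj₂ refl)))
  ...   | inj₁ z≡y = sym z≡y
  ...   | inj₂ z≡y = sym z≡y

  opair-inj : ∀ {x y x′ y′} → ⟪ x , y ⟫ ≡ ⟪ x′ , y′ ⟫ → x ≡ x′ × y ≡ y′
  opair-inj {x} {y} {x′} {y′} e₀ with x≡x′
    where
    e : ｛ singleton x , ｛ x , y ｝ ｝ ≡ ｛ singleton x′ , ｛ x′ , y′ ｝ ｝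
    e = trans (sym opair-def) (trans e₀ opair-def)
    x≡x′ : x ≡ x′
    x≡x′ with to ∈-pair (subst (singleton x ∈_) e (from ∈-pair (inj₁ refl)))
    ... | inj₁ h = ∈-single (subst (x ∈_) h x∈singleton)
    ... | inj₂ h = sym (∈-single (subst (x′ ∈_) (sym h) (from ∈-pair (inj₁ refl))))
  ... | refl = refl , pair-cancel (pair-cancel (trans (sym opair-def) (trans e₀ opair-def)))

  ⟨⟩⇒ : ∀ {x y r} → ⟨ x , y ⟩∈ r → ⟪ x , y ⟫ ∈ r
  ⟨⟩⇒ (p , hp , p∈) with opair-unique hp
  ... | refl = p∈

  ⇒⟨⟩ : ∀ {x y r} → ⟪ x , y ⟫ ∈ r → ⟨ x , y ⟩∈ r
  ⇒⟨⟩ h = _ , isOPair _ _ , h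

  ⟨⟩-mono : ∀ {x y r r′} → r ⊆ r′ → ⟨ x , y ⟩∈ r → ⟨ x , y ⟩∈ r′
  ⟨⟩-mono r⊆r′ (p , hp , p∈) = p , hp , r⊆r′ p p∈

  ⟨⟩∈-adjoin : ∀ {x y a b r} → ⟨ x , y ⟩∈ adjoin r ⟪ a , b ⟫ → ⟨ x , y ⟩∈ r ⊎ (x ≡ a × y ≡ b)
  ⟨⟩∈-adjoin h with to ∈-adjoin (⟨⟩⇒ h)
  ... | inj₁ h′ = inj₁ (⇒⟨⟩ h′)
  ... | inj₂ e  = inj₂ (opair-inj e)

  ⊆-adjoin : ∀ {x y} → x ⊆ adjoin x y
  ⊆-adjoin z z∈ = from ∈-adjoin (inj₁ z∈)

  ⟨⟩∈-adjoin-new : ∀ {r a b} → ⟨ a , b ⟩∈ adjoin r ⟪ a , b ⟫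
  ⟨⟩∈-adjoin-new = ⇒⟨⟩ (from ∈-adjoin (inj₂ refl))

  infixr 5 _⊗_

  _⊗_ : V → V → V
  A ⊗ B = sep (𝒫 (𝒫 (A ∪ B))) (A ∷ B ∷ [])
            λ { (A ∷ B ∷ []) p → ∃ᶠ λ x → ∃ᶠ λ y → x ∈ᶠ A ∧ᶠ y ∈ᶠ B ∧ᶠ IsOPairᶠ p x y }

  ∈-⊗ : ∀ {A B p} → p ∈ (A ⊗ B) → ∃[ x ] ∃[ y ] x ∈ A × y ∈ B × IsOPair p x y
  ∈-⊗ h = proj₂ (to (∈-sep _ _ _) h)

  ∈-⊗-intro : ∀ {A B x y} → x ∈ A → y ∈ B → ⟪ x , y ⟫ ∈ (A ⊗ B)
  ∈-⊗-intro {A} {B} {x} {y} x∈ y∈ = from (∈-sep _ _ _) (from ∈-𝒫 sub , x , y , x∈ , y∈ , isOPair x y)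
    where
    sub : ⟪ x , y ⟫ ⊆ 𝒫 (A ∪ B)
    sub z z∈ = from ∈-𝒫 λ w w∈ → from ∈-∪ ([ (λ { refl → inj₁ (subst (_∈ A) (sym (∈-single w∈)) x∈) })
      , (λ { refl → [ (λ { refl → inj₁ x∈ }) , (λ { refl → inj₂ y∈ }) ]′ (to ∈-pair w∈) }) ]′
      (to ∈-pair (subst (z ∈_) opair-def z∈)))

  ⟨⟩∈-⊗ : ∀ {A B x y} → ⟨ x , y ⟩∈ (A ⊗ B) → x ∈ A × y ∈ B
  ⟨⟩∈-⊗ h with ∈-⊗ (⟨⟩⇒ h)
  ... | _ , _ , x∈ , y∈ , hp with opair-inj (opair-unique hp)
  ... | refl , refl = x∈ , y∈

  ¬x∈x : ∀ {x} → x ∉ x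
  ¬x∈x {x} x∈x with foundation (singleton x) (x , x∈singleton)
  ... | y , y∈ , min with ∈-single y∈
  ... | refl = min x x∈x x∈singleton

  ¬∈-cycle : ∀ {x y} → x ∈ y → y ∉ x
  ¬∈-cycle {x} {y} x∈y y∈x with foundation ｛ x , y ｝ (x , from ∈-pair (inj₁ refl))
  ... | z , z∈ , min with to ∈-pair z∈
  ... | inj₁ refl = min y y∈x (from ∈-pair (inj₂ refl))
  ... | inj₂ refl = min x x∈y (from ∈-pair (inj₁ refl))

  -- Natural numbers

  succ : V → V
  succ n = adjoin n n

  isSuc : ∀ n → IsSuc (succ n) n
  isSuc n w = ∈-adjoin

  suc-unique : ∀ {s n} → IsSuc s n → s ≡ succ n
  suc-unique h = ext (λ w w∈ → from ∈-adjoin (to (h w) w∈)) (λ w w∈ → from (h w) (to ∈-adjoin w∈))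

  n∈succ : ∀ {n} → n ∈ succ n
  n∈succ = from ∈-adjoin (inj₂ refl)

  succ-inj : ∀ {m n} → succ m ≡ succ n → m ≡ n
  succ-inj {m} {n} e with to ∈-adjoin (subst (m ∈_) e n∈succ) | to ∈-adjoin (subst (n ∈_) (sym e) n∈succ)
  ... | inj₂ m≡n | _        = m≡n
  ... | inj₁ _   | inj₂ n≡m = sym n≡m
  ... | inj₁ m∈n | inj₁ n∈m = ⊥-elim (¬∈-cycle m∈n n∈m)

  succ≢∅ : ∀ {n} → succ n ≢ ∅
  succ≢∅ e = ∅-empty _ (subst (_ ∈_) e n∈succ)

  inductive-∅ : ∀ {w} → Inductive w → ∅ ∈ w
  inductive-∅ ((e , he , e∈) , _) = subst (_∈ _) (empty⇒≡∅ he) e∈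

  inductive-succ : ∀ {w n} → Inductive w → n ∈ w → succ n ∈ w
  inductive-succ (_ , h) n∈ with h _ n∈
  ... | s , hs , s∈ = subst (_∈ _) (suc-unique hs) s∈

  mkInductive : ∀ {w} → ∅ ∈ w → (∀ n → n ∈ w → succ n ∈ w) → Inductive w
  mkInductive ∅∈ s∈ = (∅ , ∅-empty , ∅∈) , λ n n∈ → succ n , isSuc n , s∈ n n∈

  ω : V
  ω = sep (proj₁ infinity) [] λ { [] n → ∀ᶠ λ w → Inductiveᶠ w ⇒ᶠ n ∈ᶠ w }

  ∅∈ω : ∅ ∈ ω
  ∅∈ω = from (∈-sep _ _ _) (inductive-∅ (proj₂ infinity) , λ w → inductive-∅)

  succ∈ω : ∀ {n} → n ∈ ω → succ n ∈ ω
  succ∈ω n∈ with to (∈-sep _ _ _) n∈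
  ... | n∈₀ , h = from (∈-sep _ _ _) (inductive-succ (proj₂ infinity) n∈₀ , λ w ind → inductive-succ ind (h w ind))

  isOmega : IsOmega ω
  isOmega = mkInductive ∅∈ω (λ n → succ∈ω) , λ w ind n n∈ → proj₂ (to (∈-sep _ _ _) n∈) w ind

  omega-unique : ∀ {w} → IsOmega w → w ≡ ω
  omega-unique (ind , min) = ext (min ω (proj₁ isOmega)) (proj₂ isOmega _ ind)

  nat⇒∈ω : ∀ {n} → IsNat n → n ∈ ω
  nat⇒∈ω (w , hw , n∈) = subst (_ ∈_) (omega-unique hw) n∈

  ∈ω⇒nat : ∀ {n} → n ∈ ω → IsNat n
  ∈ω⇒nat n∈ = ω , isOmega , n∈

  opaque
    ω-induction : ∀ {k} (ρ : Vec V k) (φ : Class k) → ⟦ φ ⟧₁ ρ ∅ →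
                  (∀ n → n ∈ ω → ⟦ φ ⟧₁ ρ n → ⟦ φ ⟧₁ ρ (succ n)) → ∀ n → n ∈ ω → ⟦ φ ⟧₁ ρ n
    ω-induction ρ φ base step n n∈ = proj₂ (to (∈-sep ω ρ φ) (proj₂ isOmega (sep ω ρ φ) ind n n∈))
      where
      ind : Inductive (sep ω ρ φ)
      ind = mkInductive (from (∈-sep ω ρ φ) (∅∈ω , base)) λ m m∈ →
        let m∈ω , h = to (∈-sep ω ρ φ) m∈ in from (∈-sep ω ρ φ) (succ∈ω m∈ω , step m m∈ω h)

  ω-transitive : Transitive ω
  ω-transitive n n∈ = ω-induction (ω ∷ []) (λ { (ω ∷ []) n → n ⊆ᶠ ω })
    (λ z z∈ → ⊥-elim (∅-empty z z∈))
    (λ m m∈ m⊆ z z∈ → [ m⊆ z , (λ { refl → m∈ }) ]′ (to ∈-adjoin z∈)) n n∈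

  nat-transitive : ∀ n → n ∈ ω → Transitive n
  nat-transitive = ω-induction [] (λ { [] n → Transitiveᶠ n })
    (λ z z∈ → ⊥-elim (∅-empty z z∈))
    (λ m m∈ tr x x∈ → [ (λ x∈m z z∈ → ⊆-adjoin z (tr x x∈m z z∈)) , (λ { refl → ⊆-adjoin }) ]′ (to ∈-adjoin x∈))

  ∅∈succ : ∀ n → n ∈ ω → ∅ ∈ succ n
  ∅∈succ n n∈ = from ∈-adjoin (h n n∈)
    where
    h : ∀ n → n ∈ ω → (∅ ∈ n ⊎ ∅ ≡ n)
    h = ω-induction (∅ ∷ []) (λ { (∅ ∷ []) n → ∅ ∈ᶠ n ∨ᶠ ∅ ≡ᶠ n })
          (inj₂ refl) (λ m m∈ h → inj₁ (from ∈-adjoin h))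

  succ-mono : ∀ {m} n → n ∈ ω → m ∈ n → succ m ∈ succ n
  succ-mono {m} n n∈ m∈n = from ∈-adjoin (h n n∈ (succ m) (isSuc m) m∈n)
    where
    -- The language of formulas has no term for `succ m`, so the induction ranges over every s with
    -- `IsSuc s m`.
    h : ∀ n → n ∈ ω → ∀ s → IsSuc s m → m ∈ n → (s ∈ n ⊎ s ≡ n)
    h = ω-induction (m ∷ []) (λ { (m ∷ []) n → ∀ᶠ λ s → IsSucᶠ s m ⇒ᶠ m ∈ᶠ n ⇒ᶠ (s ∈ᶠ n ∨ᶠ s ≡ᶠ n) })
          (λ s hs m∈ → ⊥-elim (∅-empty _ m∈))
          λ k k∈ ih s hs m∈ → [ (λ m∈k → inj₁ (from ∈-adjoin (ih s hs m∈k)))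
                              , (λ { refl → inj₂ (suc-unique hs) }) ]′ (to ∈-adjoin m∈)

  -- A strict upper bound takes the place of the maximum, which would require comparing m and n. The
  -- induction on n passes from k to `succ k`, and `succ-mono` puts `succ n` below it.
  ω-directed : ∀ {m n} → m ∈ ω → n ∈ ω → ∃[ k ] k ∈ ω × m ∈ k × n ∈ k
  ω-directed {m} {n} m∈ω n∈ω = ω-induction (m ∷ ω ∷ [])
    (λ { (m ∷ ω ∷ []) n → ∃ᶠ λ k → k ∈ᶠ ω ∧ᶠ m ∈ᶠ k ∧ᶠ n ∈ᶠ k })
    (succ m , succ∈ω m∈ω , n∈succ , ∅∈succ m m∈ω)
    (λ { n n∈ (k , k∈ , m∈k , n∈k) → succ k , succ∈ω k∈ , ⊆-adjoin _ m∈k , succ-mono k k∈ n∈k }) n n∈ω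

  -- Iterated unions and the transitive closure

  -- Stage x m u says that u is the m-th iterated union of x.
  Chain : V → V → Set ℓ
  Chain x f = ∀ m u → ⟨ m , u ⟩∈ f → (IsEmpty m × u ≡ x)
            ⊎ (∃[ k ] ∃[ v ] IsSuc m k × ⟨ k , v ⟩∈ f × (∀ y → y ∈ u ⇔ (∃[ z ] y ∈ z × z ∈ v)))

  Stage : V → V → V → Set ℓ
  Stage x m u = ∃[ f ] Chain x f × ⟨ m , u ⟩∈ f

  Stageᶠ : ∀ {m} → ℕ → ℕ → ℕ → Formula (suc m)
  Stageᶠ x m u = ∃ᶠ λ f →
    (∀ᶠ λ m → ∀ᶠ λ u → ⟨ m , u ⟩∈ᶠ f ⇒ᶠ
      ((IsEmptyᶠ m ∧ᶠ u ≡ᶠ x)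
       ∨ᶠ (∃ᶠ λ k → ∃ᶠ λ v → IsSucᶠ m k ∧ᶠ ⟨ k , v ⟩∈ᶠ f
            ∧ᶠ (∀ᶠ λ y → y ∈ᶠ u ⇔ᶠ (∃ᶠ λ z → y ∈ᶠ z ∧ᶠ z ∈ᶠ v)))))
    ∧ᶠ ⟨ m , u ⟩∈ᶠ f

  stage-∅ : ∀ {x u} → Stage x ∅ u → u ≡ x
  stage-∅ (f , ch , h) with ch _ _ h
  ... | inj₁ (_ , e) = e
  ... | inj₂ (k , _ , hs , _) = ⊥-elim (succ≢∅ (sym (suc-unique hs)))

  stage-succ : ∀ {x m u} → Stage x (succ m) u → ∃[ v ] Stage x m v × u ≡ ⋃ v
  stage-succ (f , ch , h) with ch _ _ h
  ... | inj₁ (e , _) = ⊥-elim (e _ n∈succ)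
  ... | inj₂ (k , v , hs , kv , hu) with succ-inj (suc-unique hs)
  ... | refl = v , (f , ch , kv) , ext (λ y y∈ → from ∈-⋃ (to (hu y) y∈)) (λ y y∈ → from (hu y) (to ∈-⋃ y∈))

  -- A `Chain` is only a relation whose pairs are justified by earlier pairs, so two chains might
  -- disagree. Excluding this is what lets replacement collect the stages in `transitive-superset`.
  stage-unique : ∀ x m → m ∈ ω → ∀ u u′ → Stage x m u → Stage x m u′ → u ≡ u′
  stage-unique x = ω-induction (x ∷ [])
    (λ { (x ∷ []) m → ∀ᶠ λ u → ∀ᶠ λ u′ → Stageᶠ x m u ⇒ᶠ Stageᶠ x m u′ ⇒ᶠ u ≡ᶠ u′ })
    (λ u u′ h h′ → trans (stage-∅ h) (sym (stage-∅ h′)))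
    step
    where
    step : ∀ n → n ∈ ω → (∀ u u′ → Stage x n u → Stage x n u′ → u ≡ u′) →
           ∀ u u′ → Stage x (succ n) u → Stage x (succ n) u′ → u ≡ u′
    step n n∈ ih u u′ h h′ with stage-succ h | stage-succ h′
    ... | v , hv , refl | v′ , hv′ , refl = cong ⋃ (ih v v′ hv hv′)

  next-stage : ∀ {x m v} → Stage x m v → Stage x (succ m) (⋃ v)
  next-stage {x} {m} {v} (f , ch , h) = adjoin f ⟪ succ m , ⋃ v ⟫ , ch′ , ⟨⟩∈-adjoin-new
    where
    ch′ : Chain x (adjoin f ⟪ succ m , ⋃ v ⟫)
    ch′ n u nu with ⟨⟩∈-adjoin nu
    ... | inj₂ (refl , refl) = inj₂ (m , v , isSuc m , ⟨⟩-mono ⊆-adjoin h , λ y → ∈-⋃)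
    ... | inj₁ nu′ with ch n u nu′
    ...   | inj₁ e = inj₁ e
    ...   | inj₂ (k , v , hs , kv , hu) = inj₂ (k , v , hs , ⟨⟩-mono ⊆-adjoin kv , hu)

  opaque
    stage-exists : ∀ x m → m ∈ ω → ∃[ u ] Stage x m u
    stage-exists x = ω-induction (x ∷ []) (λ { (x ∷ []) m → ∃ᶠ λ u → Stageᶠ x m u })
      (x , singleton ⟪ ∅ , x ⟫ , first , ⇒⟨⟩ x∈singleton)
      (λ { m m∈ (v , hv) → ⋃ v , next-stage hv })
      where
      first : Chain x (singleton ⟪ ∅ , x ⟫)
      first m u mu with opair-inj (∈-single (⟨⟩⇒ mu))
      ... | refl , refl = inj₁ (∅-empty , refl)

  opaque
    transitive-superset : ∀ x → ∃[ t ] Transitive t × x ⊆ t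
    transitive-superset x with rep ω (x ∷ []) (λ { (x ∷ []) m u → Stageᶠ x m u })
                                 (λ m u u′ m∈ → stage-unique x m m∈ u u′)
    ... | T , hT = ⋃ T , tr , sub
      where
      tr : Transitive (⋃ T)
      tr y y∈ z z∈ with to ∈-⋃ y∈
      ... | u , y∈u , u∈T with to (hT u) u∈T
      ... | m , m∈ , hm = from ∈-⋃ (⋃ u , from ∈-⋃ (y , z∈ , y∈u) ,
                                    from (hT (⋃ u)) (succ m , succ∈ω m∈ , next-stage hm))
      sub : x ⊆ ⋃ T
      sub y y∈ with stage-exists x ∅ ∅∈ω
      ... | u , hu with stage-∅ hu
      ... | refl = from ∈-⋃ (x , y∈ , from (hT x) (∅ , ∅∈ω , hu))

  tc : V → V
  tc x = sep (proj₁ (transitive-superset x)) (x ∷ [])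
           λ { (x ∷ []) y → ∀ᶠ λ t → Transitiveᶠ t ⇒ᶠ x ⊆ᶠ t ⇒ᶠ y ∈ᶠ t }

  tc-least : ∀ {x} t → Transitive t → x ⊆ t → tc x ⊆ t
  tc-least t tr x⊆t y y∈ = proj₂ (to (∈-sep _ _ _) y∈) t tr x⊆t

  ⊆-tc : ∀ {x} → x ⊆ tc x
  ⊆-tc {x} y y∈ = from (∈-sep _ _ _) (proj₂ (proj₂ (transitive-superset x)) y y∈ , λ t _ x⊆t → x⊆t y y∈)

  tc-transitive : ∀ {x} → Transitive (tc x)
  tc-transitive {x} y y∈ z z∈ with to (∈-sep _ _ _) y∈
  ... | y∈₀ , h = from (∈-sep _ _ _) (proj₁ (proj₂ (transitive-superset x)) y y∈₀ z z∈ ,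
                    λ t tr x⊆t → tr y (h t tr x⊆t) z z∈)

  isTransitiveClosure : ∀ x → IsTransitiveClosure (tc x) x
  isTransitiveClosure x = tc-transitive , ⊆-tc , tc-least

  opaque
    -- Foundation applies to sets, so the counterexamples are collected inside `tc (singleton x)`.
    -- The elements of a minimal one stay in this set and hence have the property, which contradicts
    -- `step`.
    ∈-induction : ∀ {k} (ρ : Vec V k) (φ : Class k) →
                  (∀ x → (∀ y → y ∈ x → ⟦ φ ⟧₁ ρ y) → ⟦ φ ⟧₁ ρ x) → ∀ x → ⟦ φ ⟧₁ ρ x
    ∈-induction {k} ρ φ step x = by-contradiction contra
      where
      ψ : Class k
      ψ ρ y = ¬ᶠ φ ρ y
      T : V
      T = tc (singleton x)
      contra : ¬ ¬ ⟦ φ ⟧₁ ρ x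
      contra ¬φx with foundation (sep T ρ ψ) (x , from (∈-sep T ρ ψ) (⊆-tc x x∈singleton , ¬φx))
      ... | y , y∈bad , min = proj₂ (to (∈-sep T ρ ψ) y∈bad) (step y λ z z∈y → by-contradiction λ ¬φz →
              min z z∈y (from (∈-sep T ρ ψ) (tc-transitive y (proj₁ (to (∈-sep T ρ ψ) y∈bad)) z z∈y , ¬φz)))

  -- The cumulative hierarchy over a base set

  -- Rank B a u says that u = B ∪ ⋃ { 𝒫 v : v is the value at some b ∈ a }; for
  -- B = ∅ and a an ordinal, this is the cumulative hierarchy.
  Ranked : V → V → Set ℓ
  Ranked B f = ∀ a u → ⟨ a , u ⟩∈ f →
               (∀ b → b ∈ a → ∃[ v ] ⟨ b , v ⟩∈ f)
             × (∀ x → x ∈ u ⇔ (x ∈ B ⊎ (∃[ b ] ∃[ v ] b ∈ a × ⟨ b , v ⟩∈ f × x ⊆ v)))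

  Rank : V → V → V → Set ℓ
  Rank B a u = ∃[ f ] Ranked B f × ⟨ a , u ⟩∈ f

  Rankᶠ : ∀ {m} → ℕ → ℕ → ℕ → Formula (suc m)
  Rankᶠ B a u = ∃ᶠ λ f →
    (∀ᶠ λ a → ∀ᶠ λ u → ⟨ a , u ⟩∈ᶠ f ⇒ᶠ
      ((∀ᶠ λ b → b ∈ᶠ a ⇒ᶠ (∃ᶠ λ v → ⟨ b , v ⟩∈ᶠ f))
       ∧ᶠ (∀ᶠ λ x → x ∈ᶠ u ⇔ᶠ (x ∈ᶠ B ∨ᶠ (∃ᶠ λ b → ∃ᶠ λ v → b ∈ᶠ a ∧ᶠ ⟨ b , v ⟩∈ᶠ f ∧ᶠ x ⊆ᶠ v)))))
    ∧ᶠ ⟨ a , u ⟩∈ᶠ f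

  rank-unique : ∀ B a u u′ → Rank B a u → Rank B a u′ → u ≡ u′
  rank-unique B = ∈-induction (B ∷ [])
    (λ { (B ∷ []) a → ∀ᶠ λ u → ∀ᶠ λ u′ → Rankᶠ B a u ⇒ᶠ Rankᶠ B a u′ ⇒ᶠ u ≡ᶠ u′ })
    (λ a ih u u′ h h′ → ext (half a ih u u′ h h′) (half a ih u′ u h′ h))
    where
    half : ∀ a → (∀ b → b ∈ a → ∀ u u′ → Rank B b u → Rank B b u′ → u ≡ u′) →
           ∀ u u′ → Rank B a u → Rank B a u′ → u ⊆ u′
    half a ih u u′ (f , hf , au) (f′ , hf′ , au′) x x∈ with to (proj₂ (hf a u au) x) x∈
    ... | inj₁ x∈B = from (proj₂ (hf′ a u′ au′) x) (inj₁ x∈B)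
    ... | inj₂ (b , v , b∈ , bv , x⊆v) with proj₁ (hf′ a u′ au′) b b∈
    ... | v′ , bv′ with ih b b∈ v v′ (f , hf , bv) (f′ , hf′ , bv′)
    ... | refl = from (proj₂ (hf′ a u′ au′) x) (inj₂ (b , v , b∈ , bv′ , x⊆v))

  opaque
    rank-graph : ∀ B t → ∃[ g ] (∀ p → p ∈ g ⇔ (∃[ b ] b ∈ t × (∃[ u ] Rank B b u × IsOPair p b u)))
    rank-graph B t = rep t (B ∷ []) (λ { (B ∷ []) b p → ∃ᶠ λ u → Rankᶠ B b u ∧ᶠ IsOPairᶠ p b u })
      λ { b p p′ b∈ (u , hu , hp) (u′ , hu′ , hp′) →
          trans (opair-unique hp) (trans (cong ⟪ b ,_⟫ (rank-unique B b u u′ hu hu′)) (sym (opair-unique hp′))) }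

    rank-powers : ∀ B a → ∃[ g ] (∀ w → w ∈ g ⇔ (∃[ b ] b ∈ a × (∃[ v ] Rank B b v × (∀ x → x ∈ w ⇔ x ⊆ v))))
    rank-powers B a = rep a (B ∷ []) (λ { (B ∷ []) b w → ∃ᶠ λ v → Rankᶠ B b v ∧ᶠ (∀ᶠ λ x → x ∈ᶠ w ⇔ᶠ x ⊆ᶠ v) })
      λ { b w w′ b∈ (v , hv , hw) (v′ , hv′ , hw′) → eq-power (rank-unique B b v v′ hv hv′) hw hw′ }
      where
      eq-power : ∀ {v v′ w w′} → v ≡ v′ → (∀ x → x ∈ w ⇔ x ⊆ v) → (∀ x → x ∈ w′ ⇔ x ⊆ v′) → w ≡ w′
      eq-power refl hw hw′ = ext (λ x x∈ → from (hw′ x) (to (hw x) x∈)) (λ x x∈ → from (hw x) (to (hw′ x) x∈))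

  -- If a ∉ `tc a`, a value at a can be adjoined to the ranks of the members of `tc a` without a
  -- conflict. If a ∈ `tc a`, the members of `tc a` that have a rank form a transitive set with a as
  -- a subset; this is then all of `tc a`, and a is among them.
  rank-step : ∀ B a → (∀ b → b ∈ a → ∃[ u ] Rank B b u) → ∃[ u ] Rank B a u
  rank-step B a ih with em {a ∈ tc a}
  ... | yes a∈tc = below a a∈tc
    where
    ranked : V
    ranked = sep (tc a) (B ∷ []) λ { (B ∷ []) b → ∃ᶠ λ u → Rankᶠ B b u }
    below : ∀ b → b ∈ tc a → ∃[ u ] Rank B b u
    below b b∈ = proj₂ (to (∈-sep _ _ _) (tc-least ranked ranked-transitive
      (λ c c∈ → from (∈-sep _ _ _) (⊆-tc c c∈ , ih c c∈)) b b∈))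
      where
      ranked-transitive : Transitive ranked
      ranked-transitive c c∈ d d∈ with to (∈-sep _ _ _) c∈
      ... | c∈tc , u , f , hf , cu with proj₁ (hf c u cu) d d∈
      ... | v , dv = from (∈-sep _ _ _) (tc-transitive c c∈tc d d∈ , v , f , hf , dv)
  ... | no a∉tc = u₀ , f , hf , ⟨⟩∈-adjoin-new
    where
    f′ : ∃[ g ] (∀ p → p ∈ g ⇔ (∃[ b ] b ∈ tc a × (∃[ u ] Rank B b u × IsOPair p b u)))
    f′ = rank-graph B (tc a)
    q : ∃[ g ] (∀ w → w ∈ g ⇔ (∃[ b ] b ∈ a × (∃[ v ] Rank B b v × (∀ x → x ∈ w ⇔ x ⊆ v))))
    q = rank-powers B a
    u₀ f : V
    u₀ = B ∪ ⋃ (proj₁ q)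
    f = adjoin (proj₁ f′) ⟪ a , u₀ ⟫
    ∈f′ : ∀ {b u} → b ∈ tc a → Rank B b u → ⟨ b , u ⟩∈ f
    ∈f′ {b} {u} b∈ hu = ⇒⟨⟩ (⊆-adjoin _ (from (proj₂ f′ _) (b , b∈ , u , hu , isOPair b u)))
    f⇒ : ∀ {b u} → b ∈ tc a → ⟨ b , u ⟩∈ f → Rank B b u
    f⇒ b∈ bu with ⟨⟩∈-adjoin bu
    ... | inj₂ (refl , _) = ⊥-elim (a∉tc b∈)
    ... | inj₁ bu′ with to (proj₂ f′ _) (⟨⟩⇒ bu′)
    ... | _ , _ , u , hu , hp with opair-inj (opair-unique hp)
    ... | refl , refl = hu
    hf : Ranked B f
    hf b u bu with ⟨⟩∈-adjoin bu
    ... | inj₂ (refl , refl) = (λ c c∈ → let v , hv = ih c c∈ in v , ∈f′ (⊆-tc c c∈) hv) , λ x → mk⇔ (fwd x) (bwd x)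
      where
      fwd : ∀ x → x ∈ u₀ → x ∈ B ⊎ (∃[ b ] ∃[ v ] b ∈ a × ⟨ b , v ⟩∈ f × x ⊆ v)
      fwd x x∈ with to ∈-∪ x∈
      ... | inj₁ x∈B = inj₁ x∈B
      ... | inj₂ h with to ∈-⋃ h
      ... | w , x∈w , w∈ with to (proj₂ q w) w∈
      ... | c , c∈ , v , hv , hw = inj₂ (c , v , c∈ , ∈f′ (⊆-tc c c∈) hv , to (hw x) x∈w)
      bwd : ∀ x → x ∈ B ⊎ (∃[ b ] ∃[ v ] b ∈ a × ⟨ b , v ⟩∈ f × x ⊆ v) → x ∈ u₀
      bwd x (inj₁ x∈B) = from ∈-∪ (inj₁ x∈B)
      bwd x (inj₂ (c , v , c∈ , cv , x⊆v)) = from ∈-∪ (inj₂ (from ∈-⋃ (𝒫 v , from ∈-𝒫 x⊆v ,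
        from (proj₂ q _) (c , c∈ , v , f⇒ (⊆-tc c c∈) cv , λ _ → ∈-𝒫))))
    ... | inj₁ bu′ with to (proj₂ f′ _) (⟨⟩⇒ bu′)
    ... | b′ , b∈tc , u′ , (g , hg , bg) , hp with opair-inj (opair-unique hp)
    ... | refl , refl = (λ c c∈ → let v , cv = proj₁ (hg b u bg) c c∈ in
                                  v , ∈f′ (tc-transitive b b∈tc c c∈) (g , hg , cv))
                      , λ x → mk⇔ (fwd x) (bwd x)
      where
      fwd : ∀ x → x ∈ u → x ∈ B ⊎ (∃[ c ] ∃[ v ] c ∈ b × ⟨ c , v ⟩∈ f × x ⊆ v)
      fwd x x∈ with to (proj₂ (hg b u bg) x) x∈
      ... | inj₁ h = inj₁ h
      ... | inj₂ (c , v , c∈ , cv , x⊆v) = inj₂ (c , v , c∈ , ∈f′ (tc-transitive b b∈tc c c∈) (g , hg , cv) , x⊆v)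
      bwd : ∀ x → x ∈ B ⊎ (∃[ c ] ∃[ v ] c ∈ b × ⟨ c , v ⟩∈ f × x ⊆ v) → x ∈ u
      bwd x (inj₁ h) = from (proj₂ (hg b u bg) x) (inj₁ h)
      bwd x (inj₂ (c , v , c∈ , cv , x⊆v)) with proj₁ (hg b u bg) c c∈
      ... | v′ , cv′ with rank-unique B c v v′ (f⇒ (tc-transitive b b∈tc c c∈) cv) (g , hg , cv′)
      ... | refl = from (proj₂ (hg b u bg) x) (inj₂ (c , v , c∈ , cv′ , x⊆v))

  opaque
    rank-exists : ∀ B a → ∃[ u ] Rank B a u
    rank-exists B = ∈-induction (B ∷ []) (λ { (B ∷ []) a → ∃ᶠ λ u → Rankᶠ B a u }) (rank-step B)

  𝕌 : V → V → V
  𝕌 B a = proj₁ (rank-exists B a)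

  rank≡𝕌 : ∀ {B a u} → Rank B a u → u ≡ 𝕌 B a
  rank≡𝕌 {B} {a} h = rank-unique B a _ _ h (proj₂ (rank-exists B a))

  ∈-𝕌 : ∀ {B a x} → x ∈ 𝕌 B a ⇔ (x ∈ B ⊎ (∃[ b ] b ∈ a × x ⊆ 𝕌 B b))
  ∈-𝕌 {B} {a} {x} with rank-exists B a
  ... | u , f , hf , au = mk⇔ fwd bwd
    where
    fwd : x ∈ u → x ∈ B ⊎ (∃[ b ] b ∈ a × x ⊆ 𝕌 B b)
    fwd x∈ with to (proj₂ (hf a u au) x) x∈
    ... | inj₁ h = inj₁ h
    ... | inj₂ (b , v , b∈ , bv , x⊆v) = inj₂ (b , b∈ , subst (x ⊆_) (rank≡𝕌 (f , hf , bv)) x⊆v)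
    bwd : x ∈ B ⊎ (∃[ b ] b ∈ a × x ⊆ 𝕌 B b) → x ∈ u
    bwd (inj₁ h) = from (proj₂ (hf a u au) x) (inj₁ h)
    bwd (inj₂ (b , b∈ , x⊆)) with proj₁ (hf a u au) b b∈
    ... | v , bv = from (proj₂ (hf a u au) x) (inj₂ (b , v , b∈ , bv , subst (x ⊆_) (sym (rank≡𝕌 (f , hf , bv))) x⊆))

  -- The operation x , y ↦ x ∪ {y} generates numerals, pairs, formula codes and finite parts of
  -- assignments. So this binary operation is all that a countable closure has to respect besides
  -- the choice of Skolem witnesses.
  record AdjoinClosed (Y : V) : Set ℓ where
    field
      has-∅      : ∅ ∈ Y
      has-adjoin : ∀ {x y} → x ∈ Y → y ∈ Y → adjoin x y ∈ Y

    has-ω : ω ⊆ Y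
    has-ω = proj₂ isOmega Y (mkInductive has-∅ λ n n∈ → has-adjoin n∈ n∈)

    has-pair : ∀ {x y} → x ∈ Y → y ∈ Y → ｛ x , y ｝ ∈ Y
    has-pair {x} {y} x∈ y∈ = subst (_∈ Y) e (has-adjoin (has-adjoin has-∅ x∈) y∈)
      where
      e : adjoin (adjoin ∅ x) y ≡ ｛ x , y ｝
      e = ext (λ w w∈ → from ∈-pair ([ (λ h → [ (λ h′ → ⊥-elim (∅-empty _ h′)) , inj₁ ]′ (to ∈-adjoin h)) , inj₂ ]′
                           (to ∈-adjoin w∈)))
              (λ w w∈ → from ∈-adjoin ([ (λ h → inj₁ (from ∈-adjoin (inj₂ h))) , inj₂ ]′ (to ∈-pair w∈)))

    has-opair : ∀ {x y} → x ∈ Y → y ∈ Y → ⟪ x , y ⟫ ∈ Y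
    has-opair x∈ y∈ = subst (_∈ Y) (sym opair-def) (has-pair (has-pair x∈ x∈) (has-pair x∈ y∈))

  -- Every element of `𝕌 B ω` is a subset of some `𝕌 B n`; for an element of B, transitivity allows
  -- n = ∅. For x and y with bounds m and n, `ω-directed` gives k above both, and x ∪ {y} is a
  -- subset of `𝕌 B k`.
  𝕌ω-closed : ∀ {B} → Transitive B → AdjoinClosed (𝕌 B ω)
  𝕌ω-closed {B} tr = record
    { has-∅ = from ∈-𝕌 (inj₂ (∅ , ∅∈ω , λ x x∈ → ⊥-elim (∅-empty x x∈)))
    ; has-adjoin = λ {x} {y} x∈ y∈ →
        let m , m∈ , x⊆ = bounded x x∈
            n , n∈ , y⊆ = bounded y y∈
            k , k∈ , m∈k , n∈k = ω-directed m∈ n∈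
        in from ∈-𝕌 (inj₂ (k , k∈ , λ z z∈ →
             [ (λ z∈x → mono (nat-transitive k k∈ m m∈k) z (x⊆ z z∈x))
             , (λ { refl → from ∈-𝕌 (inj₂ (n , n∈k , y⊆)) }) ]′ (to ∈-adjoin z∈))) }
    where
    mono : ∀ {a b} → a ⊆ b → 𝕌 B a ⊆ 𝕌 B b
    mono a⊆b z z∈ = from ∈-𝕌 ([ inj₁ , (λ { (c , c∈ , z⊆) → inj₂ (c , a⊆b c c∈ , z⊆) }) ]′ (to ∈-𝕌 z∈))
    bounded : ∀ x → x ∈ 𝕌 B ω → ∃[ n ] n ∈ ω × x ⊆ 𝕌 B n
    bounded x x∈ with to ∈-𝕌 x∈
    ... | inj₂ h = h
    ... | inj₁ x∈B = ∅ , ∅∈ω , λ z z∈ → from ∈-𝕌 (inj₁ (tr x x∈B z z∈))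

  -- Functions and surjections

  IsFunctionᶠ IsSurjectionᶠ : ∀ {m} → ℕ → ℕ → ℕ → Formula (suc m)
  IsFunctionᶠ f A B = (∀ᶠ λ p → p ∈ᶠ f ⇒ᶠ (∃ᶠ λ x → ∃ᶠ λ y → x ∈ᶠ A ∧ᶠ y ∈ᶠ B ∧ᶠ IsOPairᶠ p x y))
    ∧ᶠ (∀ᶠ λ x → x ∈ᶠ A ⇒ᶠ (∃ᶠ λ y → ⟨ x , y ⟩∈ᶠ f))
    ∧ᶠ (∀ᶠ λ x → ∀ᶠ λ y → ∀ᶠ λ y′ → ⟨ x , y ⟩∈ᶠ f ⇒ᶠ ⟨ x , y′ ⟩∈ᶠ f ⇒ᶠ y ≡ᶠ y′)
  IsSurjectionᶠ f A B = IsFunctionᶠ f A B ∧ᶠ (∀ᶠ λ y → y ∈ᶠ B ⇒ᶠ (∃ᶠ λ x → ⟨ x , y ⟩∈ᶠ f))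

  IsOrdinalᶠ : ∀ {m} → ℕ → Formula (suc m)
  IsOrdinalᶠ α = Transitiveᶠ α
    ∧ᶠ (∀ᶠ λ x → ∀ᶠ λ y → x ∈ᶠ α ⇒ᶠ y ∈ᶠ α ⇒ᶠ (x ∈ᶠ y ∨ᶠ x ≡ᶠ y ∨ᶠ y ∈ᶠ x))

  function-dom : ∀ {f A B x y} → IsFunction f A B → ⟨ x , y ⟩∈ f → x ∈ A
  function-dom (rel , _) (p , hp , p∈) with rel p p∈
  ... | _ , _ , x∈ , _ , hp′ with opair-inj (trans (sym (opair-unique hp)) (opair-unique hp′))
  ... | refl , refl = x∈

  function-cod : ∀ {f A B x y} → IsFunction f A B → ⟨ x , y ⟩∈ f → y ∈ B
  function-cod (rel , _) (p , hp , p∈) with rel p p∈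
  ... | _ , _ , _ , y∈ , hp′ with opair-inj (trans (sym (opair-unique hp)) (opair-unique hp′))
  ... | refl , refl = y∈

  -- Points of A to which r assigns nothing in B are sent to the default b. The surjections needed
  -- later arise as partial functions and are completed here.
  partial⇒onto : ∀ {A B} r → (∃[ b ] b ∈ B) →
    (∀ x y y′ → y ∈ B → y′ ∈ B → ⟨ x , y ⟩∈ r → ⟨ x , y′ ⟩∈ r → y ≡ y′) →
    (∀ y → y ∈ B → ∃[ x ] x ∈ A × ⟨ x , y ⟩∈ r) → MapsOnto A B
  partial⇒onto {A} {B} r (b , b∈) fun onto = f , (rel , total , single) , λ y y∈ →
      let x , x∈ , h = onto y y∈ in x , f-intro x∈ y∈ (inj₁ h)
    where
    Cond : V → V → Set ℓ
    Cond x y = ⟨ x , y ⟩∈ r ⊎ ((¬ (∃[ z ] z ∈ B × ⟨ x , z ⟩∈ r)) × y ≡ b)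
    f : V
    f = sep (A ⊗ B) (r ∷ b ∷ B ∷ []) λ { (r ∷ b ∷ B ∷ []) p → ∃ᶠ λ x → ∃ᶠ λ y → IsOPairᶠ p x y
          ∧ᶠ (⟨ x , y ⟩∈ᶠ r ∨ᶠ (¬ᶠ (∃ᶠ λ z → z ∈ᶠ B ∧ᶠ ⟨ x , z ⟩∈ᶠ r) ∧ᶠ y ≡ᶠ b)) }
    f-intro : ∀ {x y} → x ∈ A → y ∈ B → Cond x y → ⟨ x , y ⟩∈ f
    f-intro {x} {y} x∈ y∈ c = ⇒⟨⟩ (from (∈-sep _ _ _) (∈-⊗-intro x∈ y∈ , x , y , isOPair x y , c))
    f-elim : ∀ {x y} → ⟨ x , y ⟩∈ f → y ∈ B × Cond x y
    f-elim h with to (∈-sep _ _ _) (⟨⟩⇒ h)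
    ... | h⊗ , x , y , hp , c with opair-inj (opair-unique hp)
    ... | refl , refl = proj₂ (⟨⟩∈-⊗ (⇒⟨⟩ h⊗)) , c
    rel : IsRelation f A B
    rel p p∈ = ∈-⊗ (proj₁ (to (∈-sep _ _ _) p∈))
    total : ∀ x → x ∈ A → ∃[ y ] ⟨ x , y ⟩∈ f
    total x x∈ with em {∃[ z ] z ∈ B × ⟨ x , z ⟩∈ r}
    ... | yes (z , z∈ , h) = z , f-intro x∈ z∈ (inj₁ h)
    ... | no ¬h = b , f-intro x∈ b∈ (inj₂ (¬h , refl))
    single : ∀ x y y′ → ⟨ x , y ⟩∈ f → ⟨ x , y′ ⟩∈ f → y ≡ y′
    single x y y′ h h′ with f-elim h | f-elim h′
    ... | y∈ , inj₁ c | y′∈ , inj₁ c′ = fun x y y′ y∈ y′∈ c c′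
    ... | y∈ , inj₁ c | _ , inj₂ (¬c , _) = ⊥-elim (¬c (y , y∈ , c))
    ... | _ , inj₂ (¬c , _) | y′∈ , inj₁ c = ⊥-elim (¬c (y′ , y′∈ , c))
    ... | _ , inj₂ (_ , e) | _ , inj₂ (_ , e′) = trans e (sym e′)

  mapsOnto-mono : ∀ {A A′ B B′} → A ⊆ A′ → B′ ⊆ B → (∃[ b ] b ∈ B′) → MapsOnto A B → MapsOnto A′ B′
  mapsOnto-mono A⊆ B⊆ ne (f , hf , onto) = partial⇒onto f ne (λ x y y′ _ _ → proj₂ (proj₂ hf) x y y′)
    λ y y∈ → let x , h = onto y (B⊆ y y∈) in x , A⊆ x (function-dom hf h) , h

  mapsOnto-refl : ∀ A → MapsOnto A A
  mapsOnto-refl A = i , ((λ p p∈ → ∈-⊗ (proj₁ (to (∈-sep _ _ _) p∈))) , (λ x x∈ → x , i-intro x∈)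
                        , λ x y y′ h h′ → trans (sym (i-elim h)) (i-elim h′)) , λ x x∈ → x , i-intro x∈
    where
    i : V
    i = sep (A ⊗ A) [] λ { [] p → ∃ᶠ λ x → IsOPairᶠ p x x }
    i-intro : ∀ {x} → x ∈ A → ⟨ x , x ⟩∈ i
    i-intro {x} x∈ = ⇒⟨⟩ (from (∈-sep _ _ _) (∈-⊗-intro x∈ x∈ , x , isOPair x x))
    i-elim : ∀ {x y} → ⟨ x , y ⟩∈ i → x ≡ y
    i-elim h with to (∈-sep _ _ _) (⟨⟩⇒ h)
    ... | _ , z , hp with opair-inj (opair-unique hp)
    ... | refl , refl = refl

  mapsOnto-trans : ∀ {A B C} → (∃[ c ] c ∈ C) → MapsOnto A B → MapsOnto B C → MapsOnto A C
  mapsOnto-trans {A} {B} {C} ne (f , hf , f-onto) (g , hg , g-onto) = partial⇒onto r ne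
    (λ x y y′ _ _ h h′ → single (elim h) (elim h′)) onto
    where
    r : V
    r = sep (A ⊗ C) (f ∷ g ∷ []) λ { (f ∷ g ∷ []) p → ∃ᶠ λ x → ∃ᶠ λ z → IsOPairᶠ p x z
          ∧ᶠ (∃ᶠ λ y → ⟨ x , y ⟩∈ᶠ f ∧ᶠ ⟨ y , z ⟩∈ᶠ g) }
    elim : ∀ {x z} → ⟨ x , z ⟩∈ r → ∃[ y ] ⟨ x , y ⟩∈ f × ⟨ y , z ⟩∈ g
    elim h with to (∈-sep _ _ _) (⟨⟩⇒ h)
    ... | _ , x , z , hp , c with opair-inj (opair-unique hp)
    ... | refl , refl = c
    single : ∀ {x z z′} → (∃[ y ] ⟨ x , y ⟩∈ f × ⟨ y , z ⟩∈ g) → (∃[ y ] ⟨ x , y ⟩∈ f × ⟨ y , z′ ⟩∈ g) → z ≡ z′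
    single (y , fy , gz) (y′ , fy′ , gz′) with proj₂ (proj₂ hf) _ y y′ fy fy′
    ... | refl = proj₂ (proj₂ hg) y _ _ gz gz′
    onto : ∀ z → z ∈ C → ∃[ x ] x ∈ A × ⟨ x , z ⟩∈ r
    onto z z∈ with g-onto z z∈
    ... | y , gz with f-onto y (function-dom hg gz)
    ... | x , fy = x , function-dom hf fy , ⇒⟨⟩ (from (∈-sep _ _ _)
                     (∈-⊗-intro (function-dom hf fy) z∈ , x , z , isOPair x z , y , fy , gz))

  -- Ordinals

  ordinal-∈ : ∀ {α β} → IsOrdinal α → β ∈ α → IsOrdinal β
  ordinal-∈ {α} {β} (tr , lin) β∈ = tr-β , λ x y x∈ y∈ → lin x y (tr β β∈ x x∈) (tr β β∈ y y∈)
    where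
    tr-β : Transitive β
    tr-β x x∈ y y∈ with lin y β (tr x (tr β β∈ x x∈) y y∈) β∈
    ... | inj₁ h = h
    ... | inj₂ (inj₁ refl) = ⊥-elim (¬∈-cycle x∈ y∈)
    ... | inj₂ (inj₂ β∈y) = ⊥-elim (no-3-cycle y∈ x∈ β∈y)
      where
      no-3-cycle : ∀ {a b c} → a ∈ b → b ∈ c → c ∉ a
      no-3-cycle {a} {b} {c} a∈b b∈c c∈a with foundation (adjoin ｛ a , b ｝ c) (c , from ∈-adjoin (inj₂ refl))
      ... | z , z∈ , min with to ∈-adjoin z∈
      ... | inj₂ refl = min b b∈c (⊆-adjoin b (from ∈-pair (inj₂ refl)))
      ... | inj₁ h with to ∈-pair h
      ...   | inj₁ refl = min c c∈a (from ∈-adjoin (inj₂ refl))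
      ...   | inj₂ refl = min a a∈b (⊆-adjoin a (from ∈-pair (inj₁ refl)))

  -- The ∈-least x of α outside γ equals γ: its elements are in γ by minimality, while an element y
  -- of γ with x = y or x ∈ y would put x into the transitive set γ.
  transitive⊆ordinal : ∀ {γ α} → IsOrdinal α → Transitive γ → γ ⊆ α → γ ≡ α ⊎ γ ∈ α
  transitive⊆ordinal {γ} {α} (tr , lin) tr-γ γ⊆α with em {γ ≡ α}
  ... | yes e = inj₁ e
  ... | no γ≢α = inj₂ least-missing
    where
    D : V
    D = sep α (γ ∷ []) λ { (γ ∷ []) x → ¬ᶠ (x ∈ᶠ γ) }
    least-missing : γ ∈ α
    least-missing with ¬∀⇒∃¬ {λ x → x ∈ α → x ∈ γ} (λ α⊆γ → γ≢α (ext γ⊆α α⊆γ))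
    ... | x₀ , h₀ with foundation D (x₀ , from (∈-sep _ _ _)
                         (by-contradiction (λ ∉ → h₀ λ ∈ → ⊥-elim (∉ ∈)) , λ ∈ → h₀ λ _ → ∈))
    ... | x , x∈D , min with to (∈-sep _ _ _) x∈D
    ... | x∈α , x∉γ = subst (_∈ α) (ext x⊆γ γ⊆x) x∈α
      where
      x⊆γ : x ⊆ γ
      x⊆γ y y∈ = by-contradiction λ y∉ → min y y∈ (from (∈-sep _ _ _) (tr x x∈α y y∈ , y∉))
      γ⊆x : γ ⊆ x
      γ⊆x y y∈ with lin y x (γ⊆α y y∈) x∈α
      ... | inj₁ h = h
      ... | inj₂ (inj₁ refl) = ⊥-elim (x∉γ y∈)
      ... | inj₂ (inj₂ x∈y) = ⊥-elim (x∉γ (tr-γ y y∈ x x∈y))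

  -- The intersection of α and β is a transitive subset of both. If it were an element of both, it
  -- would be an element of itself.
  ordinal-compare : ∀ {α β} → IsOrdinal α → IsOrdinal β → α ∈ β ⊎ α ≡ β ⊎ β ∈ α
  ordinal-compare {α} {β} oα oβ with transitive⊆ordinal oα tr γ⊆α | transitive⊆ordinal oβ tr γ⊆β
    where
    γ : V
    γ = sep α (β ∷ []) λ { (β ∷ []) x → x ∈ᶠ β }
    tr : Transitive γ
    tr x x∈ y y∈ with to (∈-sep _ _ _) x∈
    ... | x∈α , x∈β = from (∈-sep _ _ _) (proj₁ oα x x∈α y y∈ , proj₁ oβ x x∈β y y∈)
    γ⊆α : γ ⊆ α
    γ⊆α x x∈ = proj₁ (to (∈-sep _ _ _) x∈)
    γ⊆β : γ ⊆ β
    γ⊆β x x∈ = proj₂ (to (∈-sep _ _ _) x∈)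
  ... | inj₁ e | inj₁ e′ = inj₂ (inj₁ (trans (sym e) e′))
  ... | inj₁ e | inj₂ γ∈β = inj₁ (subst (_∈ β) e γ∈β)
  ... | inj₂ γ∈α | inj₁ e = inj₂ (inj₂ (subst (_∈ α) e γ∈α))
  ... | inj₂ γ∈α | inj₂ γ∈β = ⊥-elim (¬x∈x (from (∈-sep _ _ _) (γ∈α , γ∈β)))

  -- Lindenbaum numbers

  -- A surjection f of X onto an ordinal is determined by the relation
  -- f x ∈ f y on X, so replacement applies to the set of relations on X.
  Codes : V → V → V → Set ℓ
  Codes X R α = IsOrdinal α × (∃[ f ] IsSurjection f X α ×
    (∀ x y u v → ⟨ x , u ⟩∈ f → ⟨ y , v ⟩∈ f → ⟨ x , y ⟩∈ R ⇔ u ∈ v))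

  -- The surjections f and g agree, by ∈-induction on the value γ of f at x. Let δ be the value of g
  -- at x. Each element of γ or δ is the value of f or g at some y; both surjections read off from R
  -- alike how y compares with x, and the induction hypothesis identifies their values at y. Hence γ
  -- = δ.
  codes-⊆ : ∀ X R {α β} → Codes X R α → Codes X R β → α ⊆ β
  codes-⊆ X R {α} {β} ((tr , _) , f , (hf , f-onto) , fR) ((tr′ , _) , g , (hg , g-onto) , gR) γ γ∈ =
    let x , xγ = f-onto γ γ∈ in function-cod hg (agree γ γ∈ x xγ)
    where
    step : ∀ γ → (∀ δ → δ ∈ γ → δ ∈ α → ∀ x → ⟨ x , δ ⟩∈ f → ⟨ x , δ ⟩∈ g) →
           γ ∈ α → ∀ x → ⟨ x , γ ⟩∈ f → ⟨ x , γ ⟩∈ g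
    step γ ih γ∈ x xγ with proj₁ (proj₂ hg) x (function-dom hf xγ)
    ... | δ , xδ = subst (λ δ → ⟨ x , δ ⟩∈ g) (ext δ⊆γ γ⊆δ) xδ
      where
      γ⊆δ : γ ⊆ δ
      γ⊆δ ε ε∈ with f-onto ε (tr γ γ∈ ε ε∈)
      ... | y , yε = to (gR y x ε δ (ih ε ε∈ (tr γ γ∈ ε ε∈) y yε) xδ) (from (fR y x ε γ yε xγ) ε∈)
      δ⊆γ : δ ⊆ γ
      δ⊆γ ε ε∈ with g-onto ε (tr′ δ (function-cod hg xδ) ε ε∈)
      ... | y , yε with proj₁ (proj₂ hf) y (function-dom hg yε)
      ... | ζ , yζ with to (fR y x ζ γ yζ xγ) (from (gR y x ε δ yε xδ) ε∈)
      ... | ζ∈γ with proj₂ (proj₂ hg) y ε ζ yε (ih ζ ζ∈γ (function-cod hf yζ) y yζ)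
      ... | refl = ζ∈γ
    agree : ∀ γ → γ ∈ α → ∀ x → ⟨ x , γ ⟩∈ f → ⟨ x , γ ⟩∈ g
    agree = ∈-induction (α ∷ f ∷ g ∷ [])
      (λ { (α ∷ f ∷ g ∷ []) γ → γ ∈ᶠ α ⇒ᶠ (∀ᶠ λ x → ⟨ x , γ ⟩∈ᶠ f ⇒ᶠ ⟨ x , γ ⟩∈ᶠ g) }) step

  opaque
    coded-ordinals : ∀ X → ∃[ K ] (∀ α → α ∈ K ⇔ (∃[ R ] R ∈ 𝒫 (X ⊗ X) × Codes X R α))
    coded-ordinals X = rep (𝒫 (X ⊗ X)) (X ∷ [])
      (λ { (X ∷ []) R α → IsOrdinalᶠ α ∧ᶠ (∃ᶠ λ f → IsSurjectionᶠ f X α ∧ᶠ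
           (∀ᶠ λ x → ∀ᶠ λ y → ∀ᶠ λ u → ∀ᶠ λ v → ⟨ x , u ⟩∈ᶠ f ⇒ᶠ ⟨ y , v ⟩∈ᶠ f ⇒ᶠ
             (⟨ x , y ⟩∈ᶠ R ⇔ᶠ u ∈ᶠ v))) })
      (λ R α β _ h h′ → ext (codes-⊆ X R h h′) (codes-⊆ X R h′ h))

  surjection⇒coded : ∀ X α → IsOrdinal α → MapsOnto X α → α ∈ proj₁ (coded-ordinals X)
  surjection⇒coded X α oα (f , hf , onto) = from (proj₂ (coded-ordinals X) α)
      (R , from ∈-𝒫 (λ p p∈ → proj₁ (to (∈-sep _ _ _) p∈)) , oα , f , (hf , onto) , λ x y u v xu yv →
        mk⇔ (λ h → fwd xu yv (proj₂ (to (∈-sep _ _ _) (⟨⟩⇒ h))))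
            (λ u∈v → ⇒⟨⟩ (from (∈-sep _ _ _) (∈-⊗-intro (function-dom hf xu) (function-dom hf yv)
                       , x , y , u , v , isOPair x y , xu , yv , u∈v))))
    where
    R : V
    R = sep (X ⊗ X) (f ∷ []) λ { (f ∷ []) p → ∃ᶠ λ x → ∃ᶠ λ y → ∃ᶠ λ u → ∃ᶠ λ v →
          IsOPairᶠ p x y ∧ᶠ ⟨ x , u ⟩∈ᶠ f ∧ᶠ ⟨ y , v ⟩∈ᶠ f ∧ᶠ u ∈ᶠ v }
    fwd : ∀ {x y u v} → ⟨ x , u ⟩∈ f → ⟨ y , v ⟩∈ f →
          (∃[ x′ ] ∃[ y′ ] ∃[ u′ ] ∃[ v′ ] IsOPair ⟪ x , y ⟫ x′ y′ × ⟨ x′ , u′ ⟩∈ f × ⟨ y′ , v′ ⟩∈ f × u′ ∈ v′) → u ∈ v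
    fwd xu yv (_ , _ , _ , _ , hp , xu′ , yv′ , u′∈v′) with opair-inj (opair-unique hp)
    ... | refl , refl with proj₂ (proj₂ hf) _ _ _ xu xu′ | proj₂ (proj₂ hf) _ _ _ yv yv′
    ... | refl | refl = u′∈v′

  -- For nonempty X, ∅ is not an image of X although it belongs to the image {∅}, so it is adjoined
  -- to make the set transitive. It also makes every Lindenbaum number nonempty.
  lindenbaum : V → V
  lindenbaum X = adjoin (proj₁ (coded-ordinals X)) ∅

  ∈-lindenbaum : ∀ {X α} → α ∈ lindenbaum X → IsOrdinal α × (α ≡ ∅ ⊎ MapsOnto X α)
  ∈-lindenbaum {X} {α} h with to ∈-adjoin h
  ... | inj₂ refl = ((λ x x∈ → ⊥-elim (∅-empty x x∈)) , λ x y x∈ → ⊥-elim (∅-empty x x∈)) , inj₁ refl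
  ... | inj₁ h′ with to (proj₂ (coded-ordinals X) α) h′
  ... | R , _ , oα , f , hf , _ = oα , inj₂ (f , hf)

  onto⇒∈lindenbaum : ∀ {X α} → IsOrdinal α → MapsOnto X α → α ∈ lindenbaum X
  onto⇒∈lindenbaum {X} {α} oα h = from ∈-adjoin (inj₁ (surjection⇒coded X α oα h))

  ∅∈lindenbaum : ∀ {X} → ∅ ∈ lindenbaum X
  ∅∈lindenbaum = from ∈-adjoin (inj₂ refl)

  lindenbaum-ordinal : ∀ X → IsOrdinal (lindenbaum X)
  lindenbaum-ordinal X = tr , λ α β α∈ β∈ → ordinal-compare (proj₁ (∈-lindenbaum α∈)) (proj₁ (∈-lindenbaum β∈))
    where
    tr : Transitive (lindenbaum X)
    tr α α∈ β β∈ with ∈-lindenbaum α∈ | em {β ≡ ∅}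
    ... | _ | yes refl = ∅∈lindenbaum
    ... | _ , inj₁ refl | no _ = ⊥-elim (∅-empty β β∈)
    ... | oα , inj₂ h | no β≢∅ =
      onto⇒∈lindenbaum (ordinal-∈ oα β∈) (mapsOnto-mono (λ _ → id) (proj₁ oα β β∈) (nonempty β≢∅) h)

  lindenbaum-not-image : ∀ X → ¬ MapsOnto X (lindenbaum X)
  lindenbaum-not-image X h = ¬x∈x (onto⇒∈lindenbaum (lindenbaum-ordinal X) h)

  lindenbaum-cardinal : ∀ X → IsCardinal (lindenbaum X)
  lindenbaum-cardinal X = lindenbaum-ordinal X , not-equinumerous
    where
    not-equinumerous : ∀ α → α ∈ lindenbaum X → ¬ Equinumerous α (lindenbaum X)
    not-equinumerous α α∈ (f , _ , hf) with ∈-lindenbaum α∈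
    ... | _ , inj₂ h = lindenbaum-not-image X (mapsOnto-trans (∅ , ∅∈lindenbaum) h (f , hf))
    ... | _ , inj₁ refl = ∅-empty _ (function-dom (proj₁ hf) (proj₂ (proj₂ hf ∅ ∅∈lindenbaum)))

  -- This makes a Lindenbaum number large: including a given cardinal in X puts the new cardinal
  -- above it.
  ⊆lindenbaum : ∀ {X κ} → IsOrdinal κ → κ ⊆ X → κ ⊆ lindenbaum X
  ⊆lindenbaum {X} {κ} oκ κ⊆X α α∈ with em {α ≡ ∅}
  ... | yes refl = ∅∈lindenbaum
  ... | no α≢∅ = onto⇒∈lindenbaum (ordinal-∈ oκ α∈)
                   (mapsOnto-mono (λ _ → id) (λ x x∈ → κ⊆X x (proj₁ oκ α α∈ x x∈)) (nonempty α≢∅) (mapsOnto-refl X))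

  -- Existence and transitivity of H_κ

  -- If β ∈ κ is not the rank of an element of the transitive set t, then t ⊆ 𝕌 ∅ β
  -- by ∈-induction; hence a set whose closure does not map onto κ lies below rank κ.
  not-onto⇒⊆𝕌 : ∀ {t κ} → Transitive t → IsOrdinal κ → (∃[ β ] β ∈ κ) → ¬ MapsOnto t κ → t ⊆ 𝕌 ∅ κ
  not-onto⇒⊆𝕌 {t} {κ} tr (tr-κ , lin) ne ¬onto = bounded-by (¬∀⇒∃¬ (λ attained → ¬onto (onto attained)))
    where
    -- The condition on y says that its rank is β. Different β cannot share a y: if y ⊆ `𝕌 ∅ β` and
    -- β ∈ β′, then y ∈ `𝕌 ∅ β′`. So r is single-valued although no rank function has been defined.
    r : V
    r = sep (t ⊗ κ) (∅ ∷ []) λ { (∅ ∷ []) p → ∃ᶠ λ y → ∃ᶠ λ β → IsOPairᶠ p y β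
          ∧ᶠ (∃ᶠ λ u → Rankᶠ ∅ β u ∧ᶠ y ⊆ᶠ u ∧ᶠ ¬ᶠ (y ∈ᶠ u)) }
    r-elim : ∀ {y β} → ⟨ y , β ⟩∈ r → y ⊆ 𝕌 ∅ β × y ∉ 𝕌 ∅ β
    r-elim h with to (∈-sep _ _ _) (⟨⟩⇒ h)
    ... | _ , y , β , hp , u , hu , c with opair-inj (opair-unique hp) | rank≡𝕌 hu
    ... | refl , refl | refl = c
    Attained : V → Set ℓ
    Attained β = β ∈ κ → ∃[ y ] y ∈ t × (y ⊆ 𝕌 ∅ β × y ∉ 𝕌 ∅ β)
    onto : (∀ β → Attained β) → MapsOnto t κ
    onto attained = partial⇒onto r ne fun λ β β∈ → let y , y∈ , y⊆ , y∉ = attained β β∈ in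
      y , y∈ , ⇒⟨⟩ (from (∈-sep _ _ _)
        (∈-⊗-intro y∈ β∈ , y , β , isOPair y β , 𝕌 ∅ β , proj₂ (rank-exists ∅ β) , y⊆ , y∉))
      where
      fun : ∀ x y y′ → y ∈ κ → y′ ∈ κ → ⟨ x , y ⟩∈ r → ⟨ x , y′ ⟩∈ r → y ≡ y′
      fun x β β′ β∈ β′∈ h h′ with lin β β′ β∈ β′∈
      ... | inj₁ β∈β′ = ⊥-elim (proj₂ (r-elim h′) (from ∈-𝕌 (inj₂ (β , β∈β′ , proj₁ (r-elim h)))))
      ... | inj₂ (inj₁ e) = e
      ... | inj₂ (inj₂ β′∈β) = ⊥-elim (proj₂ (r-elim h) (from ∈-𝕌 (inj₂ (β′ , β′∈β , proj₁ (r-elim h′)))))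
    bounded-by : (∃[ β ] ¬ Attained β) → t ⊆ 𝕌 ∅ κ
    bounded-by (β , ¬att) y y∈ = from ∈-𝕌 (inj₂ (β , β∈ , λ z z∈ → h z (tr y y∈ z z∈)))
      where
      β∈ : β ∈ κ
      β∈ = by-contradiction λ β∉ → ¬att λ β∈ → ⊥-elim (β∉ β∈)
      h : ∀ y → y ∈ t → y ∈ 𝕌 ∅ β
      h = ∈-induction (t ∷ 𝕌 ∅ β ∷ []) (λ { (t ∷ u ∷ []) y → y ∈ᶠ t ⇒ᶠ y ∈ᶠ u })
        λ y ih y∈ → by-contradiction λ y∉ → ¬att λ _ → y , y∈ , (λ z z∈ → ih z z∈ (tr y y∈ z z∈)) , y∉

  IsTransitiveClosureᶠ : ∀ {m} → ℕ → ℕ → Formula (suc m)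
  IsTransitiveClosureᶠ t x = Transitiveᶠ t ∧ᶠ x ⊆ᶠ t ∧ᶠ (∀ᶠ λ t′ → Transitiveᶠ t′ ⇒ᶠ x ⊆ᶠ t′ ⇒ᶠ t ⊆ᶠ t′)

  H-exists : ∀ κ → IsOrdinal κ → (∃[ β ] β ∈ κ) → ∃[ H ] IsH κ H
  H-exists κ oκ ne = H , λ x → mk⇔ (λ x∈ → proj₂ (to (∈-sep _ _ _) x∈)) (λ h → from (∈-sep _ _ _) (bound x h , h))
    where
    H : V
    H = sep (𝒫 (𝕌 ∅ κ)) (κ ∷ []) λ { (κ ∷ []) x →
          ∃ᶠ λ t → IsTransitiveClosureᶠ t x ∧ᶠ ¬ᶠ (∃ᶠ λ f → IsSurjectionᶠ f t κ) }
    bound : ∀ x → (∃[ t ] IsTransitiveClosure t x × ¬ MapsOnto t κ) → x ∈ 𝒫 (𝕌 ∅ κ)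
    bound x (t , (tr , x⊆t , _) , ¬onto) = from ∈-𝒫 λ y y∈ → not-onto⇒⊆𝕌 tr oκ ne ¬onto y (x⊆t y y∈)

  H-transitive : ∀ {κ H} → (∃[ β ] β ∈ κ) → IsH κ H → Transitive H
  H-transitive ne hH x x∈ y y∈ with to (hH x) x∈
  ... | t , (tr , x⊆t , _) , ¬onto = from (hH y) (tc y , isTransitiveClosure y ,
        λ onto → ¬onto (mapsOnto-mono (tc-least t tr (tr y (x⊆t y y∈))) (λ _ → id) ne onto))

  ∈-small⇒∈H : ∀ {κ H X x} → (∃[ β ] β ∈ κ) → IsH κ H → Transitive X → ¬ MapsOnto X κ → x ∈ X → x ∈ H
  ∈-small⇒∈H {x = x} ne hH tr ¬onto x∈ = from (hH x) (tc x , isTransitiveClosure x ,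
    λ onto → ¬onto (mapsOnto-mono (tc-least _ tr (tr x x∈)) (λ _ → id) ne onto))

  -- Codes of formulas

  num : ℕ → V
  num zero    = ∅
  num (suc k) = succ (num k)

  isNumeral : ∀ k → IsNumeral k (num k)
  isNumeral zero    = ∅-empty
  isNumeral (suc k) = num k , isNumeral k , isSuc (num k)

  numeral-unique : ∀ k {v} → IsNumeral k v → v ≡ num k
  numeral-unique zero    h = empty⇒≡∅ h
  numeral-unique (suc k) (u , hu , hs) = trans (suc-unique hs) (cong succ (numeral-unique k hu))

  num-inj : ∀ {k l} → num k ≡ num l → k ≡ l
  num-inj {zero}  {zero}  e = refl
  num-inj {zero}  {suc l} e = ⊥-elim (succ≢∅ (sym e))
  num-inj {suc k} {zero}  e = ⊥-elim (succ≢∅ e)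
  num-inj {suc k} {suc l} e = cong suc (num-inj (succ-inj e))

  num∈ω : ∀ k → num k ∈ ω
  num∈ω zero    = ∅∈ω
  num∈ω (suc k) = succ∈ω (num∈ω k)

  tag : ℕ → V → V
  tag k d = ⟪ num k , d ⟫

  tag-clash : ∀ k l {d e} {A : Set ℓ} → tag k d ≡ tag l e → k ≢ l → A
  tag-clash k l e k≢l = ⊥-elim (k≢l (num-inj (proj₁ (opair-inj e))))

  memᶜ eqᶜ andᶜ exᶜ : V → V → V
  memᶜ i j = tag 0 ⟪ i , j ⟫
  eqᶜ  i j = tag 1 ⟪ i , j ⟫
  andᶜ φ ψ = tag 3 ⟪ φ , ψ ⟫
  exᶜ  i φ = tag 4 ⟪ i , φ ⟫

  negᶜ : V → V
  negᶜ φ = tag 2 φ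

  isTagged : ∀ k x y → ∃[ v ] IsNumeral k v × IsTriple (tag k ⟪ x , y ⟫) v x y
  isTagged k x y = num k , isNumeral k , ⟪ x , y ⟫ , isOPair x y , isOPair _ _

  tagged-unique : ∀ k {c x y} → (∃[ v ] IsNumeral k v × IsTriple c v x y) → c ≡ tag k ⟪ x , y ⟫
  tagged-unique k (v , hv , p , hp , hc) with numeral-unique k hv | opair-unique hp
  ... | refl | refl = opair-unique hc

  isNegCode : ∀ φ → IsNegCode (negᶜ φ) φ
  isNegCode φ = num 2 , isNumeral 2 , isOPair _ _

  negCode-unique : ∀ {c φ} → IsNegCode c φ → c ≡ negᶜ φ
  negCode-unique (v , hv , hc) with numeral-unique 2 hv
  ... | refl = opair-unique hc

  IsNumeralᶠ : ∀ {m} → ℕ → ℕ → Formula (suc m)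
  IsNumeralᶠ zero    v = IsEmptyᶠ v
  IsNumeralᶠ (suc k) v = ∃ᶠ λ u → IsNumeralᶠ k u ∧ᶠ IsSucᶠ v u

  IsTaggedᶠ : ∀ {m} → ℕ → ℕ → ℕ → ℕ → Formula (suc m)
  IsTaggedᶠ k c x y = ∃ᶠ λ v → IsNumeralᶠ k v ∧ᶠ (∃ᶠ λ p → IsOPairᶠ p x y ∧ᶠ IsOPairᶠ c v p)

  IsNegCodeᶠ : ∀ {m} → ℕ → ℕ → Formula (suc m)
  IsNegCodeᶠ c φ = ∃ᶠ λ v → IsNumeralᶠ 2 v ∧ᶠ IsOPairᶠ c v φ

  -- The record `FormulaClosed` as a conjunction with `ω` as a parameter, the shape to which a
  -- first-order formula unfolds.
  FormulaClosed′ : V → Set ℓ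
  FormulaClosed′ F = (∀ c i j → i ∈ ω → j ∈ ω → IsMemCode c i j → c ∈ F)
                   × (∀ c i j → i ∈ ω → j ∈ ω → IsEqCode c i j → c ∈ F)
                   × (∀ c φ → φ ∈ F → IsNegCode c φ → c ∈ F)
                   × (∀ c φ ψ → φ ∈ F → ψ ∈ F → IsAndCode c φ ψ → c ∈ F)
                   × (∀ c i φ → i ∈ ω → φ ∈ F → IsExCode c i φ → c ∈ F)

  closed⇒closed′ : ∀ {F} → FormulaClosed F → FormulaClosed′ F
  closed⇒closed′ cl = (λ c i j i∈ j∈ → mem-closed c i j (∈ω⇒nat i∈) (∈ω⇒nat j∈))
                    , (λ c i j i∈ j∈ → eq-closed c i j (∈ω⇒nat i∈) (∈ω⇒nat j∈))
                    , neg-closed , and-closed , λ c i φ i∈ → ex-closed c i φ (∈ω⇒nat i∈)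
    where open FormulaClosed cl

  closed′⇒closed : ∀ {F} → FormulaClosed′ F → FormulaClosed F
  closed′⇒closed (m , e , n , a , x) = record
    { mem-closed = λ c i j hi hj → m c i j (nat⇒∈ω hi) (nat⇒∈ω hj)
    ; eq-closed  = λ c i j hi hj → e c i j (nat⇒∈ω hi) (nat⇒∈ω hj)
    ; neg-closed = n ; and-closed = a
    ; ex-closed  = λ c i φ hi → x c i φ (nat⇒∈ω hi) }

  mkFormulaClosed : ∀ {F} → (∀ i j → i ∈ ω → j ∈ ω → memᶜ i j ∈ F) → (∀ i j → i ∈ ω → j ∈ ω → eqᶜ i j ∈ F) →
    (∀ φ → φ ∈ F → negᶜ φ ∈ F) → (∀ φ ψ → φ ∈ F → ψ ∈ F → andᶜ φ ψ ∈ F) →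
    (∀ i φ → i ∈ ω → φ ∈ F → exᶜ i φ ∈ F) → FormulaClosed F
  mkFormulaClosed m e n a x = closed′⇒closed
    ( (λ c i j i∈ j∈ h → subst (_∈ _) (sym (tagged-unique 0 h)) (m i j i∈ j∈))
    , (λ c i j i∈ j∈ h → subst (_∈ _) (sym (tagged-unique 1 h)) (e i j i∈ j∈))
    , (λ c φ φ∈ h → subst (_∈ _) (sym (negCode-unique h)) (n φ φ∈))
    , (λ c φ ψ φ∈ ψ∈ h → subst (_∈ _) (sym (tagged-unique 3 h)) (a φ ψ φ∈ ψ∈))
    , (λ c i φ i∈ φ∈ h → subst (_∈ _) (sym (tagged-unique 4 h)) (x i φ i∈ φ∈)))

  adjoinClosed⇒formulaClosed : ∀ {Y} → AdjoinClosed Y → FormulaClosed Y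
  adjoinClosed⇒formulaClosed cl = mkFormulaClosed
    (λ i j i∈ j∈ → tagged 0 (has-opair (has-ω i i∈) (has-ω j j∈)))
    (λ i j i∈ j∈ → tagged 1 (has-opair (has-ω i i∈) (has-ω j j∈)))
    (λ φ φ∈ → tagged 2 φ∈)
    (λ φ ψ φ∈ ψ∈ → tagged 3 (has-opair φ∈ ψ∈))
    (λ i φ i∈ φ∈ → tagged 4 (has-opair (has-ω i i∈) φ∈))
    where
    open AdjoinClosed cl
    tagged : ∀ k {d} → d ∈ _ → tag k d ∈ _
    tagged k d∈ = has-opair (has-ω _ (num∈ω k)) d∈

  opaque
    -- Being a formula means lying in every closed set, so separation needs one closed set as a
    -- bound. `𝕌 ∅ ω`, the set of hereditarily finite sets, is one.
    formulas : ∃[ F ] (∀ c → c ∈ F ⇔ (c ∈ 𝕌 ∅ ω × (∀ F → FormulaClosed′ F → c ∈ F)))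
    formulas = separation-of
      where
      φ : Class 1
      φ (ω ∷ []) c = ∀ᶠ λ F →
        ((∀ᶠ λ c → ∀ᶠ λ i → ∀ᶠ λ j → i ∈ᶠ ω ⇒ᶠ j ∈ᶠ ω ⇒ᶠ IsTaggedᶠ 0 c i j ⇒ᶠ c ∈ᶠ F)
         ∧ᶠ (∀ᶠ λ c → ∀ᶠ λ i → ∀ᶠ λ j → i ∈ᶠ ω ⇒ᶠ j ∈ᶠ ω ⇒ᶠ IsTaggedᶠ 1 c i j ⇒ᶠ c ∈ᶠ F)
         ∧ᶠ (∀ᶠ λ c → ∀ᶠ λ φ → φ ∈ᶠ F ⇒ᶠ IsNegCodeᶠ c φ ⇒ᶠ c ∈ᶠ F)
         ∧ᶠ (∀ᶠ λ c → ∀ᶠ λ φ → ∀ᶠ λ ψ → φ ∈ᶠ F ⇒ᶠ ψ ∈ᶠ F ⇒ᶠ IsTaggedᶠ 3 c φ ψ ⇒ᶠ c ∈ᶠ F)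
         ∧ᶠ (∀ᶠ λ c → ∀ᶠ λ i → ∀ᶠ λ φ → i ∈ᶠ ω ⇒ᶠ φ ∈ᶠ F ⇒ᶠ IsTaggedᶠ 4 c i φ ⇒ᶠ c ∈ᶠ F))
        ⇒ᶠ c ∈ᶠ F
      separation-of : ∃[ F ] (∀ c → c ∈ F ⇔ (c ∈ 𝕌 ∅ ω × (∀ F → FormulaClosed′ F → c ∈ F)))
      separation-of = sep (𝕌 ∅ ω) (ω ∷ []) φ , λ c → ∈-sep (𝕌 ∅ ω) (ω ∷ []) φ

  Form : V
  Form = proj₁ formulas

  form⇒ : ∀ {c} → c ∈ Form → IsFormula c
  form⇒ c∈ F cl = proj₂ (to (proj₂ formulas _) c∈) F (closed⇒closed′ cl)

  ⇒form : ∀ {c} → IsFormula c → c ∈ Form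
  ⇒form h = from (proj₂ formulas _) (h _ (adjoinClosed⇒formulaClosed (𝕌ω-closed λ x x∈ → ⊥-elim (∅-empty x x∈)))
                                    , λ F cl → h F (closed′⇒closed cl))

  mem-formula : ∀ {i j} → i ∈ ω → j ∈ ω → IsFormula (memᶜ i j)
  mem-formula i∈ j∈ F cl = FormulaClosed.mem-closed cl _ _ _ (∈ω⇒nat i∈) (∈ω⇒nat j∈) (isTagged 0 _ _)

  eq-formula : ∀ {i j} → i ∈ ω → j ∈ ω → IsFormula (eqᶜ i j)
  eq-formula i∈ j∈ F cl = FormulaClosed.eq-closed cl _ _ _ (∈ω⇒nat i∈) (∈ω⇒nat j∈) (isTagged 1 _ _)

  neg-formula : ∀ {φ} → IsFormula φ → IsFormula (negᶜ φ)
  neg-formula h F cl = FormulaClosed.neg-closed cl _ _ (h F cl) (isNegCode _)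

  and-formula : ∀ {φ ψ} → IsFormula φ → IsFormula ψ → IsFormula (andᶜ φ ψ)
  and-formula h h′ F cl = FormulaClosed.and-closed cl _ _ _ (h F cl) (h′ F cl) (isTagged 3 _ _)

  ex-formula : ∀ {i φ} → i ∈ ω → IsFormula φ → IsFormula (exᶜ i φ)
  ex-formula i∈ h F cl = FormulaClosed.ex-closed cl _ _ _ (∈ω⇒nat i∈) (h F cl) (isTagged 4 _ _)

  record FormulaInduction (P : V → Set ℓ) : Set ℓ where
    field
      mem-case : ∀ i j → i ∈ ω → j ∈ ω → P (memᶜ i j)
      eq-case  : ∀ i j → i ∈ ω → j ∈ ω → P (eqᶜ i j)
      neg-case : ∀ φ → IsFormula φ → P φ → P (negᶜ φ)
      and-case : ∀ φ ψ → IsFormula φ → IsFormula ψ → P φ → P ψ → P (andᶜ φ ψ)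
      ex-case  : ∀ i φ → i ∈ ω → IsFormula φ → P φ → P (exᶜ i φ)

  -- Codes lie in every closed set, in particular in the set of formulas that have the property.
  -- Codes of nonstandard length are thus covered, which recursion on `Formula` could not reach; in
  -- return the property has to be given by a `Class`.
  formula-induction : ∀ {k} (ρ : Vec V k) (φ : Class k) → FormulaInduction (⟦ φ ⟧₁ ρ) →
                      ∀ c → IsFormula c → ⟦ φ ⟧₁ ρ c
  formula-induction ρ φ ind c hc = proj₂ (to (∈-sep Form ρ φ) (hc (sep Form ρ φ) (mkFormulaClosed
      (λ i j i∈ j∈ → intro (mem-formula i∈ j∈) (mem-case i j i∈ j∈))
      (λ i j i∈ j∈ → intro (eq-formula i∈ j∈) (eq-case i j i∈ j∈))
      (λ a a∈ → let fa , pa = elim a∈ in intro (neg-formula fa) (neg-case a fa pa))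
      (λ a b a∈ b∈ → let fa , pa = elim a∈ ; fb , pb = elim b∈ in
                     intro (and-formula fa fb) (and-case a b fa fb pa pb))
      (λ i a i∈ a∈ → let fa , pa = elim a∈ in intro (ex-formula i∈ fa) (ex-case i a i∈ fa pa)))))
    where
    open FormulaInduction ind
    intro : ∀ {c} → IsFormula c → ⟦ φ ⟧₁ ρ c → c ∈ sep Form ρ φ
    intro f p = from (∈-sep Form ρ φ) (⇒form f , p)
    elim : ∀ {c} → c ∈ sep Form ρ φ → IsFormula c × ⟦ φ ⟧₁ ρ c
    elim h = let c∈ , p = to (∈-sep Form ρ φ) h in form⇒ c∈ , p

  -- Assignments and their updates

  Asn : V → V
  Asn A = sep (𝒫 (ω ⊗ A)) (ω ∷ A ∷ []) λ { (ω ∷ A ∷ []) s → IsFunctionᶠ s ω A }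

  asn-function : ∀ {A s} → s ∈ Asn A → IsFunction s ω A
  asn-function h = proj₂ (to (∈-sep _ _ _) h)

  function⇒∈𝒫 : ∀ {f A B} → IsRelation f A B → f ∈ 𝒫 (A ⊗ B)
  function⇒∈𝒫 {f} {A} {B} rel = from ∈-𝒫 λ p p∈ → let x , y , x∈ , y∈ , hp = rel p p∈ in
    subst (_∈ (A ⊗ B)) (sym (opair-unique hp)) (∈-⊗-intro x∈ y∈)

  function-asn : ∀ {A s} → IsFunction s ω A → s ∈ Asn A
  function-asn h = from (∈-sep _ _ _) (function⇒∈𝒫 (proj₁ h) , h)

  asn⇒ : ∀ {A s} → s ∈ Asn A → IsAssignment s A
  asn⇒ h = ω , isOmega , asn-function h

  ⇒asn : ∀ {A s} → IsAssignment s A → s ∈ Asn A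
  ⇒asn (w , hw , h) with omega-unique hw
  ... | refl = function-asn h

  asn-value : ∀ {A s i} → s ∈ Asn A → i ∈ ω → ∃[ x ] x ∈ A × ⟨ i , x ⟩∈ s
  asn-value h i∈ = let x , ix = proj₁ (proj₂ (asn-function h)) _ i∈ in x , function-cod (asn-function h) ix , ix

  asn-single : ∀ {A s i x y} → s ∈ Asn A → ⟨ i , x ⟩∈ s → ⟨ i , y ⟩∈ s → x ≡ y
  asn-single h = proj₂ (proj₂ (asn-function h)) _ _ _

  asn-mono : ∀ {A B s} → A ⊆ B → s ∈ Asn A → s ∈ Asn B
  asn-mono A⊆B h = let rel , total , single = asn-function h in
    function-asn ((λ p p∈ → let x , y , x∈ , y∈ , hp = rel p p∈ in x , y , x∈ , A⊆B y y∈ , hp) , total , single)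

  -- `IsUpdate` with the set of assignments as a parameter 𝒜, so that formulas can refer to it by a
  -- variable.
  Update : V → V → V → V → V → Set ℓ
  Update 𝒜 s′ s i a = s′ ∈ 𝒜 × ⟨ i , a ⟩∈ s′ × (∀ j x → j ≢ i → ⟨ j , x ⟩∈ s → ⟨ j , x ⟩∈ s′)

  Updateᶠ : ∀ {m} → ℕ → ℕ → ℕ → ℕ → ℕ → Formula (suc m)
  Updateᶠ 𝒜 s′ s i a = s′ ∈ᶠ 𝒜 ∧ᶠ ⟨ i , a ⟩∈ᶠ s′
    ∧ᶠ (∀ᶠ λ j → ∀ᶠ λ x → ¬ᶠ (j ≡ᶠ i) ⇒ᶠ ⟨ j , x ⟩∈ᶠ s ⇒ᶠ ⟨ j , x ⟩∈ᶠ s′)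

  update : V → V → V → V
  update s i a = adjoin (sep s (i ∷ []) λ { (i ∷ []) p → ¬ᶠ (∃ᶠ λ x → IsOPairᶠ p i x) }) ⟪ i , a ⟫

  update-old : ∀ {s i a j x} → j ≢ i → ⟨ j , x ⟩∈ s → ⟨ j , x ⟩∈ update s i a
  update-old j≢i jx = ⇒⟨⟩ (⊆-adjoin _ (from (∈-sep _ _ _) (⟨⟩⇒ jx ,
    λ { (y , hp) → j≢i (proj₁ (opair-inj (opair-unique hp))) })))

  update-inv : ∀ {s i a j x} → ⟨ j , x ⟩∈ update s i a → (j ≢ i × ⟨ j , x ⟩∈ s) ⊎ (j ≡ i × x ≡ a)
  update-inv {x = x} h with ⟨⟩∈-adjoin h
  ... | inj₂ e = inj₂ e
  ... | inj₁ h′ with to (∈-sep _ _ _) (⟨⟩⇒ h′)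
  ... | jx , ¬i = inj₁ ((λ { refl → ¬i (x , isOPair _ _) }) , ⇒⟨⟩ jx)

  update-asn : ∀ {A s i a} → s ∈ Asn A → i ∈ ω → a ∈ A → update s i a ∈ Asn A
  update-asn {A} {s} {i} {a} hs i∈ a∈ = function-asn (rel , total , single)
    where
    rel : IsRelation (update s i a) ω A
    rel p p∈ with to ∈-adjoin p∈
    ... | inj₂ refl = i , a , i∈ , a∈ , isOPair i a
    ... | inj₁ h = proj₁ (asn-function hs) p (proj₁ (to (∈-sep _ _ _) h))
    total : ∀ j → j ∈ ω → ∃[ x ] ⟨ j , x ⟩∈ update s i a
    total j j∈ with em {j ≡ i}
    ... | yes refl = a , ⟨⟩∈-adjoin-new
    ... | no j≢i = let x , _ , jx = asn-value hs j∈ in x , update-old j≢i jx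
    single : ∀ j x y → ⟨ j , x ⟩∈ update s i a → ⟨ j , y ⟩∈ update s i a → x ≡ y
    single j x y h h′ with update-inv h | update-inv h′
    ... | inj₁ (_ , jx) | inj₁ (_ , jy) = asn-single hs jx jy
    ... | inj₁ (j≢i , _) | inj₂ (j≡i , _) = ⊥-elim (j≢i j≡i)
    ... | inj₂ (j≡i , _) | inj₁ (j≢i , _) = ⊥-elim (j≢i j≡i)
    ... | inj₂ (_ , e) | inj₂ (_ , e′) = trans e (sym e′)

  update-Update : ∀ {A s i a} → s ∈ Asn A → i ∈ ω → a ∈ A → Update (Asn A) (update s i a) s i a
  update-Update hs i∈ a∈ = update-asn hs i∈ a∈ , ⟨⟩∈-adjoin-new , λ j x → update-old

  Update-unique : ∀ {A s′ s i a} → s ∈ Asn A → Update (Asn A) s′ s i a → s′ ≡ update s i a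
  Update-unique {A} {s′} {s} {i} {a} hs (hs′ , ia , old) = ext fwd bwd
    where
    fwd : s′ ⊆ update s i a
    fwd p p∈ with proj₁ (asn-function hs′) p p∈
    ... | j , x , j∈ , _ , hp with opair-unique hp | em {j ≡ i}
    ... | refl | yes refl = from ∈-adjoin (inj₂ (cong ⟪ j ,_⟫ (asn-single hs′ (⇒⟨⟩ p∈) ia)))
    ... | refl | no j≢i with asn-value hs j∈
    ...   | y , _ , jy with asn-single hs′ (⇒⟨⟩ p∈) (old j y j≢i jy)
    ...   | refl = ⟨⟩⇒ (update-old j≢i jy)
    bwd : update s i a ⊆ s′
    bwd p p∈ with to ∈-adjoin p∈
    ... | inj₂ refl = ⟨⟩⇒ ia
    ... | inj₁ h with to (∈-sep _ _ _) h
    ... | p∈s , ¬i with proj₁ (asn-function hs) p p∈s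
    ... | j , x , _ , _ , hp with opair-unique hp
    ... | refl = ⟨⟩⇒ (old j x (λ { refl → ¬i (x , isOPair _ _) }) (⇒⟨⟩ p∈s))

  update-IsUpdate : ∀ {A s i a} → s ∈ Asn A → i ∈ ω → a ∈ A → IsUpdate A (update s i a) s i a
  update-IsUpdate hs i∈ a∈ = let hu , rest = update-Update hs i∈ a∈ in asn⇒ hu , rest

  IsUpdate-unique : ∀ {A s′ s i a} → s ∈ Asn A → IsUpdate A s′ s i a → s′ ≡ update s i a
  IsUpdate-unique hs (hs′ , rest) = Update-unique hs (⇒asn hs′ , rest)

  -- Existence of a satisfaction set

  -- Truth c B says that B is the set of assignments satisfying c; a Tarskian set g
  -- is a partial function c ↦ B whose domain is closed under subformulas.
  module _ (A : V) where

    Obeys : V → V → V → Set ℓ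
    Obeys g c B =
        (∀ i j → IsMemCode c i j → ∀ s → s ∈ B ⇔ (s ∈ Asn A × (∃[ x ] ∃[ y ] ⟨ i , x ⟩∈ s × ⟨ j , y ⟩∈ s × x ∈ y)))
      × (∀ i j → IsEqCode c i j → ∀ s → s ∈ B ⇔ (s ∈ Asn A × (∃[ x ] ∃[ y ] ⟨ i , x ⟩∈ s × ⟨ j , y ⟩∈ s × x ≡ y)))
      × (∀ φ → IsNegCode c φ → ∃[ C ] ⟨ φ , C ⟩∈ g × (∀ s → s ∈ B ⇔ (s ∈ Asn A × s ∉ C)))
      × (∀ φ ψ → IsAndCode c φ ψ → ∃[ C ] ∃[ E ] ⟨ φ , C ⟩∈ g × ⟨ ψ , E ⟩∈ g × (∀ s → s ∈ B ⇔ (s ∈ C × s ∈ E)))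
      × (∀ i φ → IsExCode c i φ → ∃[ C ] ⟨ φ , C ⟩∈ g ×
           (∀ s → s ∈ B ⇔ (s ∈ Asn A × (∃[ a ] ∃[ s′ ] a ∈ A × Update (Asn A) s′ s i a × s′ ∈ C))))

    Tarskian : V → Set ℓ
    Tarskian g = ∀ c B → ⟨ c , B ⟩∈ g → Obeys g c B

    Truth : V → V → Set ℓ
    Truth c B = ∃[ g ] Tarskian g × ⟨ c , B ⟩∈ g

  Truthᶠ : ∀ {m} → ℕ → ℕ → ℕ → ℕ → Formula (suc m)
  Truthᶠ A 𝒜 c B = ∃ᶠ λ g → (∀ᶠ λ c → ∀ᶠ λ B → ⟨ c , B ⟩∈ᶠ g ⇒ᶠ
       ((∀ᶠ λ i → ∀ᶠ λ j → IsTaggedᶠ 0 c i j ⇒ᶠ (∀ᶠ λ s → s ∈ᶠ B ⇔ᶠ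
            (s ∈ᶠ 𝒜 ∧ᶠ (∃ᶠ λ x → ∃ᶠ λ y → ⟨ i , x ⟩∈ᶠ s ∧ᶠ ⟨ j , y ⟩∈ᶠ s ∧ᶠ x ∈ᶠ y))))
     ∧ᶠ (∀ᶠ λ i → ∀ᶠ λ j → IsTaggedᶠ 1 c i j ⇒ᶠ (∀ᶠ λ s → s ∈ᶠ B ⇔ᶠ
            (s ∈ᶠ 𝒜 ∧ᶠ (∃ᶠ λ x → ∃ᶠ λ y → ⟨ i , x ⟩∈ᶠ s ∧ᶠ ⟨ j , y ⟩∈ᶠ s ∧ᶠ x ≡ᶠ y))))
     ∧ᶠ (∀ᶠ λ φ → IsNegCodeᶠ c φ ⇒ᶠ (∃ᶠ λ C → ⟨ φ , C ⟩∈ᶠ g ∧ᶠ (∀ᶠ λ s → s ∈ᶠ B ⇔ᶠ (s ∈ᶠ 𝒜 ∧ᶠ ¬ᶠ (s ∈ᶠ C)))))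
     ∧ᶠ (∀ᶠ λ φ → ∀ᶠ λ ψ → IsTaggedᶠ 3 c φ ψ ⇒ᶠ (∃ᶠ λ C → ∃ᶠ λ E → ⟨ φ , C ⟩∈ᶠ g ∧ᶠ ⟨ ψ , E ⟩∈ᶠ g
            ∧ᶠ (∀ᶠ λ s → s ∈ᶠ B ⇔ᶠ (s ∈ᶠ C ∧ᶠ s ∈ᶠ E))))
     ∧ᶠ (∀ᶠ λ i → ∀ᶠ λ φ → IsTaggedᶠ 4 c i φ ⇒ᶠ (∃ᶠ λ C → ⟨ φ , C ⟩∈ᶠ g
            ∧ᶠ (∀ᶠ λ s → s ∈ᶠ B ⇔ᶠ (s ∈ᶠ 𝒜 ∧ᶠ (∃ᶠ λ a → ∃ᶠ λ s′ → a ∈ᶠ A ∧ᶠ Updateᶠ 𝒜 s′ s i a ∧ᶠ s′ ∈ᶠ C)))))))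
    ∧ᶠ ⟨ c , B ⟩∈ᶠ g

  module _ {A : V} where

    -- The set g occurs only positively in `Obeys`: a pair asks for the presence of pairs for its
    -- subformulas. So Tarskian sets may be enlarged and united without checking that they are
    -- compatible; uniqueness of the values is a separate induction.
    obeys-mono : ∀ {g g′ c B} → g ⊆ g′ → Obeys A g c B → Obeys A g′ c B
    obeys-mono g⊆ (m , e , n , a , x) = m , e
      , (λ φ h → let C , φC , hB = n φ h in C , ⟨⟩-mono g⊆ φC , hB)
      , (λ φ ψ h → let C , E , φC , ψE , hB = a φ ψ h in C , E , ⟨⟩-mono g⊆ φC , ⟨⟩-mono g⊆ ψE , hB)
      , λ i φ h → let C , φC , hB = x i φ h in C , ⟨⟩-mono g⊆ φC , hB

    extend : ∀ {g c B} → Tarskian A g → Obeys A g c B → Truth A c B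
    extend {g} {c} {B} hg ob = adjoin g ⟪ c , B ⟫ , hg′ , ⟨⟩∈-adjoin-new
      where
      hg′ : Tarskian A (adjoin g ⟪ c , B ⟫)
      hg′ c′ B′ h with ⟨⟩∈-adjoin h
      ... | inj₁ h′ = obeys-mono ⊆-adjoin (hg c′ B′ h′)
      ... | inj₂ (refl , refl) = obeys-mono ⊆-adjoin ob

    tarskian-∪ : ∀ {g g′} → Tarskian A g → Tarskian A g′ → Tarskian A (g ∪ g′)
    tarskian-∪ hg hg′ c B h with to ∈-∪ (⟨⟩⇒ h)
    ... | inj₁ h′ = obeys-mono (λ z z∈ → from ∈-∪ (inj₁ z∈)) (hg c B (⇒⟨⟩ h′))
    ... | inj₂ h′ = obeys-mono (λ z z∈ → from ∈-∪ (inj₂ z∈)) (hg′ c B (⇒⟨⟩ h′))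

    truth-mem : ∀ {i j B} → Truth A (memᶜ i j) B →
      ∀ s → s ∈ B ⇔ (s ∈ Asn A × (∃[ x ] ∃[ y ] ⟨ i , x ⟩∈ s × ⟨ j , y ⟩∈ s × x ∈ y))
    truth-mem (g , hg , h) = proj₁ (hg _ _ h) _ _ (isTagged 0 _ _)

    truth-eq : ∀ {i j B} → Truth A (eqᶜ i j) B →
      ∀ s → s ∈ B ⇔ (s ∈ Asn A × (∃[ x ] ∃[ y ] ⟨ i , x ⟩∈ s × ⟨ j , y ⟩∈ s × x ≡ y))
    truth-eq (g , hg , h) = proj₁ (proj₂ (hg _ _ h)) _ _ (isTagged 1 _ _)

    opaque
      truth-neg : ∀ {φ B} → Truth A (negᶜ φ) B → ∃[ C ] Truth A φ C × (∀ s → s ∈ B ⇔ (s ∈ Asn A × s ∉ C))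
      truth-neg (g , hg , h) = let C , φC , hB = proj₁ (proj₂ (proj₂ (hg _ _ h))) _ (isNegCode _) in C , (g , hg , φC) , hB

    opaque
      truth-and : ∀ {φ ψ B} → Truth A (andᶜ φ ψ) B →
        ∃[ C ] ∃[ E ] Truth A φ C × Truth A ψ E × (∀ s → s ∈ B ⇔ (s ∈ C × s ∈ E))
      truth-and (g , hg , h) = let C , E , φC , ψE , hB = proj₁ (proj₂ (proj₂ (proj₂ (hg _ _ h)))) _ _ (isTagged 3 _ _) in
        C , E , (g , hg , φC) , (g , hg , ψE) , hB

    opaque
      truth-ex : ∀ {i φ B} → Truth A (exᶜ i φ) B → ∃[ C ] Truth A φ C ×
        (∀ s → s ∈ B ⇔ (s ∈ Asn A × (∃[ a ] ∃[ s′ ] a ∈ A × Update (Asn A) s′ s i a × s′ ∈ C)))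
      truth-ex (g , hg , h) = let C , φC , hB = proj₂ (proj₂ (proj₂ (proj₂ (hg _ _ h)))) _ _ (isTagged 4 _ _) in
        C , (g , hg , φC) , hB

    iff⇒≡ : ∀ {B B′} {P : V → Set ℓ} → (∀ s → s ∈ B ⇔ P s) → (∀ s → s ∈ B′ ⇔ P s) → B ≡ B′
    iff⇒≡ h h′ = ext (λ s s∈ → from (h′ s) (to (h s) s∈)) (λ s s∈ → from (h s) (to (h′ s) s∈))

    UniqueTruth HasTruth : V → Set ℓ
    UniqueTruth c = ∀ B B′ → Truth A c B → Truth A c B′ → B ≡ B′
    HasTruth c = ∃[ B ] Truth A c B

    unique-truth-cases : FormulaInduction UniqueTruth
    unique-truth-cases = record
      { mem-case = λ i j _ _ B B′ h h′ → iff⇒≡ (truth-mem h) (truth-mem h′)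
      ; eq-case  = λ i j _ _ B B′ h h′ → iff⇒≡ (truth-eq h) (truth-eq h′)
      ; neg-case = λ φ _ ih B B′ h h′ → neg-case ih (truth-neg h) (truth-neg h′)
      ; and-case = λ φ ψ _ _ ih ih′ B B′ h h′ → and-case ih ih′ (truth-and h) (truth-and h′)
      ; ex-case  = λ i φ _ _ ih B B′ h h′ → ex-case ih (truth-ex h) (truth-ex h′) }
      where
      neg-case : ∀ {φ B B′} → UniqueTruth φ → (∃[ C ] Truth A φ C × (∀ s → s ∈ B ⇔ (s ∈ Asn A × s ∉ C))) →
                 (∃[ C ] Truth A φ C × (∀ s → s ∈ B′ ⇔ (s ∈ Asn A × s ∉ C))) → B ≡ B′
      neg-case ih (C , hC , hB) (C′ , hC′ , hB′) with ih C C′ hC hC′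
      ... | refl = iff⇒≡ hB hB′
      and-case : ∀ {φ ψ B B′} → UniqueTruth φ → UniqueTruth ψ →
        (∃[ C ] ∃[ E ] Truth A φ C × Truth A ψ E × (∀ s → s ∈ B ⇔ (s ∈ C × s ∈ E))) →
        (∃[ C ] ∃[ E ] Truth A φ C × Truth A ψ E × (∀ s → s ∈ B′ ⇔ (s ∈ C × s ∈ E))) → B ≡ B′
      and-case ih ih′ (C , E , hC , hE , hB) (C′ , E′ , hC′ , hE′ , hB′) with ih C C′ hC hC′ | ih′ E E′ hE hE′
      ... | refl | refl = iff⇒≡ hB hB′
      ex-case : ∀ {i φ B B′} → UniqueTruth φ → (∃[ C ] Truth A φ C ×
        (∀ s → s ∈ B ⇔ (s ∈ Asn A × (∃[ a ] ∃[ s′ ] a ∈ A × Update (Asn A) s′ s i a × s′ ∈ C)))) →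
        (∃[ C ] Truth A φ C ×
        (∀ s → s ∈ B′ ⇔ (s ∈ Asn A × (∃[ a ] ∃[ s′ ] a ∈ A × Update (Asn A) s′ s i a × s′ ∈ C)))) → B ≡ B′
      ex-case ih (C , hC , hB) (C′ , hC′ , hB′) with ih C C′ hC hC′
      ... | refl = iff⇒≡ hB hB′

    -- The satisfying assignments are separated according to the main connective, and the new pair
    -- is added to a Tarskian set that treats the subformulas. A code has only one tag, which makes
    -- the other four clauses of `Obeys` vacuous.
    has-truth-cases : FormulaInduction HasTruth
    has-truth-cases = record
      { mem-case = λ i j _ _ →
          let φ = λ { (i ∷ j ∷ []) s → ∃ᶠ λ x → ∃ᶠ λ y → ⟨ i , x ⟩∈ᶠ s ∧ᶠ ⟨ j , y ⟩∈ᶠ s ∧ᶠ x ∈ᶠ y }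
          in sep (Asn A) (i ∷ j ∷ []) φ , extend {∅} ∅-tarskian
             ( (λ i′ j′ h s → same 0 (tagged-unique 0 h) (∈-sep (Asn A) (i ∷ j ∷ []) φ))
             , (λ _ _ h → tag-clash 0 1 (tagged-unique 1 h) λ ()) , (λ _ h → tag-clash 0 2 (negCode-unique h) λ ())
             , (λ _ _ h → tag-clash 0 3 (tagged-unique 3 h) λ ()) , (λ _ _ h → tag-clash 0 4 (tagged-unique 4 h) λ ()))
      ; eq-case = λ i j _ _ →
          let φ = λ { (i ∷ j ∷ []) s → ∃ᶠ λ x → ∃ᶠ λ y → ⟨ i , x ⟩∈ᶠ s ∧ᶠ ⟨ j , y ⟩∈ᶠ s ∧ᶠ x ≡ᶠ y }
          in sep (Asn A) (i ∷ j ∷ []) φ , extend {∅} ∅-tarskian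
             ( (λ _ _ h → tag-clash 1 0 (tagged-unique 0 h) λ ())
             , (λ i′ j′ h s → same 1 (tagged-unique 1 h) (∈-sep (Asn A) (i ∷ j ∷ []) φ))
             , (λ _ h → tag-clash 1 2 (negCode-unique h) λ ())
             , (λ _ _ h → tag-clash 1 3 (tagged-unique 3 h) λ ()) , (λ _ _ h → tag-clash 1 4 (tagged-unique 4 h) λ ()))
      ; neg-case = λ { φ _ (C , g , hg , φC) →
          let ψ = λ { (C ∷ []) s → ¬ᶠ (s ∈ᶠ C) }
          in sep (Asn A) (C ∷ []) ψ , extend hg
             ( (λ _ _ h → tag-clash 2 0 (tagged-unique 0 h) λ ()) , (λ _ _ h → tag-clash 2 1 (tagged-unique 1 h) λ ())
             , (λ φ′ h → C , subst (λ φ → ⟨ φ , C ⟩∈ g) (proj₂ (opair-inj (negCode-unique h))) φC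
                           , λ s → ∈-sep (Asn A) (C ∷ []) ψ)
             , (λ _ _ h → tag-clash 2 3 (tagged-unique 3 h) λ ()) , (λ _ _ h → tag-clash 2 4 (tagged-unique 4 h) λ ())) }
      ; and-case = λ { φ ψ _ _ (C , g , hg , φC) (E , g′ , hg′ , ψE) →
          let χ = λ { (E ∷ []) s → s ∈ᶠ E }
          in sep C (E ∷ []) χ , extend (tarskian-∪ hg hg′)
             ( (λ _ _ h → tag-clash 3 0 (tagged-unique 0 h) λ ()) , (λ _ _ h → tag-clash 3 1 (tagged-unique 1 h) λ ())
             , (λ _ h → tag-clash 3 2 (negCode-unique h) λ ())
             , (λ φ′ ψ′ h → let e , e′ = args 3 h in C , E
                  , subst (λ φ → ⟨ φ , C ⟩∈ (g ∪ g′)) e (⟨⟩-mono (λ z z∈ → from ∈-∪ (inj₁ z∈)) φC)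
                  , subst (λ ψ → ⟨ ψ , E ⟩∈ (g ∪ g′)) e′ (⟨⟩-mono (λ z z∈ → from ∈-∪ (inj₂ z∈)) ψE)
                  , λ s → ∈-sep C (E ∷ []) χ)
             , (λ _ _ h → tag-clash 3 4 (tagged-unique 4 h) λ ())) }
      ; ex-case = λ { i φ _ _ (C , g , hg , φC) →
          let ψ = λ { (A ∷ 𝒜 ∷ i ∷ C ∷ []) s → ∃ᶠ λ a → ∃ᶠ λ s′ → a ∈ᶠ A ∧ᶠ Updateᶠ 𝒜 s′ s i a ∧ᶠ s′ ∈ᶠ C }
          in sep (Asn A) (A ∷ Asn A ∷ i ∷ C ∷ []) ψ , extend hg
             ( (λ _ _ h → tag-clash 4 0 (tagged-unique 0 h) λ ()) , (λ _ _ h → tag-clash 4 1 (tagged-unique 1 h) λ ())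
             , (λ _ h → tag-clash 4 2 (negCode-unique h) λ ()) , (λ _ _ h → tag-clash 4 3 (tagged-unique 3 h) λ ())
             , (λ i′ φ′ h → let e , e′ = args 4 h in C
                  , subst (λ φ → ⟨ φ , C ⟩∈ g) e′ φC
                  , λ s → subst (λ i′ → _ ⇔ (s ∈ Asn A × (∃[ a ] ∃[ s′ ] a ∈ A × Update (Asn A) s′ s i′ a × s′ ∈ C))) e
                            (∈-sep (Asn A) (A ∷ Asn A ∷ i ∷ C ∷ []) ψ))) } }
      where
      ∅-tarskian : Tarskian A ∅
      ∅-tarskian c B h = ⊥-elim (∅-empty _ (⟨⟩⇒ h))
      args : ∀ k {x y x′ y′} → (∃[ v ] IsNumeral k v × IsTriple (tag k ⟪ x , y ⟫) v x′ y′) → x ≡ x′ × y ≡ y′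
      args k h = opair-inj (proj₂ (opair-inj (tagged-unique k h)))
      same : ∀ k {i j i′ j′ s} {B : Set ℓ} {R : V → V → Set ℓ} → tag k ⟪ i , j ⟫ ≡ tag k ⟪ i′ , j′ ⟫ →
        B ⇔ (s ∈ Asn A × (∃[ x ] ∃[ y ] ⟨ i , x ⟩∈ s × ⟨ j , y ⟩∈ s × R x y)) →
        B ⇔ (s ∈ Asn A × (∃[ x ] ∃[ y ] ⟨ i′ , x ⟩∈ s × ⟨ j′ , y ⟩∈ s × R x y))
      same k e h with opair-inj (proj₂ (opair-inj e))
      ... | refl , refl = h

    opaque
      truth-unique : ∀ c → IsFormula c → UniqueTruth c
      truth-unique = formula-induction (A ∷ Asn A ∷ [])
        (λ { (A ∷ 𝒜 ∷ []) c → ∀ᶠ λ B → ∀ᶠ λ B′ → Truthᶠ A 𝒜 c B ⇒ᶠ Truthᶠ A 𝒜 c B′ ⇒ᶠ B ≡ᶠ B′ }) unique-truth-cases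

      truth-exists : ∀ c → IsFormula c → HasTruth c
      truth-exists = formula-induction (A ∷ Asn A ∷ []) (λ { (A ∷ 𝒜 ∷ []) c → ∃ᶠ λ B → Truthᶠ A 𝒜 c B }) has-truth-cases

    opaque
      truths : ∃[ S ] (∀ p → p ∈ S ⇔ (p ∈ (Form ⊗ Asn A) ×
                 (∃[ c ] ∃[ s ] ∃[ B ] IsOPair p c s × Truth A c B × s ∈ B)))
      truths = sep (Form ⊗ Asn A) (A ∷ Asn A ∷ []) φ , λ p → ∈-sep (Form ⊗ Asn A) (A ∷ Asn A ∷ []) φ
        where
        φ : Class 2
        φ (A ∷ 𝒜 ∷ []) p = ∃ᶠ λ c → ∃ᶠ λ s → ∃ᶠ λ B → IsOPairᶠ p c s ∧ᶠ Truthᶠ A 𝒜 c B ∧ᶠ s ∈ᶠ B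

    truths-value : ∀ {c s B} → IsFormula c → s ∈ Asn A → Truth A c B → ⟨ c , s ⟩∈ proj₁ truths ⇔ s ∈ B
    truths-value {c} {s} {B} hc hs hB = mk⇔ fwd λ s∈ → ⇒⟨⟩ (from (proj₂ truths _)
        (∈-⊗-intro (⇒form hc) hs , c , s , B , isOPair c s , hB , s∈))
      where
      fwd : ⟨ c , s ⟩∈ proj₁ truths → s ∈ B
      fwd h with to (proj₂ truths _) (⟨⟩⇒ h)
      ... | _ , _ , _ , B′ , hp , hB′ , s∈ with opair-inj (opair-unique hp)
      ... | refl , refl with truth-unique c hc B B′ hB hB′
      ... | refl = s∈

    truths-satisfaction : IsSatisfaction A (proj₁ truths)
    truths-satisfaction = record
      { sat-mem = λ c i j s hi hj hc hs → sat-mem (nat⇒∈ω hi) (nat⇒∈ω hj) (⇒asn hs) (tagged-unique 0 hc)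
      ; sat-eq  = λ c i j s hi hj hc hs → sat-eq (nat⇒∈ω hi) (nat⇒∈ω hj) (⇒asn hs) (tagged-unique 1 hc)
      ; sat-neg = λ c φ s hφ hc hs → sat-neg hφ (⇒asn hs) (negCode-unique hc)
      ; sat-and = λ c φ ψ s hφ hψ hc hs → sat-and hφ hψ (⇒asn hs) (tagged-unique 3 hc)
      ; sat-ex  = λ c i φ s hi hφ hc hs → sat-ex (nat⇒∈ω hi) hφ (⇒asn hs) (tagged-unique 4 hc) }
      where
      S : V
      S = proj₁ truths
      sat-mem : ∀ {c i j s} → i ∈ ω → j ∈ ω → s ∈ Asn A → c ≡ memᶜ i j →
                ⟨ c , s ⟩∈ S ⇔ (∃[ x ] ∃[ y ] ⟨ i , x ⟩∈ s × ⟨ j , y ⟩∈ s × x ∈ y)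
      sat-mem {s = s} i∈ j∈ hs refl =
        let B , hB = truth-exists _ (mem-formula i∈ j∈)
            v = truths-value (mem-formula i∈ j∈) hs hB in
        mk⇔ (λ h → proj₂ (to (truth-mem hB s) (to v h))) (λ h → from v (from (truth-mem hB s) (hs , h)))
      sat-eq : ∀ {c i j s} → i ∈ ω → j ∈ ω → s ∈ Asn A → c ≡ eqᶜ i j →
               ⟨ c , s ⟩∈ S ⇔ (∃[ x ] ∃[ y ] ⟨ i , x ⟩∈ s × ⟨ j , y ⟩∈ s × x ≡ y)
      sat-eq {s = s} i∈ j∈ hs refl =
        let B , hB = truth-exists _ (eq-formula i∈ j∈)
            v = truths-value (eq-formula i∈ j∈) hs hB in
        mk⇔ (λ h → proj₂ (to (truth-eq hB s) (to v h))) (λ h → from v (from (truth-eq hB s) (hs , h)))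
      sat-neg : ∀ {c φ s} → IsFormula φ → s ∈ Asn A → c ≡ negᶜ φ → ⟨ c , s ⟩∈ S ⇔ (¬ ⟨ φ , s ⟩∈ S)
      sat-neg {s = s} hφ hs refl =
        let B , hB = truth-exists _ (neg-formula hφ)
            C , hC , eB = truth-neg hB
            v = truths-value (neg-formula hφ) hs hB
            v′ = truths-value hφ hs hC in
        mk⇔ (λ h h′ → proj₂ (to (eB s) (to v h)) (to v′ h′)) (λ h → from v (from (eB s) (hs , λ s∈ → h (from v′ s∈))))
      sat-and : ∀ {c φ ψ s} → IsFormula φ → IsFormula ψ → s ∈ Asn A → c ≡ andᶜ φ ψ →
                ⟨ c , s ⟩∈ S ⇔ (⟨ φ , s ⟩∈ S × ⟨ ψ , s ⟩∈ S)
      sat-and {s = s} hφ hψ hs refl =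
        let B , hB = truth-exists _ (and-formula hφ hψ)
            C , E , hC , hE , eB = truth-and hB
            v = truths-value (and-formula hφ hψ) hs hB
            v₁ = truths-value hφ hs hC
            v₂ = truths-value hψ hs hE in
        mk⇔ (λ h → let s∈C , s∈E = to (eB s) (to v h) in from v₁ s∈C , from v₂ s∈E)
            (λ { (h₁ , h₂) → from v (from (eB s) (to v₁ h₁ , to v₂ h₂)) })
      sat-ex : ∀ {c i φ s} → i ∈ ω → IsFormula φ → s ∈ Asn A → c ≡ exᶜ i φ →
               ⟨ c , s ⟩∈ S ⇔ (∃[ a ] ∃[ s′ ] a ∈ A × IsUpdate A s′ s i a × ⟨ φ , s′ ⟩∈ S)
      sat-ex {s = s} i∈ hφ hs refl =
        let B , hB = truth-exists _ (ex-formula i∈ hφ)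
            C , hC , eB = truth-ex hB
            v = truths-value (ex-formula i∈ hφ) hs hB in
        mk⇔ (λ h → let _ , a , s′ , a∈ , (hs′ , up) , s′∈ = to (eB s) (to v h) in
                   a , s′ , a∈ , (asn⇒ hs′ , up) , from (truths-value hφ hs′ hC) s′∈)
            (λ h → let a , s′ , a∈ , (hs′ , up) , φs′ = h in
                   from v (from (eB s) (hs , a , s′ , a∈ , (⇒asn hs′ , up) , to (truths-value hφ (⇒asn hs′) hC) φs′)))

  opaque
    satisfaction : ∀ A → ∃[ S ] IsSatisfaction A S
    satisfaction A = proj₁ truths , truths-satisfaction {A}

  module Satisfied {A S : V} (sat : IsSatisfaction A S) where

    open IsSatisfaction sat

    ⊨mem : ∀ {i j s} → i ∈ ω → j ∈ ω → s ∈ Asn A →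
           ⟨ memᶜ i j , s ⟩∈ S ⇔ (∃[ x ] ∃[ y ] ⟨ i , x ⟩∈ s × ⟨ j , y ⟩∈ s × x ∈ y)
    ⊨mem i∈ j∈ hs = sat-mem _ _ _ _ (∈ω⇒nat i∈) (∈ω⇒nat j∈) (isTagged 0 _ _) (asn⇒ hs)

    ⊨eq : ∀ {i j s} → i ∈ ω → j ∈ ω → s ∈ Asn A →
          ⟨ eqᶜ i j , s ⟩∈ S ⇔ (∃[ x ] ∃[ y ] ⟨ i , x ⟩∈ s × ⟨ j , y ⟩∈ s × x ≡ y)
    ⊨eq i∈ j∈ hs = sat-eq _ _ _ _ (∈ω⇒nat i∈) (∈ω⇒nat j∈) (isTagged 1 _ _) (asn⇒ hs)

    ⊨neg : ∀ {φ s} → IsFormula φ → s ∈ Asn A → ⟨ negᶜ φ , s ⟩∈ S ⇔ (¬ ⟨ φ , s ⟩∈ S)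
    ⊨neg hφ hs = sat-neg _ _ _ hφ (isNegCode _) (asn⇒ hs)

    ⊨and : ∀ {φ ψ s} → IsFormula φ → IsFormula ψ → s ∈ Asn A →
           ⟨ andᶜ φ ψ , s ⟩∈ S ⇔ (⟨ φ , s ⟩∈ S × ⟨ ψ , s ⟩∈ S)
    ⊨and hφ hψ hs = sat-and _ _ _ _ hφ hψ (isTagged 3 _ _) (asn⇒ hs)

    ⊨ex : ∀ {i φ s} → i ∈ ω → IsFormula φ → s ∈ Asn A →
          ⟨ exᶜ i φ , s ⟩∈ S ⇔ (∃[ a ] a ∈ A × ⟨ φ , update s i a ⟩∈ S)
    ⊨ex {i} {φ} {s} i∈ hφ hs = mk⇔
      (λ h → let a , s′ , a∈ , up , h′ = to e h in a , a∈ , subst (λ s → ⟨ φ , s ⟩∈ S) (IsUpdate-unique hs up) h′)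
      (λ { (a , a∈ , h) → from e (a , update s i a , a∈ , update-IsUpdate hs i∈ a∈ , h) })
      where
      e : ⟨ exᶜ i φ , s ⟩∈ S ⇔ (∃[ a ] ∃[ s′ ] a ∈ A × IsUpdate A s′ s i a × ⟨ φ , s′ ⟩∈ S)
      e = sat-ex _ _ _ _ (∈ω⇒nat i∈) hφ (isTagged 4 _ _) (asn⇒ hs)

  -- The Tarski-Vaught test and finite support

  opaque
    tarski-vaught : ∀ {M N S T} → M ⊆ N → IsSatisfaction M S → IsSatisfaction N T →
      (∀ i φ s a → i ∈ ω → IsFormula φ → s ∈ Asn M → a ∈ N → ⟨ φ , update s i a ⟩∈ T →
         ∃[ b ] b ∈ M × ⟨ φ , update s i b ⟩∈ T) →
      ∀ c → IsFormula c → ∀ s → s ∈ Asn M → ⟨ c , s ⟩∈ S ⇔ ⟨ c , s ⟩∈ T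
    tarski-vaught {M} {N} {S} {T} M⊆N satS satT tv = formula-induction (Asn M ∷ S ∷ T ∷ [])
        (λ { (𝒜 ∷ S ∷ T ∷ []) c → ∀ᶠ λ s → s ∈ᶠ 𝒜 ⇒ᶠ (⟨ c , s ⟩∈ᶠ S ⇔ᶠ ⟨ c , s ⟩∈ᶠ T) })
        record
          { mem-case = λ i j i∈ j∈ s hs → mk⇔ (λ h → from (N.⊨mem i∈ j∈ (up hs)) (to (M.⊨mem i∈ j∈ hs) h))
                                              (λ h → from (M.⊨mem i∈ j∈ hs) (to (N.⊨mem i∈ j∈ (up hs)) h))
          ; eq-case  = λ i j i∈ j∈ s hs → mk⇔ (λ h → from (N.⊨eq i∈ j∈ (up hs)) (to (M.⊨eq i∈ j∈ hs) h))
                                              (λ h → from (M.⊨eq i∈ j∈ hs) (to (N.⊨eq i∈ j∈ (up hs)) h))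
          ; neg-case = λ φ hφ ih s hs → mk⇔ (λ h → from (N.⊨neg hφ (up hs)) λ h′ → to (M.⊨neg hφ hs) h (from (ih s hs) h′))
                                            (λ h → from (M.⊨neg hφ hs) λ h′ → to (N.⊨neg hφ (up hs)) h (to (ih s hs) h′))
          ; and-case = λ φ ψ hφ hψ ih ih′ s hs → mk⇔
              (λ h → let h₁ , h₂ = to (M.⊨and hφ hψ hs) h in
                     from (N.⊨and hφ hψ (up hs)) (to (ih s hs) h₁ , to (ih′ s hs) h₂))
              (λ h → let h₁ , h₂ = to (N.⊨and hφ hψ (up hs)) h in
                     from (M.⊨and hφ hψ hs) (from (ih s hs) h₁ , from (ih′ s hs) h₂))
          ; ex-case  = λ i φ i∈ hφ ih s hs → mk⇔
              (λ h → let a , a∈ , h′ = to (M.⊨ex i∈ hφ hs) h in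
                     from (N.⊨ex i∈ hφ (up hs)) (a , M⊆N a a∈ , to (ih _ (update-asn hs i∈ a∈)) h′))
              (λ h → let a , a∈ , h′ = to (N.⊨ex i∈ hφ (up hs)) h
                         b , b∈ , h″ = tv i φ s a i∈ hφ hs a∈ h′ in
                     from (M.⊨ex i∈ hφ hs) (b , b∈ , from (ih _ (update-asn hs i∈ b∈)) h″)) }
      where
      module M = Satisfied satS
      module N = Satisfied satT
      up : ∀ {s} → s ∈ Asn M → s ∈ Asn N
      up = asn-mono M⊆N

  -- The Tarski-Vaught test with M = N = A shows that any two satisfaction sets for A agree on
  -- formulas, so the existential quantifier in `_⊨_[_]` may be evaluated at whichever S is at hand.
  ⊨⇔ : ∀ {A S c s} → IsSatisfaction A S → IsFormula c → s ∈ Asn A → A ⊨ c [ s ] ⇔ ⟨ c , s ⟩∈ S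
  ⊨⇔ {A} {S} {c} {s} sat hc hs = mk⇔
    (λ { (S′ , sat′ , h) → to (tarski-vaught (λ _ → id) sat′ sat (λ i φ s a _ _ _ a∈ h → a , a∈ , h) c hc s hs) h })
    (λ h → S , sat , h)

  Agree : V → V → V → Set ℓ
  Agree n s s′ = ∀ k x → k ∈ n → ⟨ k , x ⟩∈ s → ⟨ k , x ⟩∈ s′

  -- Both assignments are total and single-valued, so inclusion below n is already equality below n.
  -- The negation case of `finite-support` swaps the two assignments.
  agree-sym : ∀ {A n s s′} → n ∈ ω → s ∈ Asn A → s′ ∈ Asn A → Agree n s s′ → Agree n s′ s
  agree-sym {s = s} n∈ hs hs′ ag k x k∈ kx with asn-value hs (ω-transitive _ n∈ k k∈)
  ... | y , _ , ky = subst (λ y → ⟨ k , y ⟩∈ s) (asn-single hs′ (ag k y k∈ ky) kx) ky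

  agree-update : ∀ {n s s′ i a} → Agree n s s′ → Agree n (update s i a) (update s′ i a)
  agree-update ag k x k∈ h with update-inv h
  ... | inj₁ (k≢i , kx) = update-old k≢i (ag k x k∈ kx)
  ... | inj₂ (refl , refl) = ⟨⟩∈-adjoin-new

  opaque
    -- Any n above the variables of the atomic parts will do. A quantifier does not raise n, since
    -- updating both assignments at i by the same value preserves agreement below n.
    finite-support : ∀ {A S} → IsSatisfaction A S → ∀ c → IsFormula c →
      ∃[ n ] n ∈ ω × (∀ s s′ → s ∈ Asn A → s′ ∈ Asn A → Agree n s s′ → ⟨ c , s ⟩∈ S → ⟨ c , s′ ⟩∈ S)
    finite-support {A} {S} sat = formula-induction (Asn A ∷ S ∷ ω ∷ [])
        (λ { (𝒜 ∷ S ∷ ω ∷ []) c → ∃ᶠ λ n → n ∈ᶠ ω ∧ᶠ (∀ᶠ λ s → ∀ᶠ λ s′ → s ∈ᶠ 𝒜 ⇒ᶠ s′ ∈ᶠ 𝒜 ⇒ᶠ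
               (∀ᶠ λ k → ∀ᶠ λ x → k ∈ᶠ n ⇒ᶠ ⟨ k , x ⟩∈ᶠ s ⇒ᶠ ⟨ k , x ⟩∈ᶠ s′) ⇒ᶠ ⟨ c , s ⟩∈ᶠ S ⇒ᶠ ⟨ c , s′ ⟩∈ᶠ S) })
        record
          { mem-case = λ i j i∈ j∈ → let n , n∈ , i∈n , j∈n = ω-directed i∈ j∈ in n , n∈ , λ s s′ hs hs′ ag h →
              let x , y , ix , jy , e = to (⊨mem i∈ j∈ hs) h in
              from (⊨mem i∈ j∈ hs′) (x , y , ag i x i∈n ix , ag j y j∈n jy , e)
          ; eq-case = λ i j i∈ j∈ → let n , n∈ , i∈n , j∈n = ω-directed i∈ j∈ in n , n∈ , λ s s′ hs hs′ ag h →
              let x , y , ix , jy , e = to (⊨eq i∈ j∈ hs) h in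
              from (⊨eq i∈ j∈ hs′) (x , y , ag i x i∈n ix , ag j y j∈n jy , e)
          ; neg-case = λ { φ hφ (n , n∈ , ih) → n , n∈ , λ s s′ hs hs′ ag h → from (⊨neg hφ hs′) λ h′ →
              to (⊨neg hφ hs) h (ih s′ s hs′ hs (agree-sym n∈ hs hs′ ag) h′) }
          ; and-case = λ { φ ψ hφ hψ (m , m∈ , ih) (n , n∈ , ih′) → let k , k∈ , m∈k , n∈k = ω-directed m∈ n∈ in
              k , k∈ , λ s s′ hs hs′ ag h → let h₁ , h₂ = to (⊨and hφ hψ hs) h in from (⊨and hφ hψ hs′)
                ( ih s s′ hs hs′ (λ l x l∈ → ag l x (nat-transitive k k∈ m m∈k l l∈)) h₁
                , ih′ s s′ hs hs′ (λ l x l∈ → ag l x (nat-transitive k k∈ n n∈k l l∈)) h₂) }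
          ; ex-case = λ { i φ i∈ hφ (n , n∈ , ih) → n , n∈ , λ s s′ hs hs′ ag h →
              let a , a∈ , h′ = to (⊨ex i∈ hφ hs) h in from (⊨ex i∈ hφ hs′)
                (a , a∈ , ih _ _ (update-asn hs i∈ a∈) (update-asn hs′ i∈ a∈) (agree-update ag) h′) } }
      where open Satisfied sat

  opaque
    -- The assignment s is infinite and need not be in Y, but its part below n arises from ∅ by
    -- adjoining pairs one at a time, so it is.
    restriction : ∀ {Y M s} → AdjoinClosed Y → M ⊆ Y → s ∈ Asn M → ∀ n → n ∈ ω → ∃[ σ ] σ ∈ Y × Agree n s σ × σ ⊆ s
    restriction {Y} {M} {s} cl M⊆Y hs = ω-induction (Y ∷ s ∷ [])
        (λ { (Y ∷ s ∷ []) n → ∃ᶠ λ σ → σ ∈ᶠ Y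
               ∧ᶠ (∀ᶠ λ k → ∀ᶠ λ x → k ∈ᶠ n ⇒ᶠ ⟨ k , x ⟩∈ᶠ s ⇒ᶠ ⟨ k , x ⟩∈ᶠ σ) ∧ᶠ σ ⊆ᶠ s })
        (∅ , has-∅ , (λ k x k∈ → ⊥-elim (∅-empty k k∈)) , λ p p∈ → ⊥-elim (∅-empty p p∈))
        step
      where
      open AdjoinClosed cl
      step : ∀ n → n ∈ ω → (∃[ σ ] σ ∈ Y × Agree n s σ × σ ⊆ s) → ∃[ σ ] σ ∈ Y × Agree (succ n) s σ × σ ⊆ s
      step n n∈ (σ , σ∈ , ag , σ⊆) with asn-value hs n∈
      ... | x , x∈ , nx = adjoin σ ⟪ n , x ⟫ , has-adjoin σ∈ (has-opair (has-ω n n∈) (M⊆Y x x∈)) , ag′ , sub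
        where
        ag′ : Agree (succ n) s (adjoin σ ⟪ n , x ⟫)
        ag′ k y k∈ ky with to ∈-adjoin k∈
        ... | inj₁ k∈n = ⟨⟩-mono ⊆-adjoin (ag k y k∈n ky)
        ... | inj₂ refl with asn-single hs ky nx
        ... | refl = ⟨⟩∈-adjoin-new
        sub : adjoin σ ⟪ n , x ⟫ ⊆ s
        sub p p∈ with to ∈-adjoin p∈
        ... | inj₁ h = σ⊆ p h
        ... | inj₂ refl = ⟨⟩⇒ nx

  -- Countable closures by dependent choice

  infix 4 ⟨_∣_∣_⟩∈_
  infix 6 ⟨_∣_∣_⟩∈ᶠ_

  ⟨_∣_∣_⟩∈_ : V → V → V → V → Set ℓ
  ⟨ x ∣ y ∣ z ⟩∈ R = ∃[ t ] IsTriple t x y z × t ∈ R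

  ⟨_∣_∣_⟩∈ᶠ_ : ∀ {m} → ℕ → ℕ → ℕ → ℕ → Formula (suc m)
  ⟨ x ∣ y ∣ z ⟩∈ᶠ R = ∃ᶠ λ t → (∃ᶠ λ p → IsOPairᶠ p y z ∧ᶠ IsOPairᶠ t x p) ∧ᶠ t ∈ᶠ R

  isTriple : ∀ x y z → IsTriple ⟪ x , ⟪ y , z ⟫ ⟫ x y z
  isTriple x y z = ⟪ y , z ⟫ , isOPair y z , isOPair _ _

  triple-unique : ∀ {t x y z} → IsTriple t x y z → t ≡ ⟪ x , ⟪ y , z ⟫ ⟫
  triple-unique (p , hp , ht) with opair-unique hp
  ... | refl = opair-unique ht

  countable-⊆ : ∀ {A B} → A ⊆ B → Countable B → Countable A
  countable-⊆ {A} {B} A⊆B (w , f , hw , (rel , total , single) , inj) =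
      w , g , hw , ((λ p p∈ → g-rel p p∈) , (λ x x∈ → let y , xy = total x (A⊆B x x∈) in y , g-intro x∈ xy)
                   , λ x y y′ h h′ → single x y y′ (⟨⟩-mono g⊆f h) (⟨⟩-mono g⊆f h′))
        , λ x x′ y h h′ → inj x x′ y (⟨⟩-mono g⊆f h) (⟨⟩-mono g⊆f h′)
    where
    g : V
    g = sep f (A ∷ []) λ { (A ∷ []) p → ∃ᶠ λ x → ∃ᶠ λ y → x ∈ᶠ A ∧ᶠ IsOPairᶠ p x y }
    g⊆f : g ⊆ f
    g⊆f p p∈ = proj₁ (to (∈-sep _ _ _) p∈)
    g-intro : ∀ {x y} → x ∈ A → ⟨ x , y ⟩∈ f → ⟨ x , y ⟩∈ g
    g-intro {x} {y} x∈ h = ⇒⟨⟩ (from (∈-sep _ _ _) (⟨⟩⇒ h , x , y , x∈ , isOPair x y))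
    g-rel : IsRelation g A w
    g-rel p p∈ with to (∈-sep _ _ _) p∈
    ... | p∈f , x , y , x∈ , hp with rel p p∈f
    ... | _ , y′ , _ , y′∈ , hp′ with opair-inj (trans (sym (opair-unique hp)) (opair-unique hp′))
    ... | refl , refl = x , y , x∈ , y′∈ , hp

  -- Dependent choice is applied to injections e of a subset of Y into some m ∈ ω.
  -- Each step handles all pairs from the domain of the current e; running through
  -- them by the values of e makes arithmetic on ω unnecessary.
  module Closure (dc : DC) (Y R Q : V)
    (R-total : ∀ x y → x ∈ Y → y ∈ Y → ∃[ z ] z ∈ Y × ⟨ x ∣ y ∣ z ⟩∈ R)
    (Q-total : ∀ x y → x ∈ Y → y ∈ Y → ∃[ z ] z ∈ Y × ⟨ x ∣ y ∣ z ⟩∈ Q) where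

    -- The enumeration is part of the state: the union of an increasing sequence of such e is an
    -- injection into ω by itself, so no enumerations have to be chosen afterwards. The bound m is
    -- the fresh value for the next element.
    BoundedInjection : V → Set ℓ
    BoundedInjection e = (∃[ m ] m ∈ ω × (∀ x k → ⟨ x , k ⟩∈ e → k ∈ m))
                       × (∀ x k k′ → ⟨ x , k ⟩∈ e → ⟨ x , k′ ⟩∈ e → k ≡ k′)
                       × (∀ x x′ k → ⟨ x , k ⟩∈ e → ⟨ x′ , k ⟩∈ e → x ≡ x′)

    states : V
    states = sep (𝒫 (Y ⊗ ω)) (ω ∷ []) λ { (ω ∷ []) e →
         (∃ᶠ λ m → m ∈ᶠ ω ∧ᶠ (∀ᶠ λ x → ∀ᶠ λ k → ⟨ x , k ⟩∈ᶠ e ⇒ᶠ k ∈ᶠ m))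
      ∧ᶠ (∀ᶠ λ x → ∀ᶠ λ k → ∀ᶠ λ k′ → ⟨ x , k ⟩∈ᶠ e ⇒ᶠ ⟨ x , k′ ⟩∈ᶠ e ⇒ᶠ k ≡ᶠ k′)
      ∧ᶠ (∀ᶠ λ x → ∀ᶠ λ x′ → ∀ᶠ λ k → ⟨ x , k ⟩∈ᶠ e ⇒ᶠ ⟨ x′ , k ⟩∈ᶠ e ⇒ᶠ x ≡ᶠ x′) }

    state-⊆ : ∀ {e} → e ∈ states → e ⊆ (Y ⊗ ω)
    state-⊆ h = to ∈-𝒫 (proj₁ (to (∈-sep _ _ _) h))

    state-inj : ∀ {e} → e ∈ states → BoundedInjection e
    state-inj h = proj₂ (to (∈-sep _ _ _) h)

    state-dom : ∀ {e x k} → e ∈ states → ⟨ x , k ⟩∈ e → x ∈ Y × k ∈ ω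
    state-dom h xk = ⟨⟩∈-⊗ (⟨⟩-mono (state-⊆ h) xk)

    ∅-state : ∅ ∈ states
    ∅-state = from (∈-sep _ _ _) (from ∈-𝒫 (λ p p∈ → ⊥-elim (∅-empty p p∈)) ,
      (∅ , ∅∈ω , λ x k h → none h) , (λ x k k′ h → none h) , λ x x′ k h → none h)
      where
      none : ∀ {x k} {A : Set ℓ} → ⟨ x , k ⟩∈ ∅ → A
      none h = ⊥-elim (∅-empty _ (⟨⟩⇒ h))

    opaque
      insert : ∀ {e x} → e ∈ states → x ∈ Y → ∃[ e′ ] e′ ∈ states × e ⊆ e′ × (∃[ k ] ⟨ x , k ⟩∈ e′)
      insert {e} {x} he x∈ with em {∃[ k ] ⟨ x , k ⟩∈ e} | state-inj he
      ... | yes h | _ = e , he , (λ _ → id) , h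
      ... | no new | (m , m∈ , bound) , fun , inj =
        adjoin e ⟪ x , m ⟫ , from (∈-sep _ _ _) (from ∈-𝒫 sub , (succ m , succ∈ω m∈ , bound′) , fun′ , inj′)
        , ⊆-adjoin , m , ⟨⟩∈-adjoin-new
        where
        sub : adjoin e ⟪ x , m ⟫ ⊆ (Y ⊗ ω)
        sub p p∈ with to ∈-adjoin p∈
        ... | inj₁ h = state-⊆ he p h
        ... | inj₂ refl = ∈-⊗-intro x∈ m∈
        bound′ : ∀ y k → ⟨ y , k ⟩∈ adjoin e ⟪ x , m ⟫ → k ∈ succ m
        bound′ y k h with ⟨⟩∈-adjoin h
        ... | inj₁ h′ = ⊆-adjoin k (bound y k h′)
        ... | inj₂ (_ , refl) = n∈succ
        fun′ : ∀ y k k′ → ⟨ y , k ⟩∈ adjoin e ⟪ x , m ⟫ → ⟨ y , k′ ⟩∈ adjoin e ⟪ x , m ⟫ → k ≡ k′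
        fun′ y k k′ h h′ with ⟨⟩∈-adjoin h | ⟨⟩∈-adjoin h′
        ... | inj₁ a | inj₁ b = fun y k k′ a b
        ... | inj₁ a | inj₂ (refl , _) = ⊥-elim (new (k , a))
        ... | inj₂ (refl , _) | inj₁ b = ⊥-elim (new (k′ , b))
        ... | inj₂ (_ , refl) | inj₂ (_ , refl) = refl
        inj′ : ∀ y y′ k → ⟨ y , k ⟩∈ adjoin e ⟪ x , m ⟫ → ⟨ y′ , k ⟩∈ adjoin e ⟪ x , m ⟫ → y ≡ y′
        inj′ y y′ k h h′ with ⟨⟩∈-adjoin h | ⟨⟩∈-adjoin h′
        ... | inj₁ a | inj₁ b = inj y y′ k a b
        ... | inj₁ a | inj₂ (_ , refl) = ⊥-elim (¬x∈x (bound y k a))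
        ... | inj₂ (_ , refl) | inj₁ b = ⊥-elim (¬x∈x (bound y′ k b))
        ... | inj₂ (refl , _) | inj₂ (refl , _) = refl

    Has : V → V → V → V → Set ℓ
    Has T e x y = ∃[ z ] ∃[ k ] ⟨ z , k ⟩∈ e × ⟨ x ∣ y ∣ z ⟩∈ T

    Handled : V → V → V → Set ℓ
    Handled e x y = Has R e x y × Has Q e x y

    Handledᶠ : ∀ {m} → ℕ → ℕ → ℕ → ℕ → ℕ → Formula (suc m)
    Handledᶠ R Q e x y = (∃ᶠ λ z → ∃ᶠ λ k → ⟨ z , k ⟩∈ᶠ e ∧ᶠ ⟨ x ∣ y ∣ z ⟩∈ᶠ R)
                      ∧ᶠ (∃ᶠ λ z → ∃ᶠ λ k → ⟨ z , k ⟩∈ᶠ e ∧ᶠ ⟨ x ∣ y ∣ z ⟩∈ᶠ Q)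

    handled-mono : ∀ {e e′ x y} → e ⊆ e′ → Handled e x y → Handled e′ x y
    handled-mono sub ((z , k , h , r) , (z′ , k′ , h′ , q)) =
      (z , k , ⟨⟩-mono sub h , r) , (z′ , k′ , ⟨⟩-mono sub h′ , q)

    opaque
      handle : ∀ {e x y} → e ∈ states → x ∈ Y → y ∈ Y → ∃[ e′ ] e′ ∈ states × e ⊆ e′ × Handled e′ x y
      handle {e} {x} {y} he x∈ y∈ =
        let z , z∈ , r = R-total x y x∈ y∈
            z′ , z′∈ , q = Q-total x y x∈ y∈
            e₁ , he₁ , sub₁ , k , h = insert he z∈
            e₂ , he₂ , sub₂ , k′ , h′ = insert he₁ z′∈
        in e₂ , he₂ , (λ p p∈ → sub₂ p (sub₁ p p∈)) , (z , k , ⟨⟩-mono sub₂ h , r) , (z′ , k′ , h′ , q)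

    opaque
      -- The y to be treated come from the fixed e and not from the growing e′, so the induction
      -- over the values of e ends at the bound of e.
      handle-row : ∀ {e e₁ x} → e ∈ states → e₁ ∈ states → x ∈ Y → ∀ l → l ∈ ω →
        ∃[ e′ ] e′ ∈ states × e₁ ⊆ e′ × (∀ y j → ⟨ y , j ⟩∈ e → j ∈ l → Handled e′ x y)
      handle-row {e} {e₁} {x} he he₁ x∈ = ω-induction (states ∷ e ∷ e₁ ∷ x ∷ R ∷ Q ∷ [])
          (λ { (states ∷ e ∷ e₁ ∷ x ∷ R ∷ Q ∷ []) l → ∃ᶠ λ e′ → e′ ∈ᶠ states ∧ᶠ e₁ ⊆ᶠ e′
                 ∧ᶠ (∀ᶠ λ y → ∀ᶠ λ j → ⟨ y , j ⟩∈ᶠ e ⇒ᶠ j ∈ᶠ l ⇒ᶠ Handledᶠ R Q e′ x y) })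
          (e₁ , he₁ , (λ _ → id) , λ y j _ j∈ → ⊥-elim (∅-empty j j∈))
          step
        where
        step : ∀ l → l ∈ ω → (∃[ e′ ] e′ ∈ states × e₁ ⊆ e′ × (∀ y j → ⟨ y , j ⟩∈ e → j ∈ l → Handled e′ x y)) →
               ∃[ e′ ] e′ ∈ states × e₁ ⊆ e′ × (∀ y j → ⟨ y , j ⟩∈ e → j ∈ succ l → Handled e′ x y)
        step l l∈ (e′ , he′ , sub , ih) with em {∃[ y ] ⟨ y , l ⟩∈ e}
        ... | no none = e′ , he′ , sub , λ y j h j∈ → [ ih y j h , (λ { refl → ⊥-elim (none (y , h)) }) ]′ (to ∈-adjoin j∈)
        ... | yes (y , yl) with handle he′ x∈ (proj₁ (state-dom he yl))
        ... | e″ , he″ , sub′ , done = e″ , he″ , (λ p p∈ → sub′ p (sub p p∈)) , all-done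
          where
          all-done : ∀ y′ j → ⟨ y′ , j ⟩∈ e → j ∈ succ l → Handled e″ x y′
          all-done y′ j h j∈ with to ∈-adjoin j∈
          ... | inj₁ j∈l = handled-mono sub′ (ih y′ j h j∈l)
          ... | inj₂ refl with proj₂ (proj₂ (state-inj he)) y y′ j yl h
          ... | refl = done

    opaque
      handle-rows : ∀ {e} → e ∈ states → ∀ l → l ∈ ω → ∃[ e′ ] e′ ∈ states × e ⊆ e′ ×
        (∀ x i → ⟨ x , i ⟩∈ e → i ∈ l → ∀ y j → ⟨ y , j ⟩∈ e → Handled e′ x y)
      handle-rows {e} he = ω-induction (states ∷ e ∷ R ∷ Q ∷ [])
          (λ { (states ∷ e ∷ R ∷ Q ∷ []) l → ∃ᶠ λ e′ → e′ ∈ᶠ states ∧ᶠ e ⊆ᶠ e′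
                 ∧ᶠ (∀ᶠ λ x → ∀ᶠ λ i → ⟨ x , i ⟩∈ᶠ e ⇒ᶠ i ∈ᶠ l ⇒ᶠ
                      (∀ᶠ λ y → ∀ᶠ λ j → ⟨ y , j ⟩∈ᶠ e ⇒ᶠ Handledᶠ R Q e′ x y)) })
          (e , he , (λ _ → id) , λ x i _ i∈ → ⊥-elim (∅-empty i i∈))
          step
        where
        step : ∀ l → l ∈ ω →
          (∃[ e′ ] e′ ∈ states × e ⊆ e′ × (∀ x i → ⟨ x , i ⟩∈ e → i ∈ l → ∀ y j → ⟨ y , j ⟩∈ e → Handled e′ x y)) →
          ∃[ e′ ] e′ ∈ states × e ⊆ e′ × (∀ x i → ⟨ x , i ⟩∈ e → i ∈ succ l → ∀ y j → ⟨ y , j ⟩∈ e → Handled e′ x y)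
        step l l∈ (e′ , he′ , sub , ih) with em {∃[ x ] ⟨ x , l ⟩∈ e}
        ... | no none = e′ , he′ , sub , λ x i h i∈ → [ ih x i h , (λ { refl → ⊥-elim (none (x , h)) }) ]′ (to ∈-adjoin i∈)
        ... | yes (x , xl) with proj₁ (state-inj he)
        ... | m , m∈ , bound with handle-row he he′ (proj₁ (state-dom he xl)) m m∈
        ... | e″ , he″ , sub′ , done = e″ , he″ , (λ p p∈ → sub′ p (sub p p∈)) , all-done
          where
          all-done : ∀ x′ i → ⟨ x′ , i ⟩∈ e → i ∈ succ l → ∀ y j → ⟨ y , j ⟩∈ e → Handled e″ x′ y
          all-done x′ i h i∈ y j yj with to ∈-adjoin i∈
          ... | inj₁ i∈l = handled-mono sub′ (ih x′ i h i∈l y j yj)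
          ... | inj₂ refl with proj₂ (proj₂ (state-inj he)) x x′ i xl h
          ... | refl = done y j yj (bound y j yj)

    Next : V → V → Set ℓ
    Next e e′ = e ⊆ e′ × (∀ x i y j → ⟨ x , i ⟩∈ e → ⟨ y , j ⟩∈ e → Handled e′ x y)

    opaque
      next : ∀ {e} → e ∈ states → ∃[ e′ ] e′ ∈ states × Next e e′
      next {e} he =
        let m , m∈ , bound = proj₁ (state-inj he)
            e′ , he′ , sub , done = handle-rows he m m∈
        in e′ , he′ , sub , λ x i y j xi yj → done x i xi (bound x i xi) y j yj

    Closed : V → Set ℓ
    Closed N = ∀ x y → x ∈ N → y ∈ N → (∃[ z ] z ∈ N × ⟨ x ∣ y ∣ z ⟩∈ R) × (∃[ z ] z ∈ N × ⟨ x ∣ y ∣ z ⟩∈ Q)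

    module _ {e₀ : V} (he₀ : e₀ ∈ states) where

      -- `DC` does not prescribe the first term of the sequence. It is therefore applied to the
      -- extensions of e₀ only, which places e₀ below every term.
      extensions steps : V
      extensions = sep states (e₀ ∷ []) λ { (e₀ ∷ []) e → e₀ ⊆ᶠ e }
      steps = sep (extensions ⊗ extensions) (R ∷ Q ∷ []) λ { (R ∷ Q ∷ []) p → ∃ᶠ λ e → ∃ᶠ λ e′ → IsOPairᶠ p e e′
                ∧ᶠ e ⊆ᶠ e′ ∧ᶠ (∀ᶠ λ x → ∀ᶠ λ i → ∀ᶠ λ y → ∀ᶠ λ j →
                     ⟨ x , i ⟩∈ᶠ e ⇒ᶠ ⟨ y , j ⟩∈ᶠ e ⇒ᶠ Handledᶠ R Q e′ x y) }

      steps⇒Next : ∀ {e e′} → ⟨ e , e′ ⟩∈ steps → Next e e′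
      steps⇒Next h with proj₂ (to (∈-sep _ _ _) (⟨⟩⇒ h))
      ... | _ , _ , hp , nx with opair-inj (opair-unique hp)
      ... | refl , refl = nx

      opaque
        chain : ∃[ w ] ∃[ F ] IsOmega w × IsFunction F w extensions ×
          (∀ n s e e′ → n ∈ w → IsSuc s n → ⟨ n , e ⟩∈ F → ⟨ s , e′ ⟩∈ F → ⟨ e , e′ ⟩∈ steps)
        chain = dc extensions steps (e₀ , from (∈-sep _ _ _) (he₀ , λ _ → id)) λ e e∈ →
          let he , e₀⊆ = to (∈-sep _ _ _) e∈
              e′ , he′ , nx = next he
              e′∈ = from (∈-sep _ _ _) (he′ , λ p p∈ → proj₁ nx p (e₀⊆ p p∈))
          in e′ , e′∈ , ⇒⟨⟩ (from (∈-sep _ _ _) (∈-⊗-intro e∈ e′∈ , e , e′ , isOPair e e′ , nx))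

      module Limit {F : V} (F-fun : IsFunction F ω extensions)
        (F-step : ∀ n e e′ → n ∈ ω → ⟨ n , e ⟩∈ F → ⟨ succ n , e′ ⟩∈ F → Next e e′) where

        value : ∀ n → n ∈ ω → ∃[ e ] ⟨ n , e ⟩∈ F
        value = proj₁ (proj₂ F-fun)

        value-state : ∀ {n e} → ⟨ n , e ⟩∈ F → e ∈ states
        value-state h = proj₁ (to (∈-sep _ _ _) (function-cod F-fun h))

        value-e₀ : ∀ {n e} → ⟨ n , e ⟩∈ F → e₀ ⊆ e
        value-e₀ h = proj₂ (to (∈-sep _ _ _) (function-cod F-fun h))

        increasing : ∀ m → m ∈ ω → ∀ n e e′ → n ∈ m → ⟨ n , e ⟩∈ F → ⟨ m , e′ ⟩∈ F → e ⊆ e′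
        increasing = ω-induction (F ∷ []) (λ { (F ∷ []) m → ∀ᶠ λ n → ∀ᶠ λ e → ∀ᶠ λ e′ →
                        n ∈ᶠ m ⇒ᶠ ⟨ n , e ⟩∈ᶠ F ⇒ᶠ ⟨ m , e′ ⟩∈ᶠ F ⇒ᶠ e ⊆ᶠ e′ })
          (λ n e e′ n∈ → ⊥-elim (∅-empty n n∈))
          λ m m∈ ih n e e″ n∈ ne me″ → let e′ , me′ = value m m∈ in λ p p∈ → proj₁ (F-step m e′ e″ m∈ me′ me″) p
            ([ (λ n∈m → ih n e e′ n∈m ne me′ p p∈)
             , (λ { refl → subst (p ∈_) (proj₂ (proj₂ F-fun) n e e′ ne me′) p∈ }) ]′ (to ∈-adjoin n∈))

        common : ∀ {m n e e′} → ⟨ m , e ⟩∈ F → ⟨ n , e′ ⟩∈ F → ∃[ k ] ∃[ e″ ] k ∈ ω × ⟨ k , e″ ⟩∈ F × e ⊆ e″ × e′ ⊆ e″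
        common {m} {n} {e} {e′} me ne′ =
          let k , k∈ , m∈k , n∈k = ω-directed (function-dom F-fun me) (function-dom F-fun ne′)
              e″ , ke″ = value k k∈
          in k , e″ , k∈ , ke″ , increasing k k∈ m e e″ m∈k me ke″ , increasing k k∈ n e′ e″ n∈k ne′ ke″

        N f : V
        N = sep Y (F ∷ []) λ { (F ∷ []) x → ∃ᶠ λ n → ∃ᶠ λ e → ∃ᶠ λ k → ⟨ n , e ⟩∈ᶠ F ∧ᶠ ⟨ x , k ⟩∈ᶠ e }
        f = sep (Y ⊗ ω) (F ∷ []) λ { (F ∷ []) p → ∃ᶠ λ n → ∃ᶠ λ e → ⟨ n , e ⟩∈ᶠ F ∧ᶠ p ∈ᶠ e }

        ∈N : ∀ {n e x k} → ⟨ n , e ⟩∈ F → ⟨ x , k ⟩∈ e → x ∈ N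
        ∈N {n} {e} {x} {k} ne xk = from (∈-sep _ _ _) (proj₁ (state-dom (value-state ne) xk) , n , e , k , ne , xk)

        ∈f : ∀ {n e x k} → ⟨ n , e ⟩∈ F → ⟨ x , k ⟩∈ e → ⟨ x , k ⟩∈ f
        ∈f {n} {e} ne xk = ⇒⟨⟩ (from (∈-sep _ _ _) (state-⊆ (value-state ne) _ (⟨⟩⇒ xk) , n , e , ne , ⟨⟩⇒ xk))

        f⇒ : ∀ {x k} → ⟨ x , k ⟩∈ f → ∃[ n ] ∃[ e ] ⟨ n , e ⟩∈ F × ⟨ x , k ⟩∈ e
        f⇒ h = let n , e , ne , p∈ = proj₂ (to (∈-sep _ _ _) (⟨⟩⇒ h)) in n , e , ne , ⇒⟨⟩ p∈

        N-countable : Countable N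
        N-countable = ω , f , isOmega , (rel , total , single) , inj
          where
          rel : IsRelation f N ω
          rel p p∈ with ∈-⊗ (proj₁ (to (∈-sep _ _ _) p∈))
          ... | x , k , _ , k∈ , hp with opair-unique hp
          ... | refl = let n , e , ne , xk = f⇒ (⇒⟨⟩ p∈) in x , k , ∈N ne xk , k∈ , hp
          total : ∀ x → x ∈ N → ∃[ k ] ⟨ x , k ⟩∈ f
          total x x∈ = let n , e , k , ne , xk = proj₂ (to (∈-sep _ _ _) x∈) in k , ∈f ne xk
          single : ∀ x k k′ → ⟨ x , k ⟩∈ f → ⟨ x , k′ ⟩∈ f → k ≡ k′
          single x k k′ h h′ =
            let n , e , ne , xk = f⇒ h
                n′ , e′ , ne′ , xk′ = f⇒ h′
                _ , e″ , _ , ke″ , e⊆ , e′⊆ = common ne ne′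
            in proj₁ (proj₂ (state-inj (value-state ke″))) x k k′ (⟨⟩-mono e⊆ xk) (⟨⟩-mono e′⊆ xk′)
          inj : ∀ x x′ k → ⟨ x , k ⟩∈ f → ⟨ x′ , k ⟩∈ f → x ≡ x′
          inj x x′ k h h′ =
            let n , e , ne , xk = f⇒ h
                n′ , e′ , ne′ , xk′ = f⇒ h′
                _ , e″ , _ , ke″ , e⊆ , e′⊆ = common ne ne′
            in proj₂ (proj₂ (state-inj (value-state ke″))) x x′ k (⟨⟩-mono e⊆ xk) (⟨⟩-mono e′⊆ xk′)

        N-closed : Closed N
        N-closed x y x∈ y∈ =
          let m , e , i , me , xi = proj₂ (to (∈-sep _ _ _) x∈)
              n , e′ , j , ne′ , yj = proj₂ (to (∈-sep _ _ _) y∈)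
              -- Both x and y are in the domain of the state at k, so the state at `succ k` contains
              -- the elements that R and Q require for this pair.
              k , e″ , k∈ , ke″ , e⊆ , e′⊆ = common me ne′
              e‴ , ke‴ = value (succ k) (succ∈ω k∈)
              (z , _ , zk , r) , (z′ , _ , zk′ , q) =
                proj₂ (F-step k e″ e‴ k∈ ke″ ke‴) x i y j (⟨⟩-mono e⊆ xi) (⟨⟩-mono e′⊆ yj)
          in (z , ∈N ke‴ zk , r) , (z′ , ∈N ke‴ zk′ , q)

        N-start : ∀ {x k} → ⟨ x , k ⟩∈ e₀ → x ∈ N
        N-start h = let e , 0e = value ∅ ∅∈ω in ∈N 0e (⟨⟩-mono (value-e₀ 0e) h)

      opaque
        limit : ∃[ N ] N ⊆ Y × Countable N × Closed N × (∀ x k → ⟨ x , k ⟩∈ e₀ → x ∈ N)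
        limit with chain
        ... | w , F , hw , F-fun , F-step with omega-unique hw
        ... | refl = N , (λ x x∈ → proj₁ (to (∈-sep _ _ _) x∈)) , N-countable , N-closed , λ x k → N-start
          where
          nexts : ∀ n e e′ → n ∈ ω → ⟨ n , e ⟩∈ F → ⟨ succ n , e′ ⟩∈ F → Next e e′
          nexts n e e′ n∈ ne se′ = steps⇒Next (F-step n (succ n) e e′ n∈ (isSuc n) ne se′)
          open Limit F-fun nexts

    opaque
      countable-closure : ∀ {a b c} → a ∈ Y → b ∈ Y → c ∈ Y →
        ∃[ N ] N ⊆ Y × Countable N × Closed N × a ∈ N × b ∈ N × c ∈ N
      countable-closure {a} {b} {c} a∈ b∈ c∈ =
        let e₁ , he₁ , _ , _ , h₁ = insert ∅-state a∈
            e₂ , he₂ , sub₂ , _ , h₂ = insert he₁ b∈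
            e₃ , he₃ , sub₃ , _ , h₃ = insert he₂ c∈
            N , N⊆ , cN , cl , start = limit he₃
        in N , N⊆ , cN , cl , start a _ (⟨⟩-mono sub₃ (⟨⟩-mono sub₂ h₁)) , start b _ (⟨⟩-mono sub₃ h₂) , start c _ h₃

  -- Skolem hulls and the downward Löwenheim-Skolem theorem

  -- By finite support, a Skolem witness may be chosen for a formula and a finite part
  -- of an assignment.  Both are in Y, which is closed under x , y ↦ x ∪ {y}.
  module Skolemize {H : V} (tr : Transitive H) where

    S : V
    S = proj₁ (satisfaction H)

    sat : IsSatisfaction H S
    sat = proj₂ (satisfaction H)

    Y : V
    Y = 𝕌 H ω

    Y-closed : AdjoinClosed Y
    Y-closed = 𝕌ω-closed tr

    H⊆Y : H ⊆ Y
    H⊆Y x x∈ = from ∈-𝕌 (inj₁ x∈)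

    -- The value x has to work for all assignments that extend σ. So the relation mentions no single
    -- assignment, and one value serves all of them.
    Witness : V → V → V → Set ℓ
    Witness c σ x = ∃[ i ] ∃[ φ ] IsExCode c i φ ×
      (∀ s s′ → s ∈ Asn H → σ ⊆ s → Update (Asn H) s′ s i x → ⟨ φ , s′ ⟩∈ S)

    Witnessᶠ : ∀ {m} → ℕ → ℕ → ℕ → ℕ → ℕ → Formula (suc m)
    Witnessᶠ 𝒜 S c σ x = ∃ᶠ λ i → ∃ᶠ λ φ → IsTaggedᶠ 4 c i φ
      ∧ᶠ (∀ᶠ λ s → ∀ᶠ λ s′ → s ∈ᶠ 𝒜 ⇒ᶠ σ ⊆ᶠ s ⇒ᶠ Updateᶠ 𝒜 s′ s i x ⇒ᶠ ⟨ φ , s′ ⟩∈ᶠ S)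

    Skolem : V → V → V → Set ℓ
    Skolem c σ z = (∃[ x ] x ∈ H × Witness c σ x) → z ∈ H × Witness c σ z

    opaque
      R Q : V
      R = sep (Y ⊗ Y ⊗ Y) [] λ { [] t → ∃ᶠ λ x → ∃ᶠ λ y → ∃ᶠ λ z →
            (∃ᶠ λ p → IsOPairᶠ p y z ∧ᶠ IsOPairᶠ t x p) ∧ᶠ (∀ᶠ λ w → w ∈ᶠ z ⇔ᶠ (w ∈ᶠ x ∨ᶠ w ≡ᶠ y)) }
      Q = sep (Y ⊗ Y ⊗ Y) (H ∷ Asn H ∷ S ∷ []) λ { (H ∷ 𝒜 ∷ S ∷ []) t → ∃ᶠ λ c → ∃ᶠ λ σ → ∃ᶠ λ z →
            (∃ᶠ λ p → IsOPairᶠ p σ z ∧ᶠ IsOPairᶠ t c p)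
            ∧ᶠ ((∃ᶠ λ x → x ∈ᶠ H ∧ᶠ Witnessᶠ 𝒜 S c σ x) ⇒ᶠ (z ∈ᶠ H ∧ᶠ Witnessᶠ 𝒜 S c σ z)) }

      R-total : ∀ x y → x ∈ Y → y ∈ Y → ∃[ z ] z ∈ Y × ⟨ x ∣ y ∣ z ⟩∈ R
      R-total x y x∈ y∈ = adjoin x y , z∈ , _ , isTriple _ _ _ , from (∈-sep _ _ _)
          (∈-⊗-intro x∈ (∈-⊗-intro y∈ z∈) , x , y , adjoin x y , isTriple _ _ _ , λ w → ∈-adjoin)
        where
        z∈ : adjoin x y ∈ Y
        z∈ = AdjoinClosed.has-adjoin Y-closed x∈ y∈

      R-elim : ∀ {x y z} → ⟨ x ∣ y ∣ z ⟩∈ R → z ≡ adjoin x y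
      R-elim (t , ht , t∈) with proj₂ (to (∈-sep _ _ _) t∈)
      ... | _ , _ , _ , ht′ , h with opair-inj (trans (sym (triple-unique ht)) (triple-unique ht′))
      ... | refl , e with opair-inj e
      ... | refl , refl = ext (λ w w∈ → from ∈-adjoin (to (h w) w∈)) (λ w w∈ → from (h w) (to ∈-adjoin w∈))

      Q-intro : ∀ {c σ z} → c ∈ Y → σ ∈ Y → z ∈ Y → Skolem c σ z → ⟨ c ∣ σ ∣ z ⟩∈ Q
      Q-intro {c} {σ} {z} c∈ σ∈ z∈ h = _ , isTriple _ _ _ , from (∈-sep _ _ _)
        (∈-⊗-intro c∈ (∈-⊗-intro σ∈ z∈) , c , σ , z , isTriple _ _ _ , h)

      Q-elim : ∀ {c σ z} → ⟨ c ∣ σ ∣ z ⟩∈ Q → Skolem c σ z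
      Q-elim (t , ht , t∈) with proj₂ (to (∈-sep _ _ _) t∈)
      ... | _ , _ , _ , ht′ , h with opair-inj (trans (sym (triple-unique ht)) (triple-unique ht′))
      ... | refl , e with opair-inj e
      ... | refl , refl = h

    Q-total : ∀ c σ → c ∈ Y → σ ∈ Y → ∃[ z ] z ∈ Y × ⟨ c ∣ σ ∣ z ⟩∈ Q
    Q-total c σ c∈ σ∈ = choose em
      where
      choose : Dec (∃[ x ] x ∈ H × Witness c σ x) → ∃[ z ] z ∈ Y × ⟨ c ∣ σ ∣ z ⟩∈ Q
      choose (yes (x , x∈ , h)) = x , H⊆Y x x∈ , Q-intro c∈ σ∈ (H⊆Y x x∈) λ _ → x∈ , h
      -- Without a witness the implication `Skolem` holds vacuously, and c is an arbitrary element
      -- of `Y` taken as value.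
      choose (no none) = c , c∈ , Q-intro c∈ σ∈ c∈ λ h → ⊥-elim (none h)

    module Hull (N : V) (N-adjoin : AdjoinClosed N)
                (N-skolem : ∀ c σ → c ∈ N → σ ∈ N → ∃[ z ] z ∈ N × Skolem c σ z) where

      -- N also holds formula codes and finite parts of assignments, which may lie outside `H`. The
      -- submodel is the part of N inside `H`.
      M : V
      M = sep N (H ∷ []) λ { (H ∷ []) x → x ∈ᶠ H }

      M⊆N : M ⊆ N
      M⊆N x x∈ = proj₁ (to (∈-sep _ _ _) x∈)

      M⊆H : M ⊆ H
      M⊆H x x∈ = proj₂ (to (∈-sep _ _ _) x∈)

      witness-value : ∀ {i φ σ s z} → i ∈ ω → s ∈ Asn H → σ ⊆ s → z ∈ H → Witness (exᶜ i φ) σ z → ⟨ φ , update s i z ⟩∈ S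
      witness-value {i} {φ} {σ} {s} {z} i∈ hs σ⊆s z∈ (i′ , φ′ , hc , good) =
        let e , e′ = opair-inj (proj₂ (opair-inj (tagged-unique 4 hc)))
        in subst (λ φ → ⟨ φ , update s i z ⟩∈ S) (sym e′)
             (good s (update s i z) hs σ⊆s
               (subst (λ i′ → Update (Asn H) (update s i z) s i′ z) e (update-Update hs i∈ z∈)))

      -- An extension s₁ of σ agrees with s below n. After both are updated at i by x they still
      -- agree there, and the support hypothesis carries the truth of φ from one to the other.
      support-witness : ∀ {i φ s σ x n} → i ∈ ω → s ∈ Asn H → x ∈ H → ⟨ φ , update s i x ⟩∈ S → Agree n s σ →
        (∀ s s′ → s ∈ Asn H → s′ ∈ Asn H → Agree n s s′ → ⟨ φ , s ⟩∈ S → ⟨ φ , s′ ⟩∈ S) → Witness (exᶜ i φ) σ x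
      support-witness {i} {φ} {s} i∈ hs x∈ h ag supp = i , φ , isTagged 4 i φ , λ s₁ s₂ hs₁ σ⊆s₁ up →
        subst (λ s₂ → ⟨ φ , s₂ ⟩∈ S) (sym (Update-unique hs₁ up))
          (supp _ _ (update-asn hs i∈ x∈) (update-asn hs₁ i∈ x∈)
            (agree-update λ k y k∈ ky → ⟨⟩-mono σ⊆s₁ (ag k y k∈ ky)) h)

      reflect : ∀ i φ s x → i ∈ ω → IsFormula φ → s ∈ Asn M → x ∈ H → ⟨ φ , update s i x ⟩∈ S →
                ∃[ z ] z ∈ M × ⟨ φ , update s i z ⟩∈ S
      reflect i φ s x i∈ hφ hs x∈ h =
        let hsH = asn-mono M⊆H hs
            n , n∈ , supp = finite-support sat φ hφ
            σ , σ∈ , ag , σ⊆s = restriction N-adjoin M⊆N hs n n∈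
            z , z∈ , sk = N-skolem (exᶜ i φ) σ (ex-formula i∈ hφ N (adjoinClosed⇒formulaClosed N-adjoin)) σ∈
            z∈H , wit = sk (x , x∈ , support-witness i∈ hsH x∈ h ag supp)
        in z , from (∈-sep _ _ _) (z∈ , z∈H) , witness-value i∈ hsH σ⊆s z∈H wit

      M≺H : M ≺ H
      M≺H = M⊆H , λ φ s hφ hs →
        let satM = proj₂ (satisfaction M)
            e₁ = ⊨⇔ satM hφ (⇒asn hs)
            e₂ = ⊨⇔ sat hφ (asn-mono M⊆H (⇒asn hs))
            e = tarski-vaught M⊆H satM sat reflect φ hφ s (⇒asn hs)
        in mk⇔ (λ h → from e₂ (to e (to e₁ h))) (λ h → from e₁ (from e (to e₂ h)))

  opaque
    löwenheim-skolem : DC → ∀ {H a b} → Transitive H → a ∈ H → b ∈ H →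
                       ∃[ M ] Countable M × M ≺ H × a ∈ M × b ∈ M
    löwenheim-skolem dc {H} {a} {b} tr a∈ b∈ = from-closure
        -- The third starting element is ∅, which `AdjoinClosed` demands and adjunction alone does
        -- not supply.
        (countable-closure (H⊆Y a a∈) (H⊆Y b b∈) (AdjoinClosed.has-∅ Y-closed))
      where
      open Skolemize tr
      open Closure dc Y R Q R-total Q-total
      from-closure : (∃[ N ] N ⊆ Y × Countable N × Closed N × a ∈ N × b ∈ N × ∅ ∈ N) →
                     ∃[ M ] Countable M × M ≺ H × a ∈ M × b ∈ M
      from-closure (N , N⊆ , cN , cl , a∈N , b∈N , ∅∈N) =
          M , countable-⊆ M⊆N cN , M≺H , from (∈-sep _ _ _) (a∈N , a∈) , from (∈-sep _ _ _) (b∈N , b∈)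
        where
        N-adjoin : AdjoinClosed N
        N-adjoin = record { has-∅ = ∅∈N ; has-adjoin = λ x∈ y∈ →
          let z , z∈ , r = proj₁ (cl _ _ x∈ y∈) in subst (_∈ N) (R-elim r) z∈ }
        N-skolem : ∀ c σ → c ∈ N → σ ∈ N → ∃[ z ] z ∈ N × Skolem c σ z
        N-skolem c σ c∈ σ∈ = let z , z∈ , q = proj₂ (cl c σ c∈ σ∈) in z , z∈ , Q-elim q
        open Hull N N-adjoin N-skolem

  -- Translation of formulas into codes

  -- The membership proof is irrelevant so that elements with equal values are equal.
  record Elt (A : V) : Set ℓ where
    constructor elt
    field
      val      : V
      .bounded : val ∈ A

  open Elt public using (val)

  -- Excluded middle decides membership, which allows the irrelevant proof to be recovered.
  val∈ : ∀ {A} (x : Elt A) → val x ∈ A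
  val∈ (elt v v∈) = recompute em v∈

  val-inj : ∀ {A} {x y : Elt A} → val x ≡ val y → x ≡ y
  val-inj refl = refl

  infix 4 _∈ₑ_

  _∈ₑ_ : ∀ {A} → Elt A → Elt A → Set ℓ
  x ∈ₑ y = val x ∈ val y

  -- `SetTheory` is instantiated at the structure on A, so a formula evaluated here unfolds to the
  -- relativization to A of the notion it expresses.
  ⟦_⟧ₑ : ∀ {A n} → Formula n → Vec (Elt A) n → Set ℓ
  ⟦_⟧ₑ = SetTheory.⟦_⟧ _∈ₑ_

  -- The quantifiers of a formula with n free variables bind vₙ.
  level : ∀ {n} → Fin n → ℕ
  level {suc n} zero    = n
  level {suc n} (suc i) = level i

  level< : ∀ {n} (i : Fin n) → level i < n
  level< {suc n} zero    = n<1+n n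
  level< {suc n} (suc i) = m<n⇒m<1+n (level< i)

  impᶜ : V → V → V
  impᶜ φ ψ = negᶜ (andᶜ φ (negᶜ ψ))

  ⌜_⌝ : ∀ {n} → Formula n → V
  ⌜ mem i j ⌝ = memᶜ (num (level i)) (num (level j))
  ⌜ eq i j ⌝  = eqᶜ (num (level i)) (num (level j))
  ⌜ neg φ ⌝   = negᶜ ⌜ φ ⌝
  ⌜ and φ ψ ⌝ = andᶜ ⌜ φ ⌝ ⌜ ψ ⌝
  ⌜ or φ ψ ⌝  = impᶜ (negᶜ ⌜ φ ⌝) ⌜ ψ ⌝
  ⌜ imp φ ψ ⌝ = impᶜ ⌜ φ ⌝ ⌜ ψ ⌝
  ⌜ iff φ ψ ⌝ = andᶜ (impᶜ ⌜ φ ⌝ ⌜ ψ ⌝) (impᶜ ⌜ ψ ⌝ ⌜ φ ⌝)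
  ⌜_⌝ {n} (all φ) = negᶜ (exᶜ (num n) (negᶜ ⌜ φ ⌝))
  ⌜_⌝ {n} (ex φ)  = exᶜ (num n) ⌜ φ ⌝

  imp-formula : ∀ {φ ψ} → IsFormula φ → IsFormula ψ → IsFormula (impᶜ φ ψ)
  imp-formula hφ hψ = neg-formula (and-formula hφ (neg-formula hψ))

  ⌜⌝-formula : ∀ {n} (φ : Formula n) → IsFormula ⌜ φ ⌝
  ⌜⌝-formula (mem i j) = mem-formula (num∈ω (level i)) (num∈ω (level j))
  ⌜⌝-formula (eq i j)  = eq-formula (num∈ω (level i)) (num∈ω (level j))
  ⌜⌝-formula (neg φ)   = neg-formula (⌜⌝-formula φ)
  ⌜⌝-formula (and φ ψ) = and-formula (⌜⌝-formula φ) (⌜⌝-formula ψ)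
  ⌜⌝-formula (or φ ψ)  = imp-formula (neg-formula (⌜⌝-formula φ)) (⌜⌝-formula ψ)
  ⌜⌝-formula (imp φ ψ) = imp-formula (⌜⌝-formula φ) (⌜⌝-formula ψ)
  ⌜⌝-formula (iff φ ψ) = and-formula (imp-formula (⌜⌝-formula φ) (⌜⌝-formula ψ))
                                     (imp-formula (⌜⌝-formula ψ) (⌜⌝-formula φ))
  ⌜⌝-formula {n} (all φ) = neg-formula (ex-formula (num∈ω n) (neg-formula (⌜⌝-formula φ)))
  ⌜⌝-formula {n} (ex φ)  = ex-formula (num∈ω n) (⌜⌝-formula φ)

  Represents : ∀ {A n} → V → Vec (Elt A) n → Set ℓ
  Represents {n = n} s ρ = ∀ (i : Fin n) → ⟨ num (level i) , val (lookup ρ i) ⟩∈ s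

  represents-update : ∀ {A n s} {ρ : Vec (Elt A) n} (a : Elt A) →
                      Represents s ρ → Represents (update s (num n) (val a)) (a ∷ ρ)
  represents-update a rep zero    = ⟨⟩∈-adjoin-new
  represents-update a rep (suc i) = update-old (λ e → <-irrefl (num-inj e) (level< i)) (rep i)

  module _ {A S : V} (sat : IsSatisfaction A S) where

    open Satisfied sat

    ⊨imp : ∀ {φ ψ s} → IsFormula φ → IsFormula ψ → s ∈ Asn A → ⟨ impᶜ φ ψ , s ⟩∈ S ⇔ (⟨ φ , s ⟩∈ S → ⟨ ψ , s ⟩∈ S)
    ⊨imp hφ hψ hs = mk⇔
      (λ h hφs → by-contradiction λ ¬ψs → to (⊨neg (and-formula hφ (neg-formula hψ)) hs) h
         (from (⊨and hφ (neg-formula hψ) hs) (hφs , from (⊨neg hψ hs) ¬ψs)))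
      (λ h → from (⊨neg (and-formula hφ (neg-formula hψ)) hs) λ h′ →
         let φs , ¬ψs = to (⊨and hφ (neg-formula hψ) hs) h′ in to (⊨neg hψ hs) ¬ψs (h φs))

    -- This links elementarity for codes with statements about the structure on A. Recursion on
    -- `Formula` is enough, since the formulas to which elementarity is later applied are all
    -- standard.
    ⌜⌝-sound : ∀ {n} (φ : Formula n) (ρ : Vec (Elt A) n) s → s ∈ Asn A → Represents s ρ → ⟨ ⌜ φ ⌝ , s ⟩∈ S ⇔ ⟦ φ ⟧ₑ ρ
    ⌜⌝-sound (mem i j) ρ s hs rep = let e = ⊨mem (num∈ω (level i)) (num∈ω (level j)) hs in mk⇔
      (λ h → let x , y , ix , jy , x∈y = to e h in
             subst (val (lookup ρ i) ∈_) (asn-single hs jy (rep j)) (subst (_∈ y) (asn-single hs ix (rep i)) x∈y))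
      (λ h → from e (val (lookup ρ i) , val (lookup ρ j) , rep i , rep j , h))
    ⌜⌝-sound (eq i j) ρ s hs rep = let e = ⊨eq (num∈ω (level i)) (num∈ω (level j)) hs in mk⇔
      (λ h → let x , y , ix , jy , x≡y = to e h in
             val-inj (trans (asn-single hs (rep i) ix) (trans x≡y (asn-single hs jy (rep j)))))
      (λ h → from e (val (lookup ρ i) , val (lookup ρ j) , rep i , rep j , cong val {lookup ρ i} {lookup ρ j} h))
    ⌜⌝-sound (neg φ) ρ s hs rep = let e = ⌜⌝-sound φ ρ s hs rep ; e′ = ⊨neg (⌜⌝-formula φ) hs in
      mk⇔ (λ h h′ → to e′ h (from e h′)) (λ h → from e′ λ h′ → h (to e h′))
    ⌜⌝-sound (and φ ψ) ρ s hs rep =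
      let e = ⌜⌝-sound φ ρ s hs rep ; e′ = ⌜⌝-sound ψ ρ s hs rep ; a = ⊨and (⌜⌝-formula φ) (⌜⌝-formula ψ) hs in
      mk⇔ (λ h → to e (proj₁ (to a h)) , to e′ (proj₂ (to a h))) (λ h → from a (from e (proj₁ h) , from e′ (proj₂ h)))
    ⌜⌝-sound (or φ ψ) ρ s hs rep =
      let e = ⌜⌝-sound φ ρ s hs rep ; e′ = ⌜⌝-sound ψ ρ s hs rep
          n = ⊨neg (⌜⌝-formula φ) hs ; a = ⊨imp (neg-formula (⌜⌝-formula φ)) (⌜⌝-formula ψ) hs in
      mk⇔ (λ h → decide (λ ¬φ → to e′ (to a h (from n λ φs → ¬φ (to e φs)))))
          (λ { (inj₁ φs) → from a (λ ¬φs → ⊥-elim (to n ¬φs (from e φs))) ; (inj₂ ψs) → from a λ _ → from e′ ψs })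
      where
      decide : ∀ {B C : Set ℓ} → (¬ B → C) → B ⊎ C
      decide {B} f with em {B}
      ... | yes b = inj₁ b
      ... | no ¬b = inj₂ (f ¬b)
    ⌜⌝-sound (imp φ ψ) ρ s hs rep =
      let e = ⌜⌝-sound φ ρ s hs rep ; e′ = ⌜⌝-sound ψ ρ s hs rep ; a = ⊨imp (⌜⌝-formula φ) (⌜⌝-formula ψ) hs in
      mk⇔ (λ h φs → to e′ (to a h (from e φs))) (λ h → from a λ φs → from e′ (h (to e φs)))
    ⌜⌝-sound (iff φ ψ) ρ s hs rep =
      let e = ⌜⌝-sound φ ρ s hs rep ; e′ = ⌜⌝-sound ψ ρ s hs rep
          hφ = ⌜⌝-formula φ ; hψ = ⌜⌝-formula ψ
          i = ⊨imp hφ hψ hs ; i′ = ⊨imp hψ hφ hs ; a = ⊨and (imp-formula hφ hψ) (imp-formula hψ hφ) hs in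
      mk⇔ (λ h → mk⇔ (λ φs → to e′ (to i (proj₁ (to a h)) (from e φs)))
                     (λ ψs → to e (to i′ (proj₂ (to a h)) (from e′ ψs))))
          (λ h → from a (from i (λ φs → from e′ (to h (to e φs))) , from i′ (λ ψs → from e (from h (to e′ ψs)))))
    ⌜⌝-sound {n} (all φ) ρ s hs rep =
      let hφ = ⌜⌝-formula φ ; x = ⊨ex (num∈ω n) (neg-formula hφ) hs ; ¬x = ⊨neg (ex-formula (num∈ω n) (neg-formula hφ)) hs
          e = λ a → ⌜⌝-sound φ (a ∷ ρ) _ (update-asn hs (num∈ω n) (val∈ a)) (represents-update a rep)
          ¬e = λ {a} (a∈ : a ∈ A) → ⊨neg hφ (update-asn hs (num∈ω n) a∈) in
      mk⇔ (λ h a → by-contradiction λ ¬φa → to ¬x h 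
             (from x (val a , val∈ a , from (¬e (val∈ a)) λ φa → ¬φa (to (e a) φa))))
          (λ h → from ¬x λ ex → let a , a∈ , ¬φa = to x ex in to (¬e a∈) ¬φa (from (e (elt a a∈)) (h (elt a a∈))))
    ⌜⌝-sound {n} (ex φ) ρ s hs rep =
      let x = ⊨ex (num∈ω n) (⌜⌝-formula φ) hs
          e = λ a → ⌜⌝-sound φ (a ∷ ρ) _ (update-asn hs (num∈ω n) (val∈ a)) (represents-update a rep) in
      mk⇔ (λ h → let a , a∈ , φa = to x h in elt a a∈ , to (e (elt a a∈)) φa)
          (λ { (a , φa) → from x (val a , val∈ a , from (e a) φa) })

  -- Assignments are total on ω, so the variables beyond the listed parameters need some value as
  -- well.
  constant-asn : ∀ {A a} → a ∈ A → ∃[ s ] s ∈ Asn A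
  constant-asn {A} {a} a∈ = s , function-asn
      ( (λ p p∈ → ∈-⊗ (proj₁ (to (∈-sep _ _ _) p∈)))
      , (λ k k∈ → a , ⇒⟨⟩ (from (∈-sep _ _ _) (∈-⊗-intro k∈ a∈ , k , isOPair k a)))
      , λ k x y h h′ → trans (elim h) (sym (elim h′)))
    where
    s : V
    s = sep (ω ⊗ A) (a ∷ []) λ { (a ∷ []) p → ∃ᶠ λ k → IsOPairᶠ p k a }
    elim : ∀ {k x} → ⟨ k , x ⟩∈ s → x ≡ a
    elim h with to (∈-sep _ _ _) (⟨⟩⇒ h)
    ... | _ , _ , hp = proj₂ (opair-inj (opair-unique hp))

  representing-asn : ∀ {A a} → a ∈ A → ∀ {n} (ρ : Vec (Elt A) n) → ∃[ s ] s ∈ Asn A × Represents s ρ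
  representing-asn a∈ [] = let s , hs = constant-asn a∈ in s , hs , λ ()
  representing-asn a∈ {suc n} (x ∷ ρ) = let s , hs , rep = representing-asn a∈ ρ in
    update s (num n) (val x) , update-asn hs (num∈ω n) (val∈ x) , represents-update x rep

  -- Elementary submodels and absoluteness for transitive sets

  module Elementary {M H m₀ : V} (M≺H : M ≺ H) (m₀∈ : m₀ ∈ M) where

    incl : Elt M → Elt H
    incl (elt x x∈) = elt x (proj₁ M≺H x x∈)

    represents-incl : ∀ {n s} (ρ : Vec (Elt M) n) → Represents s ρ → Represents s (map incl ρ)
    represents-incl (x ∷ ρ) rep zero    = rep zero
    represents-incl {suc n} {s} (x ∷ ρ) rep (suc i) = represents-incl {n} {s} ρ (λ i → rep (suc i)) i

    -- Elementarity is applied twice: the existential formula passes down to M, where it has a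
    -- witness, and φ at this witness passes back up to H.
    reflects : ∀ {n} (φ : Formula (suc n)) (ρ : Vec (Elt M) n) →
      (∃[ x ] ⟦ φ ⟧ₑ (x ∷ map incl ρ)) → ∃[ x ] ⟦ φ ⟧ₑ (incl x ∷ map incl ρ)
    reflects {n} φ ρ h =
      let s , hs , rep = representing-asn m₀∈ ρ
          hsH = asn-mono (proj₁ M≺H) hs
          satH = proj₂ (satisfaction H) ; satM = proj₂ (satisfaction M)
          hx = ⌜⌝-formula (ex φ) ; hφ = ⌜⌝-formula φ
          inM = from (proj₂ M≺H ⌜ ex φ ⌝ s hx (asn⇒ hs))
            (from (⊨⇔ satH hx hsH) (from (⌜⌝-sound satH (ex φ) (map incl ρ) s hsH (represents-incl ρ rep)) h))
          a , a∈ , φa = to (Satisfied.⊨ex satM (num∈ω n) hφ hs) (to (⊨⇔ satM hx hs) inM)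
          hs′ = update-asn hs (num∈ω n) a∈
          hs′H = asn-mono (proj₁ M≺H) hs′
          inH = to (proj₂ M≺H ⌜ φ ⌝ (update s (num n) a) hφ (asn⇒ hs′)) (from (⊨⇔ satM hφ hs′) φa)
      in elt a a∈ , to (⌜⌝-sound satH φ (incl (elt a a∈) ∷ map incl ρ) _ hs′H
           (represents-update (incl (elt a a∈)) (represents-incl ρ rep))) (to (⊨⇔ satH hφ hs′H) inH)

  module Absolute {H : V} (tr : Transitive H) where

    private module E = SetTheory (_∈ₑ_ {H})

    below : (y : Elt H) → ∀ {x} → x ∈ val y → Elt H
    below y {x} x∈ = elt x (tr (val y) (val∈ y) x x∈)

    empty-abs : ∀ x → E.IsEmpty x → IsEmpty (val x)
    empty-abs x h y y∈ = h (below x y∈) y∈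

    suc-abs : ∀ x y → E.IsSuc x y ⇔ IsSuc (val x) (val y)
    suc-abs x y = mk⇔
      (λ h w → mk⇔ (λ w∈ → [ inj₁ , inj₂ ∘ cong val ]′ (to (h (below x w∈)) w∈))
                   (λ { (inj₁ w∈) → from (h (below y w∈)) (inj₁ w∈) ; (inj₂ refl) → from (h y) (inj₂ refl) }))
      (λ h w → mk⇔ (λ w∈ → [ inj₁ , inj₂ ∘ val-inj ]′ (to (h (val w)) w∈))
                   (λ { (inj₁ w∈) → from (h (val w)) (inj₁ w∈) ; (inj₂ refl) → from (h (val w)) (inj₂ refl) }))

    pair-abs : ∀ z x y → E.IsPair z x y ⇔ IsPair (val z) (val x) (val y)
    pair-abs z x y = mk⇔
      (λ h w → mk⇔ (λ w∈ → [ inj₁ ∘ cong val , inj₂ ∘ cong val ]′ (to (h (below z w∈)) w∈))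
                   (λ { (inj₁ refl) → from (h x) (inj₁ refl) ; (inj₂ refl) → from (h y) (inj₂ refl) }))
      (λ h w → mk⇔ (λ w∈ → [ inj₁ ∘ val-inj , inj₂ ∘ val-inj ]′ (to (h (val w)) w∈))
                   (λ { (inj₁ refl) → from (h (val w)) (inj₁ refl) ; (inj₂ refl) → from (h (val w)) (inj₂ refl) }))

    opair-abs : ∀ p x y → E.IsOPair p x y ⇔ IsOPair (val p) (val x) (val y)
    opair-abs p x y = mk⇔
      (λ { (a , b , ha , hb , hp) →
             val a , val b , to (pair-abs a x x) ha , to (pair-abs b x y) hb , to (pair-abs p a b) hp })
      (λ { (a , b , ha , hb , hp) →
             let a′ = below p (from (hp a) (inj₁ refl)) ; b′ = below p (from (hp b) (inj₂ refl)) in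
             a′ , b′ , from (pair-abs a′ x x) ha , from (pair-abs b′ x y) hb , from (pair-abs p a′ b′) hp })

    ⟨⟩-abs : ∀ x y r → (E.⟨ x , y ⟩∈ r) ⇔ ⟨ val x , val y ⟩∈ val r
    ⟨⟩-abs x y r = mk⇔ (λ { (p , hp , p∈) → val p , to (opair-abs p x y) hp , p∈ })
                       (λ { (p , hp , p∈) → below r p∈ , from (opair-abs (below r p∈) x y) hp , p∈ })

    opair-components : (p : Elt H) → ∀ {x y} → IsOPair (val p) x y → x ∈ H × y ∈ H
    opair-components p {x} {y} (a , b , ha , hb , hp) =
      let b∈ = tr (val p) (val∈ p) b (from (hp b) (inj₂ refl))
      in tr b b∈ x (from (hb x) (inj₁ refl)) , tr b b∈ y (from (hb y) (inj₂ refl))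

    triple-components : (t : Elt H) → ∀ {x y z} → IsTriple (val t) x y z → x ∈ H × y ∈ H × z ∈ H
    triple-components t (p , hp , ht) =
      let x∈ , p∈ = opair-components t ht in x∈ , opair-components (elt p p∈) hp

    triple-abs : ∀ t x y z → E.IsTriple t x y z ⇔ IsTriple (val t) (val x) (val y) (val z)
    triple-abs t x y z = mk⇔
      (λ { (p , hp , ht) → val p , to (opair-abs p y z) hp , to (opair-abs t x p) ht })
      (λ { (p , hp , ht) → let p′ = elt p (proj₂ (opair-components t ht)) in
             p′ , from (opair-abs p′ y z) hp , from (opair-abs t x p′) ht })

  -- The two implications

  -- The first clause, true of ω, is all that is needed to get w ⊆ M by foundation.
  module _ {V′ : Set ℓ} (_∈′_ : V′ → V′ → Set ℓ) where

    private module S = SetTheory _∈′_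

    Enumerates : V′ → V′ → V′ → V′ → Set ℓ
    Enumerates f w D ℙ =
        (∀ x → x ∈′ w → S.IsEmpty x ⊎ (∃[ y ] y ∈′ w × S.IsSuc x y))
      × (∀ n d d′ → S.⟨ d , n ⟩∈ f → S.⟨ d′ , n ⟩∈ f → d ≡ d′)
      × (∃[ P ] ∃[ L ] ∃[ 𝟏 ] S.IsTriple ℙ P L 𝟏 × (∀ p → p ∈′ P →
           ∃[ n ] ∃[ d ] n ∈′ w × S.⟨ d , n ⟩∈ f × d ∈′ D × S.Compatible P L p d))

  -- Levels 0 and 1 are ℙ and D, the parameters given as elements of `M`; P, L and 𝟏 are recovered
  -- from ℙ inside the formula. Levels 2 and 3 are reflected one after the other, w before f.
  enumeratesᶠ : Formula 4
  enumeratesᶠ =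
      (∀ᶠ λ x → x ∈ᶠ w ⇒ᶠ (IsEmptyᶠ x ∨ᶠ (∃ᶠ λ y → y ∈ᶠ w ∧ᶠ IsSucᶠ x y)))
    ∧ᶠ (∀ᶠ λ n → ∀ᶠ λ d → ∀ᶠ λ d′ → ⟨ d , n ⟩∈ᶠ f ⇒ᶠ ⟨ d′ , n ⟩∈ᶠ f ⇒ᶠ d ≡ᶠ d′)
    ∧ᶠ (∃ᶠ λ P → ∃ᶠ λ L → ∃ᶠ λ 𝟏 → (∃ᶠ λ p → IsOPairᶠ p L 𝟏 ∧ᶠ IsOPairᶠ ℙ P p) ∧ᶠ (∀ᶠ λ p → p ∈ᶠ P ⇒ᶠ
         (∃ᶠ λ n → ∃ᶠ λ d → n ∈ᶠ w ∧ᶠ ⟨ d , n ⟩∈ᶠ f ∧ᶠ d ∈ᶠ D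
            ∧ᶠ (∃ᶠ λ r → r ∈ᶠ P ∧ᶠ ⟨ r , p ⟩∈ᶠ L ∧ᶠ ⟨ r , d ⟩∈ᶠ L))))
    where
    f w D ℙ : ℕ
    f = 3
    w = 2
    D = 1
    ℙ = 0

  omega-element : ∀ x → x ∈ ω → IsEmpty x ⊎ (∃[ y ] y ∈ ω × IsSuc x y)
  omega-element = ω-induction (ω ∷ []) (λ { (ω ∷ []) x → IsEmptyᶠ x ∨ᶠ (∃ᶠ λ y → y ∈ᶠ ω ∧ᶠ IsSucᶠ x y) })
    (inj₁ ∅-empty) λ n n∈ _ → inj₂ (n , n∈ , isSuc n)

  module _ {ℙ P L 𝟏 : V} (forcing : IsForcing ℙ P L 𝟏) where

    open IsForcing forcing

    generic-𝟏⇒generic : ∀ {M} → IsGeneric P L M 𝟏 → ∀ q → q ∈ P → IsGeneric P L M q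
    generic-𝟏⇒generic gen q q∈ D pre D∈ = let E , hE , below = gen D pre D∈ in
      E , hE , λ p p∈ _ → below p p∈ (𝟏-maximum p p∈)

    meklerCCC⇒CCC₃ : DC → MeklerCCC ℙ P L → CCC₃ P L
    meklerCCC⇒CCC₃ dc (κ₀ , (oκ₀ , _) , mekler) D pre =
      let M , cM , M≺H , ℙ∈M , D∈M = löwenheim-skolem dc (H-transitive ne hH)
            (in-H (from ∈-pair (inj₁ refl))) (in-H (from ∈-pair (inj₂ refl)))
          E , hE , below = mekler κ (lindenbaum-cardinal X) κ₀⊆κ M (cM , (H , hH , M≺H) , ℙ∈M) 𝟏 𝟏∈P D pre D∈M
      in E , (λ x x∈ → proj₁ (to (hE x) x∈)) , countable-⊆ (λ x x∈ → proj₂ (to (hE x) x∈)) cM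
         , (λ x x∈ → proj₁ pre x (proj₁ (to (hE x) x∈))) , λ p p∈ → below p p∈ (𝟏-maximum p p∈)
      where
      X κ H : V
      -- The pair brings ℙ and D into `H`, and κ₀ is included to obtain κ₀ ⊆ κ.
      X = tc (｛ ℙ , D ｝ ∪ κ₀)
      κ = lindenbaum X
      ne : ∃[ β ] β ∈ κ
      ne = ∅ , ∅∈lindenbaum
      H = proj₁ (H-exists κ (lindenbaum-ordinal X) ne)
      hH : IsH κ H
      hH = proj₂ (H-exists κ (lindenbaum-ordinal X) ne)
      κ₀⊆κ : κ₀ ⊆ κ
      κ₀⊆κ = ⊆lindenbaum oκ₀ λ x x∈ → ⊆-tc x (from ∈-∪ (inj₂ x∈))
      in-H : ∀ {x} → x ∈ ｛ ℙ , D ｝ → x ∈ H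
      in-H x∈ = ∈-small⇒∈H ne hH tc-transitive (lindenbaum-not-image X) (⊆-tc _ (from ∈-∪ (inj₁ x∈)))

    module Reflection {M H D f₀ : V} (tr : Transitive H) (M≺H : M ≺ H) (ℙ∈M : ℙ ∈ M) (D∈M : D ∈ M)
                      (ω∈H : ω ∈ H) (f₀∈H : f₀ ∈ H) {C : V} (C⊆D : C ⊆ D) (C-pre : Predense P L C)
                      (f₀-inj : IsInjection f₀ C ω) where

      open Elementary M≺H ℙ∈M
      open Absolute tr
      private module E = SetTheory (_∈ₑ_ {H})

      ℙₘ Dₘ : Elt M
      ℙₘ = elt ℙ ℙ∈M
      Dₘ = elt D D∈M

      ωₕ fₕ Pₕ Lₕ 𝟏ₕ : Elt H
      ωₕ = elt ω ω∈H
      fₕ = elt f₀ f₀∈H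
      Pₕ = elt P (proj₁ (triple-components (incl ℙₘ) triple))
      Lₕ = elt L (proj₁ (proj₂ (triple-components (incl ℙₘ) triple)))
      𝟏ₕ = elt 𝟏 (proj₂ (proj₂ (triple-components (incl ℙₘ) triple)))

      enumerated : Enumerates _∈ₑ_ fₕ ωₕ (incl Dₘ) (incl ℙₘ)
      enumerated = naturals , injective , Pₕ , Lₕ , 𝟏ₕ , from (triple-abs (incl ℙₘ) Pₕ Lₕ 𝟏ₕ) triple , predense
        where
        naturals : ∀ x → x ∈ₑ ωₕ → E.IsEmpty x ⊎ (∃[ y ] y ∈ₑ ωₕ × E.IsSuc x y)
        naturals x x∈ with omega-element (val x) x∈
        ... | inj₁ empty = inj₁ λ y → empty (val y)
        ... | inj₂ (y , y∈ , hs) = inj₂ (below ωₕ y∈ , y∈ , from (suc-abs x (below ωₕ y∈)) hs)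
        injective : ∀ n d d′ → E.⟨ d , n ⟩∈ fₕ → E.⟨ d′ , n ⟩∈ fₕ → d ≡ d′
        injective n d d′ h h′ = val-inj (proj₂ f₀-inj _ _ _ (to (⟨⟩-abs d n fₕ) h) (to (⟨⟩-abs d′ n fₕ) h′))
        predense : ∀ p → p ∈ₑ Pₕ → ∃[ n ] ∃[ d ] n ∈ₑ ωₕ × E.⟨ d , n ⟩∈ fₕ × d ∈ₑ incl Dₘ × E.Compatible Pₕ Lₕ p d
        predense p p∈ =
          let d , d∈ , r , r∈ , rp , rd = proj₂ C-pre (val p) p∈
              n , dn = proj₁ (proj₂ (proj₁ f₀-inj)) d d∈
              n∈ = function-cod (proj₁ f₀-inj) dn
              nₕ = below ωₕ n∈ ; dₕ = below (incl Dₘ) (C⊆D d d∈) ; rₕ = below Pₕ r∈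
          in nₕ , dₕ , n∈ , from (⟨⟩-abs dₕ nₕ fₕ) dn , C⊆D d d∈ , rₕ , r∈
             , from (⟨⟩-abs rₕ p Lₕ) rp , from (⟨⟩-abs rₕ dₕ Lₕ) rd

      -- The sets `ω` and `f₀` witness the formula in `H`, and elementarity moves the witnesses into
      -- `M`. The new f need not be `f₀`, nor its domain C; it only inherits injectivity and the
      -- predensity of the members of D that it numbers.
      enumeration : ∃[ w ] ∃[ f ] Enumerates _∈ₑ_ (incl f) (incl w) (incl Dₘ) (incl ℙₘ)
      enumeration =
        let w , h = reflects (ex enumeratesᶠ) (Dₘ ∷ ℙₘ ∷ []) (ωₕ , fₕ , enumerated)
            f , h′ = reflects enumeratesᶠ (w ∷ Dₘ ∷ ℙₘ ∷ []) h
        in w , f , h′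

      module _ {w f : Elt M} (enum : Enumerates _∈ₑ_ (incl f) (incl w) (incl Dₘ) (incl ℙₘ)) where

        -- An ∈-minimal element of w outside M would be empty or the successor of some z in w, and z
        -- is in M by minimality. Elementarity puts the empty set and the successor of z into M. So
        -- w is treated without being identified with `ω`.
        w⊆M : val w ⊆ M
        w⊆M x x∈w = by-contradiction λ x∉M →
            least (foundation B (x , from (∈-sep _ _ _) (x∈w , x∉M)))
          where
          B : V
          B = sep (val w) (M ∷ []) λ { (M ∷ []) x → ¬ᶠ (x ∈ᶠ M) }
          least : ¬ (∃[ y ] y ∈ B × (∀ z → z ∈ y → z ∉ B))
          least (y , y∈B , min) with to (∈-sep _ _ _) y∈B
          ... | y∈w , y∉M with proj₁ enum (below (incl w) y∈w) y∈w
          ...   | inj₁ empty =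
            let z , hz = reflects (IsEmptyᶠ 0) [] (below (incl w) y∈w , empty)
            in y∉M (subst (_∈ M) (trans (empty⇒≡∅ (empty-abs (incl z) hz))
                     (sym (empty⇒≡∅ (empty-abs (below (incl w) y∈w) empty)))) (val∈ z))
          ...   | inj₂ (z , z∈w , hs) =
            let y≡ = suc-unique (to (suc-abs (below (incl w) y∈w) z) hs)
                z∈y = subst (val z ∈_) (sym y≡) n∈succ
                zₘ = elt (val z) (by-contradiction λ z∉M → min (val z) z∈y (from (∈-sep _ _ _) (z∈w , z∉M)))
                u , hu = reflects (IsSucᶠ 1 0) (zₘ ∷ []) (below (incl w) y∈w , hs)
            in y∉M (subst (_∈ M) (trans (suc-unique (to (suc-abs (incl u) (incl zₘ)) hu)) (sym y≡)) (val∈ u))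

        -- The condition p need not lie in `M`. Predensity is read in `H`, where it yields some d
        -- compatible with p, and then only the index n of d serves to locate d in `M`.
        meets-M : ∀ p → p ∈ P → ∃[ d ] (d ∈ D × d ∈ M) × Compatible P L p d
        meets-M p p∈ = from-triple (proj₂ (proj₂ enum))
          where
          from-triple : (∃[ P′ ] ∃[ L′ ] ∃[ 𝟏′ ] E.IsTriple (incl ℙₘ) P′ L′ 𝟏′ × (∀ p → p ∈ₑ P′ →
              ∃[ n ] ∃[ d ] n ∈ₑ incl w × E.⟨ d , n ⟩∈ incl f × d ∈ₑ incl Dₘ × E.Compatible P′ L′ p d)) →
            ∃[ d ] (d ∈ D × d ∈ M) × Compatible P L p d
          from-triple (P′ , L′ , 𝟏′ , t , pre)
            with opair-inj (trans (sym (triple-unique triple)) (triple-unique (to (triple-abs (incl ℙₘ) P′ L′ 𝟏′) t)))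
          ... | refl , e with opair-inj e
          ... | refl , refl =
            let pₕ = below P′ p∈
                n , d , n∈w , dn , d∈ , r , r∈ , rp , rd = pre pₕ p∈
                -- Both n and f are in `M`, so some d′ in `M` has index n; injectivity of f gives d
                -- = d′.
                d′ , d′n = reflects (⟨ 2 , 1 ⟩∈ᶠ 0) (elt (val n) (w⊆M (val n) n∈w) ∷ f ∷ []) (d , dn)
                d≡ = cong val (proj₁ (proj₂ enum) n d (incl d′) dn d′n)
            in val d , (d∈ , subst (_∈ M) (sym d≡) (val∈ d′))
               , val r , r∈ , to (⟨⟩-abs r pₕ L′) rp , to (⟨⟩-abs r d L′) rd

    CCC₃⇒meklerCCC : CCC₃ P L → MeklerCCC ℙ P L
    CCC₃⇒meklerCCC ccc = κ₀ , lindenbaum-cardinal X , λ κ _ κ₀⊆κ M hM q _ D pre D∈M →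
        D∩M D M , (λ z → ∈-sep D (M ∷ []) _) , λ p p∈ _ → generic κ κ₀⊆κ M hM D pre D∈M p p∈
      where
      X κ₀ : V
      -- An injection into ω of any subset of P is an element of `𝒫 (P ⊗ ω)`, so κ₀ can be fixed
      -- before D and C are known.
      X = tc ｛ 𝒫 (P ⊗ ω) , ω ｝
      κ₀ = lindenbaum X
      D∩M : V → V → V
      D∩M D M = sep D (M ∷ []) λ { (M ∷ []) x → x ∈ᶠ M }
      generic : ∀ κ → κ₀ ⊆ κ → ∀ M → IsCountableSubmodel ℙ κ M → ∀ D → Predense P L D → D ∈ M →
                ∀ p → p ∈ P → ∃[ d ] d ∈ D∩M D M × Compatible P L p d
      generic κ κ₀⊆κ M (_ , (H , hH , M≺H) , ℙ∈M) D pre D∈M p p∈ with ccc D pre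
      ... | C , C⊆D , (w , f , hw , f-inj) , C-pre with omega-unique hw
      ... | refl =
        let w , f , enum = enumeration
            d , d∈ , c = meets-M {w} {f} enum p p∈
        in d , from (∈-sep _ _ _) d∈ , c
        where
        ne : ∃[ β ] β ∈ κ
        ne = ∅ , κ₀⊆κ ∅ ∅∈lindenbaum
        in-H : ∀ {x} → x ∈ X → x ∈ H
        in-H = ∈-small⇒∈H ne hH tc-transitive λ onto →
          lindenbaum-not-image X (mapsOnto-mono (λ _ → id) κ₀⊆κ (∅ , ∅∈lindenbaum) onto)
        f∈ : f ∈ 𝒫 (P ⊗ ω)
        f∈ = from ∈-𝒫 λ p p∈ → let x , y , x∈ , y∈ , hp = proj₁ (proj₁ f-inj) p p∈ in
          subst (_∈ (P ⊗ ω)) (sym (opair-unique hp)) (∈-⊗-intro (proj₁ C-pre x x∈) y∈)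
        ω∈H : ω ∈ H
        ω∈H = in-H (⊆-tc ω (from ∈-pair (inj₂ refl)))
        f∈H : f ∈ H
        f∈H = in-H (tc-transitive _ (⊆-tc _ (from ∈-pair (inj₁ refl))) f f∈)
        open Reflection (H-transitive ne hH) M≺H ℙ∈M D∈M ω∈H f∈H C⊆D C-pre f-inj

proposition5p1 : ∀ {ℓ} → ExcludedMiddle ℓ →
    {V : Set ℓ} (_∈_ : V → V → Set ℓ) → let open SetTheory _∈_ in
    IsZF → DC →
    ∀ ℙ P L 𝟏 → IsForcing ℙ P L 𝟏 →
    (CCC₃ P L ⇔ MeklerCCC ℙ P L)
    × (∀ κ M → IsCardinal κ → IsCountableSubmodel ℙ κ M →
    (∀ q → q ∈ P → IsGeneric P L M q) ⇔ IsGeneric P L M 𝟏)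
proposition5p1 em _∈_ zf dc ℙ P L 𝟏 forcing =
    mk⇔ (CCC₃⇒meklerCCC forcing) (meklerCCC⇒CCC₃ forcing dc)
  , λ κ M _ _ → mk⇔ (λ generic → generic 𝟏 (SetTheory.IsForcing.𝟏∈P forcing)) (generic-𝟏⇒generic forcing)
  where open ZF em _∈_ zf
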